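{- Let $1\le t<k$ and $s\ge1$ be integers with $k\ge 3$. There exists $n_0=n_0(k,t,s)$ such that for all $n\ge n_0$ and every $\mathcal{F}\subseteq\binom{[n]}{k}$ with $\nu_t(\mathcal{F})=s<\tau_t(\mathcal{F})$, we have $|\mathcal{F}|\le|\mathcal{H}_t^{(k)}(n,s)|$, where: (i) if $t+1\le k\le 2t+1$, $$\mathcal{H}_t^{(k)}(n,s)=\Big\{F\in\tbinom{[n]}{k}:[(r-1)t+1,rt]\subseteq F\text{ for some }1\le r\le s-1\Big\}\cup\Big\{F\in\tbinom{[n]}{k}:|F\cap[(s-1)t+1,st+2]|\ge t+1\Big\};$$ (ii) if $k>2t+1$, $$\mathcal{H}_t^{(k)}(n,s)=\Big\{F\in\tbinom{[n]}{k}:[(r-1)t+1,rt]\subseteq F\text{ for some }1\le r\le s-1\Big\}\cup\Big\{F\in\tbinom{[n]}{k}:[(s-1)t+1,st]\subseteq F,\ F\cap[st+1,(s-1)t+k+1]\ne\emptyset\Big\}$$ $$\cup\Big\{[(s-1)t+1,(s-1)t+k+1]\setminus\{i\}:(s-1)t+1\le i\le (s-1)t+k+1\Big\}.$$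
   Context: $[a,b]=\{a,a+1,\dots,b\}$, $[n]=[1,n]$, and $\binom{[n]}{k}$ is the family of $k$-subsets of $[n]$. A $t$-matching of size $m$ is a collection of $m$ distinct sets $A_1,\dots,A_m\in\binom{[n]}{k}$ with $|A_i\cap A_j|<t$ for all $i\ne j$; $\nu_t(\mathcal{F})$ is the maximum size of a $t$-matching contained in $\mathcal{F}$. A family $\mathcal{C}\subseteq\binom{[n]}{t}$ is a $t$-covering family of $\mathcal{F}$ if every $F\in\mathcal{F}$ contains some $C\in\mathcal{C}$; $\tau_t(\mathcal{F})$ is the minimum size of a $t$-covering family of $\mathcal{F}$. -}

module Defs where

open import Data.Nat using (ℕ; zero; suc; _+_; _*_; _∸_; _≤_; _<_; _⊔_; _≤ᵇ_; _≡ᵇ_)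
open import Data.Bool using (Bool; true; false; _∧_; _∨_; not; if_then_else_)
open import Data.List using (List; []; _∷_; map; length; upTo; _++_)
open import Data.Bool.ListAction using (all; any)
open import Data.Nat.ListAction using (sum)
open import Data.List.Membership.Propositional using () renaming (_∈_ to _∈ₗ_)
open import Data.List.Relation.Unary.All using (All)
open import Data.List.Relation.Unary.AllPairs using (AllPairs)
open import Data.List.Relation.Unary.Unique.Propositional using (Unique)
open import Data.Vec using (Vec; []; _∷_)
open import Data.Fin.Subset using (Subset; _∩_; _⊆_; ∣_∣)
open import Data.Product using (Σ; _×_; ∃)
open import Relation.Binary.PropositionalEquality using (_≡_)

-- Conventions: a subset of [n] = {1,…,n} is a `Subset n`; position
-- i : Fin n stands for the element i+1.  A family 𝓕 ⊆ binom([n],k) is a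
-- duplicate-free list of subsets each of size k; |𝓕| = length 𝓕.

allSubsets : (n : ℕ) → List (Subset n)
allSubsets zero = [] ∷ []
allSubsets (suc n) = map (true ∷_) (allSubsets n) ++ map (false ∷_) (allSubsets n)

mem0 : ∀ {n} → Subset n → ℕ → Bool
mem0 [] _ = false
mem0 (x ∷ _) zero = x
mem0 (_ ∷ xs) (suc j) = mem0 xs j

-- membership of the natural number j in A ⊆ [n] (1-based)
memℕ : ∀ {n} → Subset n → ℕ → Bool
memℕ A zero = false
memℕ A (suc j) = mem0 A j

range : ℕ → ℕ → List ℕ
range a b = map (a +_) (upTo (suc b ∸ a))

intervalIn : ∀ {n} → ℕ → ℕ → Subset n → Bool
intervalIn a b A = all (memℕ A) (range a b)

countIn : ∀ {n} → ℕ → ℕ → Subset n → ℕ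
countIn a b A = sum (map (λ j → if memℕ A j then 1 else 0) (range a b))

-- A = [a,b] ∖ {i} for some i ∈ [a,b]  (equality as sets of naturals:
-- checked on all j ∈ [1, max(n,b)], elements > n never lie in A)
intervalMinusPoint : ∀ {n} → ℕ → ℕ → Subset n → Bool
intervalMinusPoint {n} a b A =
  any (λ i → all (λ j → eqB (memℕ A j) ((a ≤ᵇ j) ∧ (j ≤ᵇ b) ∧ not (j ≡ᵇ i)))
                 (range 1 (n ⊔ b)))
      (range a b)
  where
  eqB : Bool → Bool → Bool
  eqB true y = y
  eqB false y = not y

-- membership in H_t^{(k)}(n,s) (the k-uniformity is added in |H|)
-- first part: [(r-1)t+1, rt] ⊆ F for some 1 ≤ r ≤ s-1
Hpart1 : ∀ {n} → ℕ → ℕ → Subset n → Bool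
Hpart1 t s A = any (λ r → intervalIn ((r ∸ 1) * t + 1) (r * t) A) (range 1 (s ∸ 1))

HmemI : ∀ {n} → ℕ → ℕ → ℕ → Subset n → Bool
HmemI k t s A =
  Hpart1 t s A ∨ ((t + 1) ≤ᵇ countIn ((s ∸ 1) * t + 1) (s * t + 2) A)

HmemII : ∀ {n} → ℕ → ℕ → ℕ → Subset n → Bool
HmemII k t s A =
  Hpart1 t s A
  ∨ (intervalIn ((s ∸ 1) * t + 1) (s * t) A
       ∧ (1 ≤ᵇ countIn (s * t + 1) ((s ∸ 1) * t + k + 1) A))
  ∨ intervalMinusPoint ((s ∸ 1) * t + 1) ((s ∸ 1) * t + k + 1) A

Hmem : ∀ {n} → ℕ → ℕ → ℕ → Subset n → Bool
Hmem k t s A = if k ≤ᵇ 2 * t + 1 then HmemI k t s A else HmemII k t s A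

sizeH : ℕ → ℕ → ℕ → ℕ → ℕ
sizeH n k t s =
  sum (map (λ A → if (∣ A ∣ ≡ᵇ k) ∧ Hmem k t s A then 1 else 0) (allSubsets n))

IsTMatching : ∀ {n} → ℕ → List (Subset n) → Set
IsTMatching t M = Unique M × AllPairs (λ A B → ∣ A ∩ B ∣ < t) M

TMatchingIn : ∀ {n} → ℕ → List (Subset n) → List (Subset n) → Set
TMatchingIn t 𝓕 M = IsTMatching t M × All (_∈ₗ 𝓕) M

NuEq : ∀ {n} → ℕ → List (Subset n) → ℕ → Set
NuEq {n} t 𝓕 s =
  (Σ (List (Subset n)) λ M → TMatchingIn t 𝓕 M × length M ≡ s)
  × (∀ (M : List (Subset n)) → TMatchingIn t 𝓕 M → length M ≤ s)

IsTCovering : ∀ {n} → ℕ → List (Subset n) → List (Subset n) → Set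
IsTCovering t 𝓕 𝓒 =
  Unique 𝓒 × All (λ C → ∣ C ∣ ≡ t) 𝓒
  × (∀ {F} → F ∈ₗ 𝓕 → ∃ λ C → C ∈ₗ 𝓒 × C ⊆ F)

TauGt : ∀ {n} → ℕ → List (Subset n) → ℕ → Set
TauGt {n} t 𝓕 s = ∀ (𝓒 : List (Subset n)) → IsTCovering t 𝓕 𝓒 → s < length 𝓒

{-# OPTIONS --safe #-}
module Submission where

-- The t-sets T whose degree in 𝓕 exceeds a constant times d(t+1), where d(j) is the number
-- of k-sets through a fixed j-set, extend greedily to a t-matching together with any smaller
-- t-matching none of whose members contains such a T. Since ν = s < τ there are at most s−1
-- of them, and all but O(d(t+1)) members of 𝓕 contain one. With fewer than s−1 the family is
-- too small. With exactly s−1, the members that contain none of them form a non-trivial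
-- t-intersecting family 𝓖. Its (t+1)-sets of large degree pairwise meet in t points, so they
-- form a sunflower with at most k−t+1 petals or lie in a (t+2)-set; unless their number is
-- max(t+2, k−t+1) the family is again too small, and otherwise 𝓖 lies in a Hilton–Milner
-- family or in {F : |F ∩ Y| ≥ t+1}. It remains to see that pulling the kernels apart does not
-- decrease the union: replacing a point x in one kernel by an unused point y is
-- non-decreasing, by pairing F ∋ x with (F ∖ x) ∪ y. For k = 2t+1 both exceptional families
-- have the same leading term and are compared by an explicit injection.

open import Defs
import Data.Bool as Bool
open import Data.Bool using (Bool; true; false; if_then_else_)
open import Data.Bool.ListAction using (all; any)
open import Data.Bool.Properties using (T-≡; ∨-zeroʳ)
import Data.Empty as Empty
open import Data.Empty using (⊥-elim)
import Data.Fin as Fin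
open import Data.Fin using (Fin; zero; suc)
import Data.Fin.Properties as Fin
open import Data.Fin.Subset using (Subset; _∈_; _∉_; _⊆_; _∩_; _∪_; _─_; _-_; ⊥; ∣_∣; ⋃; ⁅_⁆; ⊤)
open import Data.Fin.Subset.Properties
open import Data.List using (List; []; _∷_; length; map; filter; _++_; foldr; take; allFin; upTo; concatMap)
import Data.List.Membership.DecPropositional as DecMembership
open import Data.List.Membership.Propositional using (find; lose) renaming (_∈_ to _∈ₗ_)
open import Data.List.Membership.Propositional.Properties using (∈-map⁺; ∈-map⁻; ∈-++⁺ˡ; ∈-++⁺ʳ; ∈-filter⁺; ∈-filter⁻; ∈-∃++; ∈-++⁻; ∈-upTo⁺; ∈-upTo⁻; ∈-concatMap⁺; ∈-concatMap⁻)
open import Data.List.Properties using (length-map; length-take; length-++; length-tabulate; length-upTo; map-++; map-∘)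
import Data.List.Relation.Unary.All as All
open import Data.List.Relation.Unary.All using (All; []; _∷_)
import Data.List.Relation.Unary.All.Properties as All
open import Data.List.Relation.Unary.AllPairs using (AllPairs; []; _∷_)
import Data.List.Relation.Unary.AllPairs.Properties as AllPairs
import Data.List.Relation.Unary.Any as Any
open import Data.List.Relation.Unary.Any using (Any; here; there)
open import Data.List.Relation.Unary.Unique.Propositional using (Unique)
import Data.List.Relation.Unary.Unique.Propositional.Properties as Unique
open import Data.Nat hiding (∣_-_∣)
open import Data.Nat.Combinatorics using (_C_; nCk+nC[k+1]≡[n+1]C[k+1]; nC1≡n; nCn≡1; nCk≡nC[n∸k])
open import Data.Nat.DivMod using (_mod_; m<n⇒m%n≡m)
open import Data.Nat.ListAction using (sum)
open import Data.Nat.ListAction.Properties using (sum-++)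
open import Data.Nat.Properties
open import Data.Nat.Tactic.RingSolver using (solve-∀)
open import Data.Product using (Σ; _×_; ∃; _,_; proj₁; proj₂)
import Data.Product.Properties as Product
import Data.Sum as Sum
open import Data.Sum using (_⊎_; inj₁; inj₂; [_,_]′)
open import Data.Vec using ([]; _∷_; lookup; _[_]≔_; here; there)
open import Data.Vec.Properties using (≡-dec; lookup∘updateAt; lookup∘updateAt′; []≔-commutes; []≔-idempotent; []=⇒lookup; lookup⇒[]=)
open import Function using (_∘_; id)
open import Function.Bundles using (Equivalence)
open import Relation.Binary using (tri<; tri≈; tri>)
open import Relation.Binary.PropositionalEquality
open import Relation.Nullary using (Dec; yes; no; ¬_; contradiction)
open import Relation.Nullary.Decidable using (_×-dec_; _⊎-dec_; ¬?; map′)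
open import Relation.Unary using (Decidable)

-- Orders of magnitude settle a case only when one side is short by a whole leading term. For large
-- n, d(j) exceeds any fixed multiple of d(j+1), so a missing kernel costs more than all errors of
-- order d(t+1), and a missing (t+1)-set more than all errors of order d(t+2). With s-1 kernels this
-- no longer suffices for the stars: overlaps between kernels already change the count at order
-- d(t+1), the order at which the exceptional parts differ. The stars, and the stars together with a
-- complete exceptional block, are therefore compared exactly, by point exchanges that lose nothing;
-- estimates enter only for an exceptional part with too few (t+1)-sets. The hypothesis s < τ is
-- used twice: it lowers the number of kernels from s to s-1, and with exactly s-1 kernels it makes
-- the remaining members non-trivial, since one more t-set would otherwise complete a covering of
-- size s. To keep the exchanges exact, families are decidable predicates counted over all subsets
-- of [n], so that an exchange of two points becomes a comparison of summands.

private variable n : ℕ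

-- Counting subsets by a predicate

S : (Subset n → ℕ) → ℕ
S {zero} f = f []
S {suc n} f = S (λ A → f (true ∷ A)) + S (λ A → f (false ∷ A))

S-mono : {f g : Subset n → ℕ} → (∀ A → f A ≤ g A) → S f ≤ S g
S-mono {zero} h = h []
S-mono {suc n} h = +-mono-≤ (S-mono (λ A → h (true ∷ A))) (S-mono (λ A → h (false ∷ A)))

S-+ : (f g : Subset n → ℕ) → S (λ A → f A + g A) ≡ S f + S g
S-+ {zero} f g = refl
S-+ {suc n} f g = trans
  (cong₂ _+_ (S-+ (f ∘ (true ∷_)) (g ∘ (true ∷_))) (S-+ (f ∘ (false ∷_)) (g ∘ (false ∷_))))
  (+-interchange (S (f ∘ (true ∷_))) _ (S (f ∘ (false ∷_))) _)
  where
  +-interchange : ∀ a b c d → (a + b) + (c + d) ≡ (a + c) + (b + d)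
  +-interchange = solve-∀

-- A set and its flip at `x` give the same summand on the right, so every value of `f` occurs twice.
-- Doubling replaces a bijection between the sets with and without `x`.
S-flip : (f : Subset n → ℕ) (x : Fin n) →
  S f + S f ≡ S (λ A → f (A [ x ]≔ true) + f (A [ x ]≔ false))
S-flip {suc n} f zero = sym (cong₂ _+_ half half)
  where
  half : S (λ A → f (true ∷ A) + f (false ∷ A)) ≡ S f
  half = S-+ (f ∘ (true ∷_)) (f ∘ (false ∷_))
S-flip {suc n} f (suc x) = trans (swap-mid (S (f ∘ (true ∷_))) (S (f ∘ (false ∷_))))
  (cong₂ _+_ (S-flip (f ∘ (true ∷_)) x) (S-flip (f ∘ (false ∷_)) x))
  where
  swap-mid : ∀ a b → (a + b) + (a + b) ≡ (a + a) + (b + b)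
  swap-mid = solve-∀

𝟙 : {P : Set} → Dec P → ℕ
𝟙 (yes _) = 1
𝟙 (no _) = 0

𝟙-mono : {P Q : Set} (P? : Dec P) (Q? : Dec Q) → (P → Q) → 𝟙 P? ≤ 𝟙 Q?
𝟙-mono (no _) _ _ = z≤n
𝟙-mono (yes p) (yes _) _ = s≤s z≤n
𝟙-mono (yes p) (no ¬q) h = contradiction (h p) ¬q

𝟙-⊎ : {P Q R : Set} (P? : Dec P) (Q? : Dec Q) (R? : Dec R) → (P → Q ⊎ R) → 𝟙 P? ≤ 𝟙 Q? + 𝟙 R?
𝟙-⊎ (no _) _ _ _ = z≤n
𝟙-⊎ (yes _) (yes _) _ _ = s≤s z≤n
𝟙-⊎ (yes _) (no _) (yes _) _ = s≤s z≤n
𝟙-⊎ (yes p) (no ¬q) (no ¬r) h = contradiction (h p) [ ¬q , ¬r ]′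

𝟙-disj : {P Q R : Set} (P? : Dec P) (Q? : Dec Q) (R? : Dec R) →
  (P → R) → (Q → R) → (P → ¬ Q) → 𝟙 P? + 𝟙 Q? ≤ 𝟙 R?
𝟙-disj (no _) Q? R? _ h _ = 𝟙-mono Q? R? h
𝟙-disj (yes p) (yes q) _ _ _ h = contradiction q (h p)
𝟙-disj (yes p) (no _) (yes _) _ _ _ = s≤s z≤n
𝟙-disj (yes p) (no _) (no ¬r) h _ _ = contradiction (h p) ¬r

-- The shape of a compression on an exchange pair: a set on the high side may stay or move, while
-- one on the low side forces both into the new family.
𝟙-pair : {P P′ Q Q′ : Set} (P? : Dec P) (P′? : Dec P′) (Q? : Dec Q) (Q′? : Dec Q′) →
  (P → Q ⊎ Q′) → (P′ → Q × Q′) → 𝟙 P? + 𝟙 P′? ≤ 𝟙 Q? + 𝟙 Q′?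
𝟙-pair (no _) (no _) _ _ _ _ = z≤n
𝟙-pair (yes p) (no _) (yes _) _ _ _ = s≤s z≤n
𝟙-pair (yes p) (no _) (no _) (yes _) _ _ = s≤s z≤n
𝟙-pair (yes p) (no _) (no ¬q) (no ¬q′) h _ = contradiction (h p) [ ¬q , ¬q′ ]′
𝟙-pair _ (yes p′) (no ¬q) _ _ h = contradiction (proj₁ (h p′)) ¬q
𝟙-pair _ (yes p′) (yes _) (no ¬q′) _ h = contradiction (proj₂ (h p′)) ¬q′
𝟙-pair (no _) (yes p′) (yes _) (yes _) _ _ = s≤s z≤n
𝟙-pair (yes _) (yes p′) (yes _) (yes _) _ _ = ≤-refl

# : {P : Subset n → Set} → Decidable P → ℕ
# P? = S (λ A → 𝟙 (P? A))

#-mono : {P Q : Subset n → Set} (P? : Decidable P) (Q? : Decidable Q) →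
  (∀ A → P A → Q A) → # P? ≤ # Q?
#-mono P? Q? h = S-mono (λ A → 𝟙-mono (P? A) (Q? A) (h A))

#-⊎ : {P Q R : Subset n → Set} (P? : Decidable P) (Q? : Decidable Q) (R? : Decidable R) →
  (∀ A → P A → Q A ⊎ R A) → # P? ≤ # Q? + # R?
#-⊎ P? Q? R? h = ≤-trans (S-mono (λ A → 𝟙-⊎ (P? A) (Q? A) (R? A) (h A)))
  (≤-reflexive (S-+ (𝟙 ∘ Q?) (𝟙 ∘ R?)))

#-disj : {P Q R : Subset n → Set} (P? : Decidable P) (Q? : Decidable Q) (R? : Decidable R) →
  (∀ A → P A → R A) → (∀ A → Q A → R A) → (∀ A → P A → ¬ Q A) → # P? + # Q? ≤ # R?
#-disj P? Q? R? h₁ h₂ h₃ = ≤-trans (≤-reflexive (sym (S-+ (𝟙 ∘ P?) (𝟙 ∘ Q?))))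
  (S-mono (λ A → 𝟙-disj (P? A) (Q? A) (R? A) (h₁ A) (h₂ A) (h₃ A)))

#-none : {P : Subset n → Set} (P? : Decidable P) → (∀ A → ¬ P A) → # P? ≡ 0
#-none {zero} P? h with P? []
... | yes p = contradiction p (h [])
... | no _ = refl
#-none {suc n} P? h = cong₂ _+_ (#-none (P? ∘ (true ∷_)) (h ∘ (true ∷_)))
                                (#-none (P? ∘ (false ∷_)) (h ∘ (false ∷_)))

#-positive : {P : Subset n → Set} (P? : Decidable P) (A : Subset n) → P A → 1 ≤ # P?
#-positive P? [] p with P? []
... | yes _ = s≤s z≤n
... | no ¬p = contradiction p ¬p
#-positive P? (true ∷ A) p = m≤n⇒m≤n+o _ (#-positive (P? ∘ (true ∷_)) A p)
#-positive P? (false ∷ A) p = m≤n⇒m≤o+n _ (#-positive (P? ∘ (false ∷_)) A p)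

_≟ₛ_ : (A B : Subset n) → Dec (A ≡ B)
_≟ₛ_ = ≡-dec Bool._≟_

#-length : {P : Subset n → Set} (P? : Decidable P) {L : List (Subset n)} →
  Unique L → All P L → length L ≤ # P?
#-length P? [] [] = z≤n
#-length P? {A ∷ L} (u ∷ us) (p ∷ ps) = ≤-trans
  (+-mono-≤ (#-positive (A ≟ₛ_) A refl)
            (#-length (λ B → P? B ×-dec ¬? (A ≟ₛ B)) us (All.zip (ps , u))))
  (#-disj (A ≟ₛ_) (λ B → P? B ×-dec ¬? (A ≟ₛ B)) P?
    (λ { B refl → p }) (λ _ → proj₁) (λ B e q → proj₂ q e))

#-any : {X : Set} (L : List X) {P : Subset n → Set} (P? : Decidable P)
  {Q : X → Subset n → Set} (Q? : ∀ x → Decidable (Q x)) (D : ℕ) →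
  (∀ A → P A → ∃ λ x → x ∈ₗ L × Q x A) → (∀ x → x ∈ₗ L → # (Q? x) ≤ D) →
  # P? ≤ length L * D
#-any [] P? Q? D h b = ≤-reflexive (#-none P? (λ A p → ∉[] (h A p)))
  where
  ∉[] : ∀ {X : Set} {R : X → Set} → ¬ ∃ (λ x → x ∈ₗ [] × R x)
  ∉[] (_ , () , _)
#-any (x ∷ L) P? {Q} Q? D h b = ≤-trans
  (#-⊎ P? (Q? x) (λ A → P? A ×-dec ¬? (Q? x A)) split)
  (+-mono-≤ (b x (here refl))
    (#-any L (λ A → P? A ×-dec ¬? (Q? x A)) Q? D later (λ y i → b y (there i))))
  where
  split : ∀ A → _ → _
  split A p with Q? x A
  ... | yes q = inj₁ q
  ... | no ¬q = inj₂ (p , ¬q)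
  later : ∀ A → _ → ∃ λ y → y ∈ₗ L × Q y A
  later A (p , ¬q) with h A p
  ... | _ , here refl , q = contradiction q ¬q
  ... | y , there i , q = y , i , q

private
  flip-twice : {f : Subset n → ℕ} (x y : Fin n) →
    (S f + S f) + (S f + S f) ≡
      S (λ A → (f (A [ y ]≔ true [ x ]≔ true) + f (A [ y ]≔ true [ x ]≔ false))
             + (f (A [ y ]≔ false [ x ]≔ true) + f (A [ y ]≔ false [ x ]≔ false)))
  flip-twice {f = f} x y = trans (cong₂ _+_ (S-flip f x) (S-flip f x)) (S-flip _ y)

-- Summing over both values at `x` and at `y` counts every set four times. Of the four sets that
-- agree off `x` and `y`, those with both points or neither are compared by the second hypothesis,
-- the other two jointly by the first.
S-exchange : {f g : Subset n → ℕ} {x y : Fin n} → x ≢ y →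
  (∀ A → lookup A x ≡ true → lookup A y ≡ false →
     f A + f (A [ x ]≔ false [ y ]≔ true) ≤ g A + g (A [ x ]≔ false [ y ]≔ true)) →
  (∀ A → lookup A x ≡ lookup A y → f A ≤ g A) →
  S f ≤ S g
S-exchange {f = f} {g} {x} {y} x≢y h₁ h₂ = quarter
  (≤-trans (≤-reflexive (flip-twice x y))
    (≤-trans (S-mono step) (≤-reflexive (sym (flip-twice x y)))))
  where
  quarter : ∀ {a b} → (a + a) + (a + a) ≤ (b + b) + (b + b) → a ≤ b
  quarter {a} {b} le with a ≤? b
  ... | yes p = p
  ... | no a≰b = contradiction le
    (<⇒≱ (+-mono-< (+-mono-< b<a b<a) (+-mono-< b<a b<a)))
    where b<a = ≰⇒> a≰b
  at-x : ∀ A b c → lookup (A [ y ]≔ c [ x ]≔ b) x ≡ b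
  at-x A b c = lookup∘updateAt x (A [ y ]≔ c)
  at-y : ∀ A b c → lookup (A [ y ]≔ c [ x ]≔ b) y ≡ c
  at-y A b c = trans (lookup∘updateAt′ y x (x≢y ∘ sym) (A [ y ]≔ c)) (lookup∘updateAt y A)
  moved : ∀ A → A [ y ]≔ false [ x ]≔ true [ x ]≔ false [ y ]≔ true ≡ A [ y ]≔ true [ x ]≔ false
  moved A = begin
    A [ y ]≔ false [ x ]≔ true [ x ]≔ false [ y ]≔ true
      ≡⟨ cong (_[ y ]≔ true) ([]≔-idempotent (A [ y ]≔ false) x) ⟩
    A [ y ]≔ false [ x ]≔ false [ y ]≔ true
      ≡⟨ []≔-commutes (A [ y ]≔ false) x y x≢y ⟩
    A [ y ]≔ false [ y ]≔ true [ x ]≔ false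
      ≡⟨ cong (_[ x ]≔ false) ([]≔-idempotent A y) ⟩
    A [ y ]≔ true [ x ]≔ false ∎
    where open ≡-Reasoning
  regroup : ∀ a b c d → (a + b) + (c + d) ≡ (a + d) + (c + b)
  regroup = solve-∀
  step : ∀ A → _ ≤ _
  step A = subst₂ _≤_ (sym (regroup (f A₁₁) (f A₁₀) (f A₀₁) (f A₀₀)))
                      (sym (regroup (g A₁₁) (g A₁₀) (g A₀₁) (g A₀₀)))
    (+-mono-≤ (+-mono-≤ (h₂ A₁₁ (trans (at-x A true true) (sym (at-y A true true))))
                        (h₂ A₀₀ (trans (at-x A false false) (sym (at-y A false false)))))
              (subst (λ B → f A₀₁ + f B ≤ g A₀₁ + g B) (moved A)
                     (h₁ A₀₁ (at-x A true false) (at-y A true false))))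
    where
    A₁₁ = A [ y ]≔ true [ x ]≔ true
    A₁₀ = A [ y ]≔ true [ x ]≔ false
    A₀₁ = A [ y ]≔ false [ x ]≔ true
    A₀₀ = A [ y ]≔ false [ x ]≔ false

-- If P only holds on sets containing x but not y, moving x to y is injective on P.
#-move : {P Q : Subset n → Set} (P? : Decidable P) (Q? : Decidable Q) {x y : Fin n} → x ≢ y →
  (∀ A → P A → lookup A x ≡ true × lookup A y ≡ false × Q (A [ x ]≔ false [ y ]≔ true)) →
  # P? ≤ # Q?
#-move {P = P} {Q} P? Q? {x} {y} x≢y h = S-exchange x≢y pair same
  where
  pair : ∀ A → lookup A x ≡ true → lookup A y ≡ false → _
  pair A _ _ = 𝟙-pair (P? A) (P? _) (Q? A) (Q? _) (λ p → inj₂ (proj₂ (proj₂ (h A p))))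
    (λ p → contradiction (trans (sym (proj₁ (h _ p)))
       (trans (lookup∘updateAt′ x y x≢y (A [ x ]≔ false)) (lookup∘updateAt x A))) λ ())
  same : ∀ A → lookup A x ≡ lookup A y → _
  same A e = 𝟙-mono (P? A) (Q? A) λ p →
    contradiction (trans (sym (proj₁ (h A p))) (trans e (proj₁ (proj₂ (h A p))))) λ ()

-- Sets through given points

allSubsets-complete : (A : Subset n) → A ∈ₗ allSubsets n
allSubsets-complete [] = here refl
allSubsets-complete (true ∷ A) = ∈-++⁺ˡ (∈-map⁺ _ (allSubsets-complete A))
allSubsets-complete (false ∷ A) = ∈-++⁺ʳ _ (∈-map⁺ _ (allSubsets-complete A))

allSubsets-unique : ∀ n → Unique (allSubsets n)
allSubsets-unique zero = [] ∷ []
allSubsets-unique (suc n) = Unique.++⁺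
  (Unique.map⁺ (λ { refl → refl }) (allSubsets-unique n))
  (Unique.map⁺ (λ { refl → refl }) (allSubsets-unique n))
  heads-differ
  where
  heads-differ : ∀ {A} → ¬ (A ∈ₗ map (true ∷_) (allSubsets n) × A ∈ₗ map (false ∷_) (allSubsets n))
  heads-differ (i , j) with ∈-map⁻ _ i | ∈-map⁻ _ j
  ... | _ , _ , refl | _ , _ , ()

opaque
  subsets : {P : Subset n → Set} → Decidable P → List (Subset n)
  subsets {n} P? = filter P? (allSubsets n)

  ∈-subsets⁺ : {P : Subset n → Set} (P? : Decidable P) {A : Subset n} → P A → A ∈ₗ subsets P?
  ∈-subsets⁺ P? = ∈-filter⁺ P? (allSubsets-complete _)

  ∈-subsets⁻ : {P : Subset n → Set} (P? : Decidable P) {A : Subset n} → A ∈ₗ subsets P? → P A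
  ∈-subsets⁻ {n} P? i = proj₂ (∈-filter⁻ P? {xs = allSubsets n} i)

  subsets-unique : {P : Subset n → Set} (P? : Decidable P) → Unique (subsets P?)
  subsets-unique {n} P? = Unique.filter⁺ P? (allSubsets-unique n)

#-witness : {P Q : Subset n → Set} (P? : Decidable P) (Q? : Decidable Q) →
  # P? < # Q? → ∃ λ A → Q A × ¬ P A
#-witness P? Q? lt with anySubset? (λ A → Q? A ×-dec ¬? (P? A))
... | yes w = w
... | no ¬w = contradiction lt (≤⇒≯ (#-mono Q? P? implies))
  where
  implies : ∀ A → _ → _
  implies A q with P? A
  ... | yes p = p
  ... | no ¬p = contradiction (A , q , ¬p) ¬w

#-cong : {P Q : Subset n → Set} (P? : Decidable P) (Q? : Decidable Q) →
  (∀ A → P A → Q A) → (∀ A → Q A → P A) → # P? ≡ # Q?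
#-cong P? Q? h₁ h₂ = ≤-antisym (#-mono P? Q? h₁) (#-mono Q? P? h₂)

-- Binomial coefficients and the decay of `d`

private
  pascal = nCk+nC[k+1]≡[n+1]C[k+1]

nC0≡1 : ∀ n → n C 0 ≡ 1
nC0≡1 n = trans (nCk≡nC[n∸k] {0} {n} z≤n) (nCn≡1 n)

absorption : ∀ n k → suc k * (suc n C suc k) ≡ suc n * (n C k)
absorption zero zero = refl
absorption zero (suc k) = *-zeroʳ k
absorption (suc n) zero = begin
  1 * (suc (suc n) C 1)   ≡⟨ *-identityˡ _ ⟩
  suc (suc n) C 1         ≡⟨ nC1≡n (suc (suc n)) ⟩
  suc (suc n)             ≡⟨ sym (*-identityʳ _) ⟩
  suc (suc n) * 1         ≡⟨ cong (suc (suc n) *_) (sym (nC0≡1 (suc n))) ⟩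
  suc (suc n) * (suc n C 0) ∎
  where open ≡-Reasoning
absorption (suc n) (suc k) = begin
  suc (suc k) * (suc (suc n) C suc (suc k))
    ≡⟨ cong (suc (suc k) *_) (sym (pascal (suc n) (suc k))) ⟩
  suc (suc k) * ((suc n C suc k) + (suc n C suc (suc k)))
    ≡⟨ expand (suc k) (suc n C suc k) (suc n C suc (suc k)) ⟩
  (suc n C suc k) + (suc k * (suc n C suc k) + suc (suc k) * (suc n C suc (suc k)))
    ≡⟨ cong ((suc n C suc k) +_) (cong₂ _+_ (absorption n k) (absorption n (suc k))) ⟩
  (suc n C suc k) + (suc n * (n C k) + suc n * (n C suc k))
    ≡⟨ cong ((suc n C suc k) +_) (sym (*-distribˡ-+ (suc n) (n C k) (n C suc k))) ⟩
  (suc n C suc k) + suc n * ((n C k) + (n C suc k))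
    ≡⟨ cong (λ z → (suc n C suc k) + suc n * z) (pascal n k) ⟩
  suc (suc n) * (suc n C suc k) ∎
  where
  open ≡-Reasoning
  expand : ∀ k a b → suc k * (a + b) ≡ a + (k * a + suc k * b)
  expand = solve-∀

-- The number of sets of size k that contain m given points and otherwise
-- choose from p free points; it is 0, not p C 0, when m exceeds k.
extensions : ℕ → ℕ → ℕ → ℕ
extensions p zero k = p C k
extensions p (suc m) zero = 0
extensions p (suc m) (suc k) = extensions p m k

extensions-zero : ∀ p m → extensions p m 0 ≡ extensions (suc p) m 0
extensions-zero p zero = trans (nC0≡1 p) (sym (nC0≡1 (suc p)))
extensions-zero p (suc m) = refl

extensions-pascal : ∀ p m k → extensions p m k + extensions p m (suc k) ≡ extensions (suc p) m (suc k)
extensions-pascal p zero k = pascal p k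
extensions-pascal p (suc m) zero = extensions-zero p m
extensions-pascal p (suc m) (suc k) = extensions-pascal p m k

-- By absorption, the first prescribed point divides the count by `(p+1)/k`. Every further one
-- lowers `k` in both counts, and the condition on `c * k` only becomes easier.
extensions-dominate : ∀ c p m k → c * k ≤ suc p → c * extensions p (suc m) k ≤ extensions (suc p) m k
extensions-dominate c p m zero _ = ≤-trans (≤-reflexive (*-zeroʳ c)) z≤n
extensions-dominate c p zero (suc k) le = *-cancelˡ-≤ (suc k) (begin
  suc k * (c * (p C k)) ≡⟨ rearrange (suc k) c (p C k) ⟩
  c * suc k * (p C k)   ≤⟨ *-monoˡ-≤ (p C k) le ⟩
  suc p * (p C k)       ≡⟨ sym (absorption p k) ⟩
  suc k * (suc p C suc k) ∎)
  where
  open ≤-Reasoning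
  rearrange : ∀ a b c → a * (b * c) ≡ b * a * c
  rearrange = solve-∀
extensions-dominate c p (suc m) (suc k) le =
  extensions-dominate c p m k (≤-trans (*-monoʳ-≤ c (n≤1+n k)) le)

d : ℕ → ℕ → ℕ → ℕ
d n k m = extensions (n ∸ m) m k

-- Prescribing one more point costs a factor of about `n/k`. Every requirement on `n` made to absorb
-- an error term is an instance of this hypothesis.
d-dominates : ∀ c n k m → c * k + suc m ≤ n → c * d n k (suc m) ≤ d n k m
d-dominates c n k m le = subst (λ q → c * d n k (suc m) ≤ extensions q m k) (sym suc-∸)
  (extensions-dominate c (n ∸ suc m) m k
    (≤-trans (≤-trans (≤-reflexive (sym (m+n∸n≡m (c * k) (suc m)))) (∸-monoˡ-≤ (suc m) le)) (n≤1+n _)))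
  where
  suc-∸ : n ∸ m ≡ suc (n ∸ suc m)
  suc-∸ = +-∸-assoc 1 (≤-trans (m≤n+m (suc m) (c * k)) le)

Star? : ∀ k (T : Subset n) → Decidable (λ F → ∣ F ∣ ≡ k × T ⊆ F)
Star? k T F = (∣ F ∣ ≟ k) ×-dec (T ⊆? F)

star-size : ∀ k (T : Subset n) → # (Star? k T) ≡ d n k ∣ T ∣
star-size zero [] = refl
star-size (suc k) [] = refl
star-size {suc n} zero (true ∷ T) = cong₂ _+_
  (#-none (λ A → Star? 0 (true ∷ T) (true ∷ A)) (λ { A (() , _) }))
  (#-none (λ A → Star? 0 (true ∷ T) (false ∷ A)) (λ { A (_ , s) → contradiction (s here) λ () }))
star-size {suc n} (suc k) (true ∷ T) = trans (cong₂ _+_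
  (trans (#-cong (λ A → Star? (suc k) (true ∷ T) (true ∷ A)) (Star? k T)
    (λ { A (e , s) → suc-injective e , drop-∷-⊆ s }) (λ { A (e , s) → cong suc e , s⊆s s }))
    (star-size k T))
  (#-none (λ A → Star? (suc k) (true ∷ T) (false ∷ A)) (λ { A (_ , s) → contradiction (s here) λ () })))
  (+-identityʳ _)
star-size {suc n} zero (false ∷ T) = trans (cong₂ _+_
  (#-none (λ A → Star? 0 (false ∷ T) (true ∷ A)) (λ { A (() , _) }))
  (trans (#-cong (λ A → Star? 0 (false ∷ T) (false ∷ A)) (Star? 0 T)
    (λ { A (e , s) → e , drop-∷-⊆ s }) (λ { A (e , s) → e , s⊆s s }))
    (star-size 0 T)))
  (trans (extensions-zero (n ∸ ∣ T ∣) ∣ T ∣)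
    (cong (λ q → extensions q ∣ T ∣ 0) (sym (+-∸-assoc 1 (∣p∣≤n T)))))
star-size {suc n} (suc k) (false ∷ T) = trans (cong₂ _+_
  (trans (#-cong (λ A → Star? (suc k) (false ∷ T) (true ∷ A)) (Star? k T)
    (λ { A (e , s) → suc-injective e , drop-∷-⊆ {s = false} {t = false} (λ i → drop-true (s i) i) })
    (λ { A (e , s) → cong suc e , out⊆ s }))
    (star-size k T))
  (trans (#-cong (λ A → Star? (suc k) (false ∷ T) (false ∷ A)) (Star? (suc k) T)
    (λ { A (e , s) → e , drop-∷-⊆ s }) (λ { A (e , s) → e , s⊆s s }))
    (star-size (suc k) T)))
  (trans (extensions-pascal (n ∸ ∣ T ∣) ∣ T ∣ k)
    (cong (λ q → extensions q ∣ T ∣ (suc k)) (sym (+-∸-assoc 1 (∣p∣≤n T)))))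
  where
  drop-true : ∀ {x} {A : Subset n} → x ∈ true ∷ A → x ∈ false ∷ T → x ∈ false ∷ A
  drop-true (there i) (there _) = there i

-- Operations on subsets, their sizes and their element lists

insert : Fin n → Subset n → Subset n
insert x A = A [ x ]≔ true

∈⇒lookup : {x : Fin n} {A : Subset n} → x ∈ A → lookup A x ≡ true
∈⇒lookup = []=⇒lookup

lookup⇒∈ : {x : Fin n} {A : Subset n} → lookup A x ≡ true → x ∈ A
lookup⇒∈ {x = x} {A} = lookup⇒[]= x A

x∈insert : (x : Fin n) (A : Subset n) → x ∈ insert x A
x∈insert x A = lookup⇒∈ (lookup∘updateAt x A)

insert-⊇ : (x : Fin n) (A : Subset n) → A ⊆ insert x A
insert-⊇ x A {y} y∈A with y Fin.≟ x
... | yes refl = x∈insert x A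
... | no y≢x = lookup⇒∈ (trans (lookup∘updateAt′ y x y≢x A) (∈⇒lookup y∈A))

∈-insert⁻ : {x y : Fin n} (A : Subset n) → y ∈ insert x A → y ≡ x ⊎ y ∈ A
∈-insert⁻ {x = x} {y} A i with y Fin.≟ x
... | yes e = inj₁ e
... | no y≢x = inj₂ (lookup⇒∈ (trans (sym (lookup∘updateAt′ y x y≢x A)) (∈⇒lookup i)))

insert-⊆ : {x : Fin n} {A B : Subset n} → x ∈ B → A ⊆ B → insert x A ⊆ B
insert-⊆ {A = A} x∈B s i with ∈-insert⁻ A i
... | inj₁ refl = x∈B
... | inj₂ j = s j

∣insert∣ : {x : Fin n} (A : Subset n) → x ∉ A → ∣ insert x A ∣ ≡ suc ∣ A ∣
∣insert∣ {x = zero} (true ∷ A) x∉ = contradiction here x∉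
∣insert∣ {x = zero} (false ∷ A) x∉ = refl
∣insert∣ {x = suc x} (true ∷ A) x∉ = cong suc (∣insert∣ A (x∉ ∘ there))
∣insert∣ {x = suc x} (false ∷ A) x∉ = ∣insert∣ A (x∉ ∘ there)

∈─⁻ : {x : Fin n} (A B : Subset n) → x ∈ A ─ B → x ∈ A × x ∉ B
∈─⁻ (true ∷ A) (false ∷ B) here = here , λ ()
∈─⁻ {x = zero} (false ∷ A) (true ∷ B) ()
∈─⁻ {x = zero} (false ∷ A) (false ∷ B) ()
∈─⁻ (_ ∷ A) (_ ∷ B) (there i) with ∈─⁻ A B i
... | a , b = there a , λ { (there j) → b j }

∣∩∣+∣─∣ : (A B : Subset n) → ∣ A ∩ B ∣ + ∣ A ─ B ∣ ≡ ∣ A ∣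
∣∩∣+∣─∣ [] [] = refl
∣∩∣+∣─∣ (true ∷ A) (true ∷ B) = cong suc (∣∩∣+∣─∣ A B)
∣∩∣+∣─∣ (true ∷ A) (false ∷ B) = trans (+-suc _ _) (cong suc (∣∩∣+∣─∣ A B))
∣∩∣+∣─∣ (false ∷ A) (true ∷ B) = ∣∩∣+∣─∣ A B
∣∩∣+∣─∣ (false ∷ A) (false ∷ B) = ∣∩∣+∣─∣ A B

∣∪∣≤ : (A B : Subset n) → ∣ A ∪ B ∣ ≤ ∣ A ∣ + ∣ B ∣
∣∪∣≤ [] [] = z≤n
∣∪∣≤ (true ∷ A) (true ∷ B) = s≤s (≤-trans (∣∪∣≤ A B) (+-monoʳ-≤ ∣ A ∣ (n≤1+n _)))
∣∪∣≤ (true ∷ A) (false ∷ B) = s≤s (∣∪∣≤ A B)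
∣∪∣≤ (false ∷ A) (true ∷ B) = ≤-trans (s≤s (∣∪∣≤ A B)) (≤-reflexive (sym (+-suc ∣ A ∣ ∣ B ∣)))
∣∪∣≤ (false ∷ A) (false ∷ B) = ∣∪∣≤ A B

∉-witness : (A B : Subset n) → ¬ A ⊆ B → ∃ λ x → x ∈ A × x ∉ B
∉-witness A B A⊈B with nonempty? (A ─ B)
... | yes (x , i) = x , ∈─⁻ A B i
... | no empty = ⊥-elim (A⊈B included)
  where
  included : A ⊆ B
  included {x} x∈A with x ∈? B
  ... | yes x∈B = x∈B
  ... | no x∉B = contradiction (x , x∈p∧x∉q⇒x∈p─q x∈A x∉B) empty

∣<∣-witness : (A B : Subset n) → ∣ B ∣ < ∣ A ∣ → ∃ λ x → x ∈ A × x ∉ B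
∣<∣-witness A B lt = ∉-witness A B (λ s → <⇒≱ lt (p⊆q⇒∣p∣≤∣q∣ s))

⊆-full : {A B : Subset n} → A ⊆ B → ∣ B ∣ ≤ ∣ A ∣ → B ⊆ A
⊆-full {A = A} {B} s le {x} x∈B with x ∈? A
... | yes x∈A = x∈A
... | no x∉A = contradiction le (<⇒≱ (p⊂q⇒∣p∣<∣q∣ (s , x , x∈B , x∉A)))

∣∩∣<∣ : (A B : Subset n) → ¬ A ⊆ B → ∣ A ∩ B ∣ < ∣ A ∣
∣∩∣<∣ A B A⊈B with ∉-witness A B A⊈B
... | x , x∈A , x∉B = p⊂q⇒∣p∣<∣q∣ (p∩q⊆p A B , x , x∈A , λ i → x∉B (proj₂ (x∈p∩q⁻ A B i)))

∩-mono-∣ : (A B C D : Subset n) → (∀ {x} → x ∈ A → x ∈ B → x ∈ C × x ∈ D) → ∣ A ∩ B ∣ ≤ ∣ C ∩ D ∣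
∩-mono-∣ A B C D h = p⊆q⇒∣p∣≤∣q∣ (λ i → let a , b = x∈p∩q⁻ A B i in x∈p∩q⁺ (h a b))

choose-subset : ∀ m (A : Subset n) → m ≤ ∣ A ∣ → ∃ λ T → T ⊆ A × ∣ T ∣ ≡ m
choose-subset {n} zero A _ = ⊥ , ⊥⊆ , ∣⊥∣≡0 n
choose-subset (suc m) (true ∷ A) (s≤s le) with choose-subset m A le
... | T , s , e = true ∷ T , s⊆s s , cong suc e
choose-subset (suc m) (false ∷ A) le with choose-subset (suc m) A le
... | T , s , e = false ∷ T , s⊆s s , e

∣-∣ : {x : Fin n} (A : Subset n) → x ∈ A → suc ∣ A - x ∣ ≡ ∣ A ∣
∣-∣ {x = x} A x∈A = trans (cong₂ _+_ (sym one) refl) (∣∩∣+∣─∣ A ⁅ x ⁆)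
  where
  one : ∣ A ∩ ⁅ x ⁆ ∣ ≡ 1
  one = ≤-antisym (≤-trans (∣p∩q∣≤∣q∣ A ⁅ x ⁆) (≤-reflexive (∣⁅x⁆∣≡1 x)))
    (≤-trans (≤-reflexive (sym (∣⁅x⁆∣≡1 x)))
      (p⊆q⇒∣p∣≤∣q∣ λ i → x∈p∩q⁺ (subst (_∈ A) (sym (x∈⁅y⁆⇒x≡y x i)) x∈A , i)))

∈-⁻ : {x y : Fin n} (A : Subset n) → y ∈ A - x → y ∈ A × y ≢ x
∈-⁻ {x = x} A i with ∈─⁻ A ⁅ x ⁆ i
... | a , b = a , x∉⁅y⁆⇒x≢y b

#-subsets-of : (W : Subset n) → # (_⊆? W) ≡ 2 ^ ∣ W ∣
#-subsets-of [] = refl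
#-subsets-of (true ∷ W) = trans (cong₂ _+_
  (trans (#-cong (λ A → (true ∷ A) ⊆? (true ∷ W)) (_⊆? W) (λ _ → drop-∷-⊆) (λ _ → s⊆s)) (#-subsets-of W))
  (trans (#-cong (λ A → (false ∷ A) ⊆? (true ∷ W)) (_⊆? W) (λ _ → λ s → drop-there ∘ s ∘ there) (λ _ → out⊆)) (#-subsets-of W)))
  (cong (2 ^ ∣ W ∣ +_) (sym (+-identityʳ _)))
#-subsets-of (false ∷ W) = trans (cong₂ _+_
  (#-none (λ A → (true ∷ A) ⊆? (false ∷ W)) (λ A s → contradiction (s here) λ ()))
  (#-cong (λ A → (false ∷ A) ⊆? (false ∷ W)) (_⊆? W) (λ _ → drop-∷-⊆) (λ _ → s⊆s)))
  (#-subsets-of W)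

powerset-length : (W : Subset n) → length (subsets (_⊆? W)) ≤ 2 ^ ∣ W ∣
powerset-length W = ≤-trans
  (#-length (_⊆? W) (subsets-unique (_⊆? W)) (All.tabulate (∈-subsets⁻ (_⊆? W))))
  (≤-reflexive (#-subsets-of W))

elems : Subset n → List (Fin n)
elems [] = []
elems (true ∷ A) = zero ∷ map suc (elems A)
elems (false ∷ A) = map suc (elems A)

length-elems : (A : Subset n) → length (elems A) ≡ ∣ A ∣
length-elems [] = refl
length-elems (true ∷ A) = cong suc (trans (length-map suc (elems A)) (length-elems A))
length-elems (false ∷ A) = trans (length-map suc (elems A)) (length-elems A)

∈-elems⁺ : {x : Fin n} {A : Subset n} → x ∈ A → x ∈ₗ elems A
∈-elems⁺ here = here refl
∈-elems⁺ {A = true ∷ A} (there i) = there (∈-map⁺ suc (∈-elems⁺ i))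
∈-elems⁺ {A = false ∷ A} (there i) = ∈-map⁺ suc (∈-elems⁺ i)

∈-elems⁻ : {x : Fin n} (A : Subset n) → x ∈ₗ elems A → x ∈ A
∈-elems⁻ (true ∷ A) (here refl) = here
∈-elems⁻ (true ∷ A) (there i) with ∈-map⁻ suc i
... | _ , j , refl = there (∈-elems⁻ A j)
∈-elems⁻ (false ∷ A) i with ∈-map⁻ suc i
... | _ , j , refl = there (∈-elems⁻ A j)

elems-unique : (A : Subset n) → Unique (elems A)
elems-unique [] = []
elems-unique (true ∷ A) =
  All.map⁺ (All.tabulate (λ _ ())) ∷ Unique.map⁺ Fin.suc-injective (elems-unique A)
elems-unique (false ∷ A) = Unique.map⁺ Fin.suc-injective (elems-unique A)

fromList : List (Fin n) → Subset n
fromList = foldr insert ⊥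

∈-fromList⁺ : {x : Fin n} {L : List (Fin n)} → x ∈ₗ L → x ∈ fromList L
∈-fromList⁺ {L = x ∷ L} (here refl) = x∈insert x (fromList L)
∈-fromList⁺ {L = y ∷ L} (there i) = insert-⊇ y (fromList L) (∈-fromList⁺ i)

∈-fromList⁻ : {x : Fin n} (L : List (Fin n)) → x ∈ fromList L → x ∈ₗ L
∈-fromList⁻ [] i = contradiction i ∉⊥
∈-fromList⁻ (y ∷ L) i with ∈-insert⁻ (fromList L) i
... | inj₁ refl = here refl
... | inj₂ j = there (∈-fromList⁻ L j)

∣fromList∣ : {L : List (Fin n)} → Unique L → ∣ fromList L ∣ ≡ length L
∣fromList∣ {n} [] = ∣⊥∣≡0 n
∣fromList∣ {L = x ∷ L} (u ∷ us) = trans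
  (∣insert∣ (fromList L) (λ i → All.lookup u (∈-fromList⁻ L i) refl)) (cong suc (∣fromList∣ us))

-- Kernels of large degree

degree : {G : Subset n → Set} → Decidable G → Subset n → ℕ
degree G? T = # (λ F → G? F ×-dec (T ⊆? F))

-- A member through `T` that meets `W` off `T` contains `insert x T` for some `x` in `W`, and each
-- such `x` accounts for at most `d n k (suc ∣ T ∣)` members. A larger degree leaves a member that
-- meets `W` only inside `T`.
avoid : {G : Subset n → Set} (G? : Decidable G) {k : ℕ} → (∀ F → G F → ∣ F ∣ ≡ k) →
  (T W : Subset n) → ∣ W ∣ * d n k (suc ∣ T ∣) < degree G? T →
  ∃ λ F → G F × T ⊆ F × (∀ {x} → x ∈ F → x ∈ W → x ∈ T)
avoid {n} {G} G? {k} uniform T W lt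
  with #-witness (λ F → (G? F ×-dec (T ⊆? F)) ×-dec Hits? F) (λ F → G? F ×-dec (T ⊆? F))
                 (≤-<-trans few lt)
  where
  Hits? : Decidable (λ F → ∃ λ x → x ∈ F × x ∈ W × x ∉ T)
  Hits? F = Fin.any? λ x → (x ∈? F) ×-dec (x ∈? W) ×-dec ¬? (x ∈? T)
  -- Carrying `x ∉ T` in the predicate makes the bound hold for all `x`: the count is zero when `x`
  -- lies in `T`.
  Through? : (x : Fin n) → Decidable (λ F → x ∉ T × ∣ F ∣ ≡ k × insert x T ⊆ F)
  Through? x F = ¬? (x ∈? T) ×-dec Star? k (insert x T) F
  through : ∀ x → # (Through? x) ≤ d n k (suc ∣ T ∣)
  through x = by-cases (x ∈? T)
    where
    by-cases : Dec (x ∈ T) → # (Through? x) ≤ d n k (suc ∣ T ∣)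
    by-cases (yes x∈T) = ≤-trans (≤-reflexive (#-none (Through? x) (λ _ q → proj₁ q x∈T))) z≤n
    by-cases (no x∉T) = ≤-trans (#-mono (Through? x) (Star? k (insert x T)) (λ _ → proj₂))
      (≤-reflexive (trans (star-size k (insert x T)) (cong (d n k) (∣insert∣ T x∉T))))
  few : # (λ F → (G? F ×-dec (T ⊆? F)) ×-dec Hits? F) ≤ ∣ W ∣ * d n k (suc ∣ T ∣)
  few = subst (λ l → # (λ F → (G? F ×-dec (T ⊆? F)) ×-dec Hits? F) ≤ l * d n k (suc ∣ T ∣))
    (length-elems W)
    (#-any (elems W) (λ F → (G? F ×-dec (T ⊆? F)) ×-dec Hits? F) Through? _
      (λ { F ((g , s) , x , x∈F , x∈W , x∉T) →
           x , ∈-elems⁺ x∈W , x∉T , uniform F g , insert-⊆ {A = T} {B = F} x∈F s })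
      (λ x _ → through x))
... | F , (g , s) , ¬hits = F , g , s , stays
  where
  stays : ∀ {x} → x ∈ F → x ∈ W → x ∈ T
  stays {x} x∈F x∈W with x ∈? T
  ... | yes x∈T = x∈T
  ... | no x∉T = ⊥-elim (¬hits ((g , s) , x , x∈F , x∈W , x∉T))

-- Every set in `H` contains an `m`-subset of some window. A window has at most `2 ^ c` of these,
-- and each that arises lies in at most `D` members of `G`.
windows : {G H : Subset n → Set} (G? : Decidable G) (H? : Decidable H)
  (𝒲 : List (Subset n)) (c m D : ℕ) → (∀ {W} → W ∈ₗ 𝒲 → ∣ W ∣ ≤ c) → (∀ F → H F → G F) →
  (∀ F → H F → ∃ λ W → W ∈ₗ 𝒲 × m ≤ ∣ F ∩ W ∣) →
  (∀ F T → H F → T ⊆ F → ∣ T ∣ ≡ m → degree G? T ≤ D) →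
  # H? ≤ length 𝒲 * (2 ^ c * D)
windows {n} {G} {H} G? H? 𝒲 c m D small H⊆G meets sparse =
  #-any 𝒲 H? (λ W F → H? F ×-dec (m ≤? ∣ F ∩ W ∣)) _
    (λ F h → let W , i , le = meets F h in W , i , h , le) inWindow
  where
  Low? : ∀ T → Dec (∣ T ∣ ≡ m × degree G? T ≤ D)
  Low? T = (∣ T ∣ ≟ m) ×-dec (degree G? T ≤? D)
  Above? : ∀ T → Decidable (λ F → (G F × T ⊆ F) × (∣ T ∣ ≡ m × degree G? T ≤ D))
  Above? T F = (G? F ×-dec (T ⊆? F)) ×-dec Low? T
  above : ∀ T → # (Above? T) ≤ D
  above T = by-cases (Low? T)
    where
    by-cases : Dec (∣ T ∣ ≡ m × degree G? T ≤ D) → # (Above? T) ≤ D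
    by-cases (yes (_ , le)) = ≤-trans (#-mono (Above? T) (λ F → G? F ×-dec (T ⊆? F)) (λ _ → proj₁)) le
    by-cases (no ¬low) = ≤-trans (≤-reflexive (#-none (Above? T) (λ _ → ¬low ∘ proj₂))) z≤n
  inWindow : ∀ W → W ∈ₗ 𝒲 → # (λ F → H? F ×-dec (m ≤? ∣ F ∩ W ∣)) ≤ 2 ^ c * D
  inWindow W i = ≤-trans
    (#-any (subsets (_⊆? W)) _ Above? D choose (λ T _ → above T))
    (*-monoˡ-≤ D (≤-trans (powerset-length W) (^-monoʳ-≤ 2 (small i))))
    where
    choose : ∀ F → H F × m ≤ ∣ F ∩ W ∣ →
      ∃ λ T → T ∈ₗ subsets (_⊆? W) × (G F × T ⊆ F) × (∣ T ∣ ≡ m × degree G? T ≤ D)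
    choose F (h , le) with choose-subset m (F ∩ W) le
    ... | T , s , e = T , ∈-subsets⁺ (_⊆? W) (λ j → proj₂ (x∈p∩q⁻ F W (s j))) ,
      (H⊆G F h , λ j → proj₁ (x∈p∩q⁻ F W (s j))) ,
      e , sparse F T h (λ j → proj₁ (x∈p∩q⁻ F W (s j))) e

∈-⋃ : {x : Fin n} {A : Subset n} {L : List (Subset n)} → A ∈ₗ L → x ∈ A → x ∈ ⋃ L
∈-⋃ (here refl) i = x∈p∪q⁺ (inj₁ i)
∈-⋃ {A = A} {L = B ∷ L} (there j) i = x∈p∪q⁺ (inj₂ (∈-⋃ j i))

∣⋃∣≤ : {k : ℕ} {L : List (Subset n)} → All (λ A → ∣ A ∣ ≤ k) L → ∣ ⋃ L ∣ ≤ length L * k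
∣⋃∣≤ {n} [] = ≤-reflexive (∣⊥∣≡0 n)
∣⋃∣≤ {L = A ∷ L} (le ∷ les) = ≤-trans (∣∪∣≤ A (⋃ L)) (+-mono-≤ le (∣⋃∣≤ les))

module Matchings {n : ℕ} (k t s : ℕ) (t<k : t < k) (𝓕 : List (Subset n))
  (uniform : All (λ F → ∣ F ∣ ≡ k) 𝓕) (ν : NuEq t 𝓕 s) (τ : TauGt t 𝓕 s) where

  open DecMembership (_≟ₛ_ {n}) using () renaming (_∈?_ to _∈ₗ?_)

  size : ∀ F → F ∈ₗ 𝓕 → ∣ F ∣ ≡ k
  size _ = All.lookup uniform

  -- The greedy choice avoids the union of at most `suc s` sets of at most `k` points, and each of
  -- these points spoils at most `d n k (suc t)` members through a `t`-set.
  threshold : ℕ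
  threshold = suc s * k * d n k (suc t)

  Large : Subset n → Set
  Large T = ∣ T ∣ ≡ t × threshold < degree (_∈ₗ? 𝓕) T

  opaque
    Large? : Decidable Large
    Large? T = (∣ T ∣ ≟ t) ×-dec (threshold <? degree (_∈ₗ? 𝓕) T)

  -- The member chosen through `T` meets all other listed sets only inside `T`. It meets each
  -- matching member in fewer than `t` points because `T` is not contained in that member, and a
  -- remaining kernel inside it would lie in `T`, hence equal `T`. So the invariant persists.
  extend : ∀ Ts Ms → Unique Ts → All Large Ts → TMatchingIn t 𝓕 Ms →
    (∀ {T A} → T ∈ₗ Ts → A ∈ₗ Ms → ¬ T ⊆ A) → length Ts + length Ms ≤ suc s →
    ∃ λ M → TMatchingIn t 𝓕 M × length M ≡ length Ts + length Ms
  extend [] Ms _ _ matching _ _ = Ms , matching , refl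
  extend (T ∷ Ts) Ms (u ∷ us) ((∣T∣ , large) ∷ larges) ((uM , pM) , aM) T⊈ le
    with avoid (_∈ₗ? 𝓕) size T (⋃ (Ts ++ Ms)) (≤-<-trans small large)
    where
    sizes : All (λ A → ∣ A ∣ ≤ k) (Ts ++ Ms)
    sizes = All.++⁺ (All.map (λ l → ≤-trans (≤-reflexive (proj₁ l)) (<⇒≤ t<k)) larges)
                    (All.map (λ i → ≤-reflexive (size _ i)) aM)
    count≤ : length (Ts ++ Ms) ≤ suc s
    count≤ = ≤-trans (≤-reflexive (length-++ Ts)) (≤-trans (n≤1+n _) le)
    small : ∣ ⋃ (Ts ++ Ms) ∣ * d n k (suc ∣ T ∣) ≤ threshold
    small rewrite ∣T∣ = *-monoˡ-≤ (d n k (suc t)) (≤-trans (∣⋃∣≤ sizes) (*-monoˡ-≤ k count≤))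
  ... | F , F∈𝓕 , T⊆F , stays
    with extend Ts (F ∷ Ms) us larges
           ((All.tabulate F≢ ∷ uM , All.tabulate meet ∷ pM) , F∈𝓕 ∷ aM) apart
           (≤-trans (≤-reflexive (+-suc _ _)) le)
    where
    F≢ : ∀ {A} → A ∈ₗ Ms → F ≢ A
    F≢ i refl = T⊈ (here refl) i T⊆F
    meet : ∀ {A} → A ∈ₗ Ms → ∣ F ∩ A ∣ < t
    meet {A} i = subst (∣ F ∩ A ∣ <_) ∣T∣ (≤-<-trans
      (∩-mono-∣ F A T A (λ x∈F x∈A → stays x∈F (∈-⋃ (∈-++⁺ʳ Ts i) x∈A) , x∈A))
      (∣∩∣<∣ T A (T⊈ (here refl) i)))
    apart : ∀ {T′ A} → T′ ∈ₗ Ts → A ∈ₗ F ∷ Ms → ¬ T′ ⊆ A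
    apart i (there j) = T⊈ (there i) j
    apart {T′} i (here refl) T′⊆F = All.lookup u i (⊆-antisym (⊆-full T′⊆T le′) T′⊆T)
      where
      T′⊆T : T′ ⊆ T
      T′⊆T x∈T′ = stays (T′⊆F x∈T′) (∈-⋃ (∈-++⁺ˡ i) x∈T′)
      le′ : ∣ T ∣ ≤ ∣ T′ ∣
      le′ = ≤-reflexive (trans ∣T∣ (sym (proj₁ (All.lookup larges i))))
  ... | M , matching , e = M , matching , trans e (+-suc _ _)

  no-extension : ∀ Ts Ms → Unique Ts → All Large Ts → TMatchingIn t 𝓕 Ms →
    (∀ {T A} → T ∈ₗ Ts → A ∈ₗ Ms → ¬ T ⊆ A) → length Ts + length Ms ≢ suc s
  no-extension Ts Ms u l matching T⊈ e with extend Ts Ms u l matching T⊈ (≤-reflexive e)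
  ... | M , matching′ , e′ = 1+n≰n (subst (_≤ s) (trans e′ e) (proj₂ ν M matching′))

  Uncovered : List (Subset n) → Subset n → Set
  Uncovered Ts F = F ∈ₗ 𝓕 × All (λ T → ¬ T ⊆ F) Ts

  Uncovered? : ∀ Ts → Decidable (Uncovered Ts)
  Uncovered? Ts F = (F ∈ₗ? 𝓕) ×-dec All.all? (λ T → ¬? (T ⊆? F)) Ts

  cover-or-miss : ∀ Ts → (∀ {F} → F ∈ₗ 𝓕 → ∃ λ T → T ∈ₗ Ts × T ⊆ F) ⊎ ∃ (Uncovered Ts)
  cover-or-miss Ts with Any.any? (Uncovered? Ts) 𝓕
  ... | yes a = inj₂ (let F , _ , h = find a in F , h)
  ... | no ¬a = inj₁ covered
    where
    covered : ∀ {F} → F ∈ₗ 𝓕 → ∃ λ T → T ∈ₗ Ts × T ⊆ F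
    covered {F} F∈𝓕 with Any.any? (λ T → T ⊆? F) Ts
    ... | yes b = find b
    ... | no ¬b = contradiction (lose F∈𝓕 (F∈𝓕 , All.¬Any⇒All¬ Ts ¬b)) ¬a

  𝒯 : List (Subset n)
  𝒯 = subsets Large?

  𝒯-large : All Large 𝒯
  𝒯-large = All.tabulate (∈-subsets⁻ Large?)

  -- The bound on `ν` alone would still allow `s` large sets. Since `s < τ`, any `s` of them leave
  -- some member uncovered, and they extend that member to a matching of size `suc s`.
  few-large : length 𝒯 < s
  few-large with length 𝒯 <? s
  ... | yes lt = lt
  ... | no ≮ with cover-or-miss (take s 𝒯)
  ...   | inj₁ covered = contradiction
    (τ (take s 𝒯) (Unique.take⁺ s (subsets-unique Large?) ,
                   All.map proj₁ (All.take⁺ s 𝒯-large) , covered))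
    (<-irrefl (sym (trans (length-take s 𝒯) (m≤n⇒m⊓n≡m (≮⇒≥ ≮)))))
  ...   | inj₂ (F , F∈𝓕 , miss) = ⊥-elim (no-extension (take s 𝒯) (F ∷ [])
    (Unique.take⁺ s (subsets-unique Large?)) (All.take⁺ s 𝒯-large)
    (([] ∷ [] , [] ∷ []) , F∈𝓕 ∷ []) (λ { i (here refl) → All.lookup miss i })
    (trans (+-comm _ 1) (cong suc (trans (length-take s 𝒯) (m≤n⇒m⊓n≡m (≮⇒≥ ≮))))))

  Rest : Subset n → Set
  Rest = Uncovered 𝒯

  Rest? : Decidable Rest
  Rest? = Uncovered? 𝒯

  -- The members of a maximum matching serve as windows: a set meeting each of them in fewer than
  -- `t` points could be added. A `t`-set inside an uncovered member is not large.
  rest-bound : # Rest? ≤ s * (2 ^ k * threshold)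
  rest-bound with proj₁ ν
  ... | M , ((uM , pM) , aM) , ∣M∣ = subst (λ l → # Rest? ≤ l * (2 ^ k * threshold)) ∣M∣
    (windows (_∈ₗ? 𝓕) Rest? M k t threshold (λ i → ≤-reflexive (size _ (All.lookup aM i)))
      (λ _ → proj₁) meets sparse)
    where
    meets : ∀ F → Rest F → ∃ λ A → A ∈ₗ M × t ≤ ∣ F ∩ A ∣
    meets F (F∈𝓕 , _) with Any.any? (λ A → t ≤? ∣ F ∩ A ∣) M
    ... | yes a = find a
    ... | no ¬a = contradiction
      (proj₂ ν (F ∷ M) ((All.tabulate F≢ ∷ uM , All.map ≰⇒> far ∷ pM) , F∈𝓕 ∷ aM))
      (<⇒≱ (≤-reflexive (cong suc (sym ∣M∣))))
      where
      far : All (λ A → ¬ t ≤ ∣ F ∩ A ∣) M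
      far = All.¬Any⇒All¬ M ¬a
      F≢ : ∀ {A} → A ∈ₗ M → F ≢ A
      F≢ i refl = All.lookup far i (≤-trans (<⇒≤ t<k) (≤-reflexive
        (sym (trans (cong ∣_∣ (∩-idem F)) (size F F∈𝓕)))))
    sparse : ∀ F T → Rest F → T ⊆ F → ∣ T ∣ ≡ t → degree (_∈ₗ? 𝓕) T ≤ threshold
    sparse F T (_ , miss) T⊆F ∣T∣ = ≮⇒≥ λ large →
      All.lookup miss (∈-subsets⁺ Large? (∣T∣ , large)) T⊆F

  -- Two members with a smaller intersection form a matching of size two that contains no kernel,
  -- and the `s - 1` kernels extend it to `suc s` sets.
  rest-intersecting : suc (length 𝒯) ≡ s → ∀ A B → Rest A → Rest B → t ≤ ∣ A ∩ B ∣
  rest-intersecting e A B (A∈𝓕 , missA) (B∈𝓕 , missB) = ≮⇒≥ λ lt →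
    no-extension 𝒯 (A ∷ B ∷ []) (subsets-unique Large?) 𝒯-large
      (((A≢B lt ∷ []) ∷ [] ∷ [] , (lt ∷ []) ∷ [] ∷ []) , A∈𝓕 ∷ B∈𝓕 ∷ [])
      (λ { i (here refl) → All.lookup missA i ; i (there (here refl)) → All.lookup missB i })
      (trans (+-comm _ 2) (cong suc e))
    where
    A≢B : ∣ A ∩ B ∣ < t → A ≢ B
    A≢B lt refl = <⇒≱ lt (≤-trans (<⇒≤ t<k) (≤-reflexive
      (sym (trans (cong ∣_∣ (∩-idem A)) (size A A∈𝓕)))))

  -- If every member of `Rest` contained `T`, then `T` and the large sets would form a covering of
  -- size `s`. A large `T` cannot be listed twice, but then the large sets alone fail to cover, and
  -- any member they miss will do.
  rest-uncovered : suc (length 𝒯) ≡ s → ∀ T → ∣ T ∣ ≡ t → ∃ λ F → Rest F × ¬ T ⊆ F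
  rest-uncovered e T ∣T∣ with T ∈ₗ? 𝒯 | cover-or-miss 𝒯 | cover-or-miss (T ∷ 𝒯)
  ... | _ | _ | inj₂ (F , F∈𝓕 , T⊈F ∷ miss) = F , (F∈𝓕 , miss) , T⊈F
  ... | _ | inj₁ covered | _ = contradiction
    (τ 𝒯 (subsets-unique Large? , All.map proj₁ 𝒯-large , covered)) (<-asym few-large)
  ... | yes T∈𝒯 | inj₂ (F , F∈𝓕 , miss) | inj₁ _ = F , (F∈𝓕 , miss) , All.lookup miss T∈𝒯
  ... | no T∉𝒯 | _ | inj₁ covered = contradiction
    (τ (T ∷ 𝒯) (All.tabulate (λ i → λ { refl → T∉𝒯 i }) ∷ subsets-unique Large? ,
                ∣T∣ ∷ All.map proj₁ 𝒯-large , covered))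
    (<-irrefl (sym e))

-- Non-trivial t-intersecting families

unique-⊆-length : {X : Set} {xs ys : List X} → Unique xs → (∀ {x} → x ∈ₗ xs → x ∈ₗ ys) →
  length xs ≤ length ys
unique-⊆-length [] _ = z≤n
unique-⊆-length {xs = x ∷ xs} (u ∷ us) h with ∈-∃++ (h (here refl))
... | as , bs , refl = ≤-trans (s≤s (unique-⊆-length us others))
  (≤-reflexive (sym (trans (length-++ as) (trans (+-suc _ _) (cong suc (sym (length-++ as)))))))
  where
  others : ∀ {y} → y ∈ₗ xs → y ∈ₗ as ++ bs
  others i with ∈-++⁻ as (h (there i))
  ... | inj₁ j = ∈-++⁺ˡ j
  ... | inj₂ (here refl) = contradiction refl (All.lookup u i)
  ... | inj₂ (there j) = ∈-++⁺ʳ as j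

nonempty-list : {X : Set} (L : List X) → 1 ≤ length L → ∃ (_∈ₗ L)
nonempty-list (x ∷ _) _ = x , here refl

AllBut : (Fin n → Set) → Fin n → Subset n → Set
AllBut P i Y = ∀ {j} → j ∈ Y → j ≡ i ⊎ P j

⊆-size-≡ : {A B : Subset n} → A ⊆ B → ∣ A ∣ ≡ ∣ B ∣ → A ≡ B
⊆-size-≡ s e = ⊆-antisym s (⊆-full s (≤-reflexive (sym e)))

∣∩∣+2≤ : {i j : Fin n} (A B : Subset n) → i ∈ A → i ∉ B → j ∈ A → j ∉ B → j ≢ i →
  suc (suc ∣ B ∩ A ∣) ≤ ∣ A ∣
∣∩∣+2≤ {i = i} {j} A B i∈A i∉B j∈A j∉B j≢i =
  ≤-trans (s≤s (s≤s (p⊆q⇒∣p∣≤∣q∣ within)))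
    (≤-reflexive (trans (cong suc (∣-∣ (A - i) (x∈p∧x≢y⇒x∈p-y j∈A j≢i))) (∣-∣ A i∈A)))
  where
  within : B ∩ A ⊆ A - i - j
  within {z} m with x∈p∩q⁻ B A m
  ... | z∈B , z∈A = x∈p∧x≢y⇒x∈p-y (x∈p∧x≢y⇒x∈p-y z∈A λ { refl → i∉B z∈B }) λ { refl → j∉B z∈B }

-- `M` stands for the larger of `t + 2` and `k + 1 - t`, the greatest numbers of large `(t+1)`-sets
-- in a triangle and in a sunflower. The hypotheses say that it is at least both; the outcome
-- records which of the two reaches it.
module Intersecting {n : ℕ} (k t M : ℕ) (1≤t : 1 ≤ t) (t<k : t < k)
  (t+2≤M : suc (suc t) ≤ M) (k<M+t : k < M + t)
  {G : Subset n → Set} (G? : Decidable G) (uniform : ∀ F → G F → ∣ F ∣ ≡ k)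
  (intersecting : ∀ A B → G A → G B → t ≤ ∣ A ∩ B ∣)
  (uncovered : ∀ T → ∣ T ∣ ≡ t → ∃ λ F → G F × ¬ T ⊆ F)
  (F₁ : Subset n) (G₁ : G F₁) where

  -- Here a single set of at most `k` points has to be avoided, and one point beyond a `(t+1)`-set
  -- leaves `d n k (suc (suc t))` sets.
  threshold : ℕ
  threshold = k * d n k (suc (suc t))

  Large : Subset n → Set
  Large B = ∣ B ∣ ≡ suc t × threshold < degree G? B

  opaque
    Large? : Decidable Large
    Large? B = (∣ B ∣ ≟ suc t) ×-dec (threshold <? degree G? B)

  𝓑 : List (Subset n)
  𝓑 = subsets Large?

  ∈𝓑⇒Large : ∀ {B} → B ∈ₗ 𝓑 → Large B
  ∈𝓑⇒Large = ∈-subsets⁻ Large?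

  -- Some member through the large set `B` meets `X` only inside `B`, so `X` meets `B` in at least
  -- as many points as it meets that member. Taking for `X` first a member and then a large set
  -- gives the next two statements.
  meets-large : ∀ X → ∣ X ∣ ≤ k → (∀ F → G F → t ≤ ∣ X ∩ F ∣) → ∀ {B} → B ∈ₗ 𝓑 → t ≤ ∣ X ∩ B ∣
  meets-large X le h {B} i with ∈𝓑⇒Large i
  ... | ∣B∣ , large with avoid G? uniform B X
    (≤-<-trans (≤-trans (≤-reflexive (cong (λ m → ∣ X ∣ * d n k (suc m)) ∣B∣)) (*-monoˡ-≤ (d n k (suc (suc t))) le)) large)
  ...   | F , g , _ , stays = ≤-trans (h F g) (∩-mono-∣ X F X B λ x∈X x∈F → x∈X , stays x∈F x∈X)

  G-meets-𝓑 : ∀ {F B} → G F → B ∈ₗ 𝓑 → t ≤ ∣ F ∩ B ∣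
  G-meets-𝓑 {F} g = meets-large F (≤-reflexive (uniform F g)) (λ F′ g′ → intersecting F F′ g g′)

  𝓑-meets-𝓑 : ∀ {B B′} → B ∈ₗ 𝓑 → B′ ∈ₗ 𝓑 → t ≤ ∣ B ∩ B′ ∣
  𝓑-meets-𝓑 {B} i = meets-large B (≤-trans (≤-reflexive (proj₁ (∈𝓑⇒Large i))) t<k)
    (λ F g → subst (λ A → t ≤ ∣ A ∣) (∩-comm F B) (G-meets-𝓑 g i))

  Sparse : Subset n → Set
  Sparse F = G F × All (λ B → ¬ B ⊆ F) 𝓑

  Sparse? : Decidable Sparse
  Sparse? F = G? F ×-dec All.all? (λ B → ¬? (B ⊆? F)) 𝓑

  -- A witness of non-triviality for each `t`-set; the default `F₁` at other sizes keeps `pick-G`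
  -- unconditional.
  pick : Subset n → Subset n
  pick T with ∣ T ∣ ≟ t
  ... | yes e = proj₁ (uncovered T e)
  ... | no _ = F₁

  pick-G : ∀ T → G (pick T)
  pick-G T with ∣ T ∣ ≟ t
  ... | yes e = proj₁ (proj₂ (uncovered T e))
  ... | no _ = G₁

  pick-⊉ : ∀ T → ∣ T ∣ ≡ t → ¬ T ⊆ pick T
  pick-⊉ T ∣T∣ with ∣ T ∣ ≟ t
  ... | yes e = proj₂ (proj₂ (uncovered T e))
  ... | no ≢ = contradiction ∣T∣ ≢

  -- `2 ^ k` windows, one for each subset of `F₁`; `2 ^ (k + k)` subsets of a window, which is a
  -- union of two members; and the factor `k` of `threshold`.
  sparse-constant : ℕ
  sparse-constant = 2 ^ k * (2 ^ (k + k) * k)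

  -- Take a `t`-set `T` in `F ∩ F₁`. The member `pick T` does not contain `T`, yet `F` meets it in
  -- at least `t` points, so one of these lies off `T`. Together with `T` it gives `t + 1` points of
  -- `F` in the window `F₁ ∪ pick T`.
  sparse-bound : # Sparse? ≤ sparse-constant * d n k (suc (suc t))
  sparse-bound = ≤-trans
    (windows G? Sparse? 𝒲 (k + k) (suc t) threshold small (λ _ → proj₁) meets
      (λ F B sp B⊆F ∣B∣ → ≮⇒≥ λ large →
         All.lookup (proj₂ sp) (∈-subsets⁺ Large? (∣B∣ , large)) B⊆F))
    (≤-trans (*-monoˡ-≤ (2 ^ (k + k) * threshold) ∣𝒲∣)
      (≤-reflexive (reassociate (2 ^ k) (2 ^ (k + k)) k (d n k (suc (suc t))))))
    where
    reassociate : ∀ a b c e → a * (b * (c * e)) ≡ a * (b * c) * e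
    reassociate = solve-∀
    𝒲 : List (Subset n)
    𝒲 = map (λ T → F₁ ∪ pick T) (subsets (_⊆? F₁))
    ∣𝒲∣ : length 𝒲 ≤ 2 ^ k
    ∣𝒲∣ = ≤-trans (≤-reflexive (length-map _ (subsets (_⊆? F₁))))
      (≤-trans (powerset-length F₁) (≤-reflexive (cong (2 ^_) (uniform F₁ G₁))))
    small : ∀ {W} → W ∈ₗ 𝒲 → ∣ W ∣ ≤ k + k
    small i with ∈-map⁻ _ i
    ... | T , _ , refl = ≤-trans (∣∪∣≤ F₁ (pick T))
      (≤-reflexive (cong₂ _+_ (uniform F₁ G₁) (uniform _ (pick-G T))))
    meets : ∀ F → Sparse F → ∃ λ W → W ∈ₗ 𝒲 × suc t ≤ ∣ F ∩ W ∣
    meets F (g , _) with choose-subset t (F ∩ F₁) (intersecting F F₁ g G₁)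
    ... | T , s , ∣T∣ with ∣<∣-witness (F ∩ pick T) (T ∩ pick T)
      (≤-trans (subst (∣ T ∩ pick T ∣ <_) ∣T∣ (∣∩∣<∣ T (pick T) (pick-⊉ T ∣T∣)))
               (intersecting F (pick T) g (pick-G T)))
    ...   | x , i , x∉ = F₁ ∪ pick T ,
      ∈-map⁺ _ (∈-subsets⁺ (_⊆? F₁) (λ j → proj₂ (x∈p∩q⁻ F F₁ (s j)))) ,
      ≤-trans (≤-reflexive (sym (trans (∣insert∣ T x∉T) (cong suc ∣T∣))))
        (p⊆q⇒∣p∣≤∣q∣ (insert-⊆ {A = T} {B = F ∩ (F₁ ∪ pick T)}
          (x∈p∩q⁺ (x∈F , x∈p∪q⁺ (inj₂ x∈P)))
          (λ j → let a , b = x∈p∩q⁻ F F₁ (s j) in x∈p∩q⁺ (a , x∈p∪q⁺ (inj₁ b)))))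
      where
      x∈F = proj₁ (x∈p∩q⁻ F (pick T) i)
      x∈P = proj₂ (x∈p∩q⁻ F (pick T) i)
      x∉T : x ∉ T
      x∉T x∈T = x∉ (x∈p∩q⁺ (x∈T , x∈P))

  bound : # G? ≤ length 𝓑 * d n k (suc t) + sparse-constant * d n k (suc (suc t))
  bound = ≤-trans (#-⊎ G? Rich? Sparse? split)
    (+-mono-≤ (#-any 𝓑 Rich? (Star? k) (d n k (suc t)) rich star) sparse-bound)
    where
    Rich? : Decidable (λ F → G F × Any (_⊆ F) 𝓑)
    Rich? F = G? F ×-dec Any.any? (_⊆? F) 𝓑
    split : ∀ F → G F → (G F × Any (_⊆ F) 𝓑) ⊎ Sparse F
    split F g with Any.any? (_⊆? F) 𝓑
    ... | yes a = inj₁ (g , a)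
    ... | no ¬a = inj₂ (g , All.¬Any⇒All¬ 𝓑 ¬a)
    rich : ∀ F → G F × Any (_⊆ F) 𝓑 → ∃ λ B → B ∈ₗ 𝓑 × ∣ F ∣ ≡ k × B ⊆ F
    rich F (g , a) with find a
    ... | B , i , s = B , i , uniform F g , s
    star : ∀ B → B ∈ₗ 𝓑 → # (Star? k B) ≤ d n k (suc t)
    star B i = ≤-reflexive (trans (star-size k B) (cong (d n k) (proj₁ (∈𝓑⇒Large i))))

  -- `∣ F ∩ Y ∣ ≥ t + 1`, phrased by naming one point of `Y` that `F` may omit. The bound on `M`
  -- excludes this type when `k + 1 - t` exceeds `t + 2`.
  TriangleType : Set
  TriangleType = M ≤ suc (suc t) ×
    ∃ λ Y → ∣ Y ∣ ≡ suc (suc t) × (∀ F → G F → ∃ λ i → i ∈ Y × AllBut (_∈ F) i Y)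

  -- A member without `T` consists of the `k + 1 - t` points of `X` and all but one point of `T`.
  -- With `M ≥ t + 2`, the bound on `M` leaves this type only for `k ≥ 2t + 1`.
  HiltonMilnerType : Set
  HiltonMilnerType = M + t ≤ suc k × ∃ λ T → ∃ λ X →
    ∣ T ∣ ≡ t × ∣ X ∣ + t ≡ suc k × (∀ {x} → x ∈ X → x ∉ T) ×
    (∀ F → G F → (T ⊆ F × ∃ λ x → x ∈ X × x ∈ F)
                 ⊎ (∃ λ i → i ∈ T × AllBut (_∈ F) i T × X ⊆ F))

  3≤M : 3 ≤ M
  3≤M = ≤-trans (s≤s (s≤s 1≤t)) t+2≤M

  -- Each large set is `Y` minus a point, which bounds their number by `t + 2`. If a member misses
  -- two points of `Y`, a large set containing both would meet it in fewer than `t` points; so every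
  -- large set omits one of the two, which leaves at most two of them, fewer than `M`.
  triangle : M ≤ length 𝓑 → ∀ Y → ∣ Y ∣ ≡ suc (suc t) → (∀ {B} → B ∈ₗ 𝓑 → B ⊆ Y) → TriangleType
  triangle many Y ∣Y∣ 𝓑⊆Y = M≤ , Y , ∣Y∣ , shape
    where
    ≡Y- : ∀ {B z} → B ∈ₗ 𝓑 → z ∈ Y → z ∉ B → B ≡ Y - z
    ≡Y- {B} {z} i z∈Y z∉B = ⊆-size-≡
      (λ {w} w∈B → x∈p∧x≢y⇒x∈p-y (𝓑⊆Y i w∈B) λ { refl → z∉B w∈B })
      (trans (proj₁ (∈𝓑⇒Large i)) (suc-injective (sym (trans (∣-∣ Y z∈Y) ∣Y∣))))
    M≤ : M ≤ suc (suc t)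
    M≤ = ≤-trans many (≤-trans (unique-⊆-length (subsets-unique Large?) listed)
      (≤-reflexive (trans (length-map (Y -_) (elems Y)) (trans (length-elems Y) ∣Y∣))))
      where
      listed : ∀ {B} → B ∈ₗ 𝓑 → B ∈ₗ map (Y -_) (elems Y)
      listed {B} i with ∣<∣-witness Y B (≤-reflexive (trans (cong suc (proj₁ (∈𝓑⇒Large i))) (sym ∣Y∣)))
      ... | z , z∈Y , z∉B rewrite ≡Y- i z∈Y z∉B = ∈-map⁺ (Y -_) (∈-elems⁺ z∈Y)
    shape : ∀ F → G F → ∃ λ i → i ∈ Y × AllBut (_∈ F) i Y
    shape F g with nonempty? (Y ─ F)
    ... | no empty = let y , y∈Y , _ = ∣<∣-witness Y ⊥ (subst₂ _<_ (sym (∣⊥∣≡0 n)) (sym ∣Y∣) (s≤s z≤n))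
                     in y , y∈Y , inside
      where
      inside : ∀ {j} → j ∈ Y → j ≡ _ ⊎ j ∈ F
      inside {j} j∈Y with j ∈? F
      ... | yes j∈F = inj₂ j∈F
      ... | no j∉F = contradiction (j , x∈p∧x∉q⇒x∈p─q j∈Y j∉F) empty
    ... | yes (i , i∈) = i , i∈Y , others
      where
      i∈Y = proj₁ (∈─⁻ Y F i∈)
      i∉F = proj₂ (∈─⁻ Y F i∈)
      others : ∀ {j} → j ∈ Y → j ≡ i ⊎ j ∈ F
      others {j} j∈Y with j Fin.≟ i | j ∈? F
      ... | yes e | _ = inj₁ e
      ... | no _ | yes j∈F = inj₂ j∈F
      ... | no j≢i | no j∉F = contradiction
        (≤-trans 3≤M (≤-trans many (unique-⊆-length (subsets-unique Large?) two))) λ { (s≤s (s≤s ())) }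
        where
        two : ∀ {B} → B ∈ₗ 𝓑 → B ∈ₗ (Y - i) ∷ (Y - j) ∷ []
        two {B} b with i ∈? B | j ∈? B
        ... | no i∉B | _ = here (≡Y- b i∈Y i∉B)
        ... | yes _ | no j∉B = there (here (≡Y- b j∈Y j∉B))
        ... | yes i∈B | yes j∈B = contradiction
          (≤-trans (s≤s (s≤s (G-meets-𝓑 g b))) (∣∩∣+2≤ B F i∈B i∉F j∈B j∉F j≢i))
          (<⇒≱ (≤-reflexive (cong suc (proj₁ (∈𝓑⇒Large b)))))

  -- Each large set is `T` with one petal point. A member without `T` meets `T` in fewer than `t`
  -- points, so it contains every petal point. Hence `F₀ ─ T` has at least `M` points, and at most
  -- `k + 1 - t`, as `F₀` misses only one point of `T`. Equality throughout forces `X` into every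
  -- member without `T`.
  hiltonMilner : M ≤ length 𝓑 → ∀ T → ∣ T ∣ ≡ t → (∀ {B} → B ∈ₗ 𝓑 → T ⊆ B) → HiltonMilnerType
  hiltonMilner many T ∣T∣ T⊆𝓑 =
    ≤-trans (+-monoˡ-≤ t (many≤ G₀ G₀ T⊈F₀ T⊈F₀)) (≤-trans (+-monoˡ-≤ t (p⊆q⇒∣p∣≤∣q∣ (core⊆X F₀))) (∣X∣ G₀)) ,
    T , X , ∣T∣ , ≤-antisym (∣X∣ G₀) (≤-trans k<M+t (+-monoˡ-≤ t (≤-trans (many≤ G₀ G₀ T⊈F₀ T⊈F₀) (p⊆q⇒∣p∣≤∣q∣ (core⊆X F₀))))) ,
    (λ i → proj₂ (∈─⁻ F₀ T i)) , shape
    where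
    F₀ = proj₁ (uncovered T ∣T∣)
    G₀ = proj₁ (proj₂ (uncovered T ∣T∣))
    T⊈F₀ = proj₂ (proj₂ (uncovered T ∣T∣))
    X = F₀ ─ T
    core⊆X : ∀ F → (F₀ ∩ F) ─ T ⊆ X
    core⊆X F i with ∈─⁻ (F₀ ∩ F) T i
    ... | a , b = x∈p∧x∉q⇒x∈p─q (proj₁ (x∈p∩q⁻ F₀ F a)) b
    petal : ∀ {B} → B ∈ₗ 𝓑 → ∃ λ z → z ∉ T × B ≡ insert z T
    petal {B} i with ∣<∣-witness B T (≤-reflexive (trans (cong suc ∣T∣) (sym (proj₁ (∈𝓑⇒Large i)))))
    ... | z , z∈B , z∉T = z , z∉T , sym (⊆-size-≡ (insert-⊆ {A = T} {B = B} z∈B (T⊆𝓑 i))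
      (trans (∣insert∣ T z∉T) (trans (cong suc ∣T∣) (sym (proj₁ (∈𝓑⇒Large i))))))
    ∣F∩T∣< : ∀ {F} → ¬ T ⊆ F → ∣ F ∩ T ∣ < t
    ∣F∩T∣< {F} T⊈F = subst₂ _<_ (cong ∣_∣ (∩-comm T F)) ∣T∣ (∣∩∣<∣ T F T⊈F)
    petal∈ : ∀ {F z} → G F → ¬ T ⊆ F → insert z T ∈ₗ 𝓑 → z ∈ F
    petal∈ {F} {z} g T⊈F i with z ∈? F
    ... | yes z∈F = z∈F
    ... | no z∉F = contradiction (≤-trans (G-meets-𝓑 g i) (∩-mono-∣ F (insert z T) F T core)) (<⇒≱ (∣F∩T∣< T⊈F))
      where
      core : ∀ {x} → x ∈ F → x ∈ insert z T → x ∈ F × x ∈ T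
      core x∈F j with ∈-insert⁻ T j
      ... | inj₁ refl = contradiction x∈F z∉F
      ... | inj₂ x∈T = x∈F , x∈T
    many≤ : ∀ {F F′} → G F → G F′ → ¬ T ⊆ F → ¬ T ⊆ F′ → M ≤ ∣ (F ∩ F′) ─ T ∣
    many≤ {F} {F′} g g′ T⊈F T⊈F′ = ≤-trans many (≤-trans
      (unique-⊆-length (subsets-unique Large?) listed)
      (≤-reflexive (trans (length-map (λ z → insert z T) (elems ((F ∩ F′) ─ T))) (length-elems ((F ∩ F′) ─ T)))))
      where
      listed : ∀ {B} → B ∈ₗ 𝓑 → B ∈ₗ map (λ z → insert z T) (elems ((F ∩ F′) ─ T))
      listed i with petal i
      ... | z , z∉T , refl = ∈-map⁺ _ (∈-elems⁺ (x∈p∧x∉q⇒x∈p─q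
        (x∈p∩q⁺ (petal∈ g T⊈F i , petal∈ g′ T⊈F′ i)) z∉T))
    -- A large set has a single point off `T`, so a member meeting it in `t` points meets `T` in at
    -- least `t - 1`.
    t≤1+ : ∀ {F} → G F → t ≤ suc ∣ F ∩ T ∣
    t≤1+ {F} g with nonempty-list 𝓑 (≤-trans (s≤s z≤n) (≤-trans 3≤M many))
    ... | B , i with petal i
    ...   | z , z∉T , e = ≤-trans (G-meets-𝓑 g i)
      (≤-trans (p⊆q⇒∣p∣≤∣q∣ within) (∣insert∣≤ (F ∩ T)))
      where
      ∣insert∣≤ : ∀ A → ∣ insert z A ∣ ≤ suc ∣ A ∣
      ∣insert∣≤ A with z ∈? A
      ... | no z∉A = ≤-reflexive (∣insert∣ A z∉A)
      ... | yes z∈A = m≤n⇒m≤1+n (p⊆q⇒∣p∣≤∣q∣ (insert-⊆ {A = A} {B = A} z∈A id))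
      within : F ∩ B ⊆ insert z (F ∩ T)
      within {w} m with x∈p∩q⁻ F B m
      ... | w∈F , w∈B with ∈-insert⁻ T (subst (w ∈_) e w∈B)
      ...   | inj₁ refl = x∈insert z (F ∩ T)
      ...   | inj₂ w∈T = insert-⊇ z (F ∩ T) (x∈p∩q⁺ (w∈F , w∈T))
    ∣X∣ : ∀ {F} → G F → ∣ F ─ T ∣ + t ≤ suc k
    ∣X∣ {F} g = ≤-trans (+-monoʳ-≤ ∣ F ─ T ∣ (t≤1+ g)) (≤-reflexive
      (trans (+-suc _ _) (cong suc (trans (+-comm ∣ F ─ T ∣ _) (trans (∣∩∣+∣─∣ F T) (uniform F g))))))
    X⊆ : ∀ {F} → G F → ¬ T ⊆ F → X ⊆ F
    X⊆ {F} g T⊈F x∈X = proj₂ (x∈p∩q⁻ F₀ F (proj₁ (∈─⁻ (F₀ ∩ F) T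
      (⊆-full {A = (F₀ ∩ F) ─ T} {B = X} (core⊆X F) large x∈X))))
      where
      large : ∣ X ∣ ≤ ∣ (F₀ ∩ F) ─ T ∣
      large = ≤-trans (+-cancelʳ-≤ t _ _ (≤-trans (∣X∣ G₀) k<M+t)) (many≤ G₀ g T⊈F₀ T⊈F)
    shape : ∀ F → G F → (T ⊆ F × ∃ λ x → x ∈ X × x ∈ F)
                        ⊎ (∃ λ i → i ∈ T × AllBut (_∈ F) i T × X ⊆ F)
    shape F g with T ⊆? F
    ... | yes T⊆F with ∣<∣-witness (F ∩ F₀) (T ∩ F₀)
          (≤-trans (subst (∣ T ∩ F₀ ∣ <_) ∣T∣ (∣∩∣<∣ T F₀ T⊈F₀)) (intersecting F F₀ g G₀))
    ...   | x , i , x∉ = inj₁ (T⊆F , x , x∈p∧x∉q⇒x∈p─q x∈F₀ (λ x∈T → x∉ (x∈p∩q⁺ (x∈T , x∈F₀))) ,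
                                proj₁ (x∈p∩q⁻ F F₀ i))
      where x∈F₀ = proj₂ (x∈p∩q⁻ F F₀ i)
    shape F g | no T⊈F with ∉-witness T F T⊈F
    ... | i , i∈T , i∉F = inj₂ (i , i∈T , others , X⊆ g T⊈F)
      where
      others : ∀ {j} → j ∈ T → j ≡ i ⊎ j ∈ F
      others {j} j∈T with j Fin.≟ i | j ∈? F
      ... | yes e | _ = inj₁ e
      ... | no _ | yes j∈F = inj₂ j∈F
      ... | no j≢i | no j∉F = contradiction
        (≤-trans (s≤s (t≤1+ g)) (≤-trans (∣∩∣+2≤ T F i∈T i∉F j∈T j∉F j≢i) (≤-reflexive ∣T∣))) 1+n≰n

  ∣𝓑∣ : ∀ {B} → B ∈ₗ 𝓑 → ∣ B ∣ ≡ suc t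
  ∣𝓑∣ i = proj₁ (∈𝓑⇒Large i)

  beyond : ∀ {T B} → ∣ T ∣ ≡ t → B ∈ₗ 𝓑 → T ⊆ B → ∃ λ z → z ∈ B × z ∉ T × insert z T ≡ B
  beyond {T} {B} ∣T∣ i T⊆B with ∣<∣-witness B T (≤-reflexive (trans (cong suc ∣T∣) (sym (∣𝓑∣ i))))
  ... | z , z∈B , z∉T = z , z∈B , z∉T , ⊆-size-≡ (insert-⊆ {A = T} {B = B} z∈B T⊆B)
    (trans (∣insert∣ T z∉T) (trans (cong suc ∣T∣) (sym (∣𝓑∣ i))))

  -- `Y` is the union of `B₁` and `B₂`. A large set without `T` needs `y` to meet `B₂` in `t`
  -- points, and its other `t` points lie in `B₁`, so it lies in `Y`. Once such a set exists, a
  -- large set through `T` with a point off `Y` would meet it only inside `T`, in fewer than `t`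
  -- points.
  dichotomy-at : M ≤ length 𝓑 → ∀ {T B₁ B₂ y} → B₁ ∈ₗ 𝓑 → B₂ ∈ₗ 𝓑 → ∣ T ∣ ≡ t → T ⊆ B₁ →
    y ∉ B₁ → insert y T ≡ B₂ → TriangleType ⊎ HiltonMilnerType
  dichotomy-at many {T} {B₁} {B₂} {y} i₁ i₂ ∣T∣ T⊆B₁ y∉B₁ e₂ = dichotomy
    where
    Y = insert y B₁
    ∣Y∣ : ∣ Y ∣ ≡ suc (suc t)
    ∣Y∣ = trans (∣insert∣ B₁ y∉B₁) (cong suc (∣𝓑∣ i₁))
    ∣∩T∣< : ∀ {B} → ¬ T ⊆ B → ∣ B ∩ T ∣ < t
    ∣∩T∣< {B} s = subst₂ _<_ (cong ∣_∣ (∩-comm T B)) ∣T∣ (∣∩∣<∣ T B s)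
    y∈ : ∀ {B} → B ∈ₗ 𝓑 → ¬ T ⊆ B → y ∈ B
    y∈ {B} i T⊈B with y ∈? B
    ... | yes j = j
    ... | no y∉B = contradiction (≤-trans (𝓑-meets-𝓑 i i₂) (∩-mono-∣ B B₂ B T core)) (<⇒≱ (∣∩T∣< T⊈B))
      where
      core : ∀ {x} → x ∈ B → x ∈ B₂ → x ∈ B × x ∈ T
      core {x} x∈B x∈B₂ with ∈-insert⁻ T (subst (x ∈_) (sym e₂) x∈B₂)
      ... | inj₁ refl = contradiction x∈B y∉B
      ... | inj₂ x∈T = x∈B , x∈T
    off⊆Y : ∀ {B} → B ∈ₗ 𝓑 → ¬ T ⊆ B → B ⊆ Y
    off⊆Y {B} i T⊈B z∈B = [ (λ { refl → x∈insert y B₁ }) ,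
                            (λ j → insert-⊇ y B₁ (proj₂ (x∈p∩q⁻ B B₁ j))) ]′
                          (∈-insert⁻ (B ∩ B₁) (covers z∈B))
      where
      y∉B∩B₁ : y ∉ B ∩ B₁
      y∉B∩B₁ j = y∉B₁ (proj₂ (x∈p∩q⁻ B B₁ j))
      covers : B ⊆ insert y (B ∩ B₁)
      covers = ⊆-full {A = insert y (B ∩ B₁)} {B = B}
        (insert-⊆ {A = B ∩ B₁} {B = B} (y∈ i T⊈B) (p∩q⊆p B B₁))
        (≤-trans (≤-reflexive (∣𝓑∣ i)) (≤-trans (s≤s (𝓑-meets-𝓑 i i₁))
          (≤-reflexive (sym (∣insert∣ (B ∩ B₁) y∉B∩B₁)))))
    dichotomy : TriangleType ⊎ HiltonMilnerType
    dichotomy with All.all? (T ⊆?_) 𝓑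
    ... | yes all = inj₂ (hiltonMilner many T ∣T∣ (λ i → All.lookup all i))
    ... | no ¬all with find (All.¬All⇒Any¬ (T ⊆?_) 𝓑 ¬all)
    ...   | B₃ , i₃ , T⊈B₃ = inj₁ (triangle many Y ∣Y∣ inY)
      where
      inY : ∀ {B} → B ∈ₗ 𝓑 → B ⊆ Y
      inY {B} i with T ⊆? B
      ... | no T⊈B = off⊆Y i T⊈B
      ... | yes T⊆B with beyond ∣T∣ i T⊆B
      ...   | z , z∈B , z∉T , e with z ∈? Y
      ...     | yes z∈Y = λ w∈B → [ (λ { refl → z∈Y }) , (λ w∈T → insert-⊇ y B₁ (T⊆B₁ w∈T)) ]′
                            (∈-insert⁻ T (subst (_ ∈_) (sym e) w∈B))
      ...     | no z∉Y = contradiction (≤-trans (𝓑-meets-𝓑 i₃ i) (∩-mono-∣ B₃ B B₃ T core)) (<⇒≱ (∣∩T∣< T⊈B₃))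
        where
        core : ∀ {x} → x ∈ B₃ → x ∈ B → x ∈ B₃ × x ∈ T
        core {x} x∈B₃ x∈B with ∈-insert⁻ T (subst (x ∈_) (sym e) x∈B)
        ... | inj₁ refl = contradiction (off⊆Y i₃ T⊈B₃ x∈B₃) z∉Y
        ... | inj₂ x∈T = x∈B₃ , x∈T

  sunflower-or-triangle : M ≤ length 𝓑 → ∀ {B₁ B₂} → B₁ ∈ₗ 𝓑 → B₂ ∈ₗ 𝓑 → B₁ ≢ B₂ →
    TriangleType ⊎ HiltonMilnerType
  sunflower-or-triangle many {B₁} {B₂} i₁ i₂ B₁≢B₂ =
    let y , y∈B₂ , y∉T , e = beyond ∣T∣ i₂ (p∩q⊆q B₁ B₂)
    in dichotomy-at many i₁ i₂ ∣T∣ (p∩q⊆p B₁ B₂) (λ j → y∉T (x∈p∩q⁺ (j , y∈B₂))) e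
    where
    ∣T∣ : ∣ B₁ ∩ B₂ ∣ ≡ t
    ∣T∣ = ≤-antisym (s≤s⁻¹ (subst (∣ B₁ ∩ B₂ ∣ <_) (∣𝓑∣ i₁) (∣∩∣<∣ B₁ B₂ λ s →
      B₁≢B₂ (⊆-size-≡ s (trans (∣𝓑∣ i₁) (sym (∣𝓑∣ i₂))))))) (𝓑-meets-𝓑 i₁ i₂)

  structure : length 𝓑 < M ⊎ TriangleType ⊎ HiltonMilnerType
  structure with length 𝓑 <? M
  ... | yes lt = inj₁ lt
  ... | no ≮ = inj₂ (two-members 𝓑 refl)
    where
    many = ≮⇒≥ ≮
    two-members : ∀ L → L ≡ 𝓑 → TriangleType ⊎ HiltonMilnerType
    two-members [] e = contradiction (≤-trans 3≤M (subst (λ L → M ≤ length L) (sym e) many)) λ ()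
    two-members (_ ∷ []) e = contradiction (≤-trans 3≤M (subst (λ L → M ≤ length L) (sym e) many)) λ { (s≤s ()) }
    two-members (B₁ ∷ B₂ ∷ L) e = sunflower-or-triangle many
      (subst (B₁ ∈ₗ_) e (here refl)) (subst (B₂ ∈ₗ_) e (there (here refl)))
      (distinct (subst Unique (sym e) (subsets-unique Large?)))
      where
      distinct : Unique (B₁ ∷ B₂ ∷ L) → B₁ ≢ B₂
      distinct ((u ∷ _) ∷ _) = u

-- Pulling blocks apart

fresh : (L : List (Fin n)) → length L < n → ∃ λ y → ¬ y ∈ₗ L
fresh {n} L lt with Fin.any? (λ y → ¬? (DecMembership._∈?_ Fin._≟_ y L))
... | yes w = w
... | no ¬w = contradiction
  (≤-trans (≤-reflexive (sym (length-tabulate id))) (unique-⊆-length (Unique.allFin⁺ n) all-used))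
  (<⇒≱ lt)
  where
  all-used : ∀ {y} → y ∈ₗ allFin n → y ∈ₗ L
  all-used {y} _ with DecMembership._∈?_ Fin._≟_ y L
  ... | yes i = i
  ... | no ∉ = contradiction (y , ∉) ¬w

∣remove∣ : (A : Subset n) (x : Fin n) → lookup A x ≡ true → suc ∣ A [ x ]≔ false ∣ ≡ ∣ A ∣
∣remove∣ (true ∷ A) zero _ = refl
∣remove∣ (true ∷ A) (suc x) e = cong suc (∣remove∣ A x e)
∣remove∣ (false ∷ A) (suc x) e = ∣remove∣ A x e

∣move∣ : (A : Subset n) {x y : Fin n} → x ≢ y → lookup A x ≡ true → lookup A y ≡ false →
  ∣ A [ x ]≔ false [ y ]≔ true ∣ ≡ ∣ A ∣
∣move∣ A {x} {y} x≢y Ax Ay = trans (∣insert∣ (A [ x ]≔ false) y∉) (∣remove∣ A x Ax)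
  where
  y∉ : y ∉ A [ x ]≔ false
  y∉ i = contradiction (trans (sym (∈⇒lookup i))
    (trans (lookup∘updateAt′ y x (x≢y ∘ sym) A) Ay)) λ ()

lookup-moved : (A : Subset n) {x y z : Fin n} → z ≢ x → z ≢ y →
  lookup (A [ x ]≔ false [ y ]≔ true) z ≡ lookup A z
lookup-moved A {x} {y} {z} z≢x z≢y =
  trans (lookup∘updateAt′ z y z≢y (A [ x ]≔ false)) (lookup∘updateAt′ z x z≢x A)

lookup-moved-from : (A : Subset n) {x y : Fin n} → x ≢ y → lookup (A [ x ]≔ false [ y ]≔ true) x ≡ false
lookup-moved-from A {x} {y} x≢y = trans (lookup∘updateAt′ x y x≢y (A [ x ]≔ false)) (lookup∘updateAt x A)

-- A monotone condition on sets is written as a disjunction of blocks, each a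
-- monotone condition on a list of coordinates; φ places the coordinates in [n].
-- Blocks may overlap under φ, but a block is placed injectively.
module Blocks {X I : Set} (_≟ₓ_ : (x y : X) → Dec (x ≡ y)) (coords : I → List X)
  (Sat : I → (X → Bool) → Set) (sat? : ∀ i a → Dec (Sat i a))
  (mono : ∀ i {a b} → (∀ {x} → x ∈ₗ coords i → a x ≡ true → b x ≡ true) → Sat i a → Sat i b)
  (L : List I) (k : ℕ) where

  open DecMembership _≟ₓ_ using () renaming (_∈?_ to _∈ₓ?_)

  Placed : (X → Fin n) → Subset n → Set
  Placed φ F = ∣ F ∣ ≡ k × Any (λ i → Sat i (lookup F ∘ φ)) L

  Placed? : (φ : X → Fin n) → Decidable (Placed φ)
  Placed? φ F = (∣ F ∣ ≟ k) ×-dec Any.any? (λ i → sat? i (lookup F ∘ φ)) L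

  BlockInjective : (X → Fin n) → Set
  BlockInjective φ = ∀ {i} → i ∈ₗ L → ∀ {x y} → x ∈ₗ coords i → y ∈ₗ coords i → φ x ≡ φ y → x ≡ y

  update : (X → Fin n) → X → Fin n → X → Fin n
  update φ c y x with x ≟ₓ c
  ... | yes _ = y
  ... | no _ = φ x

  update-off : (φ : X → Fin n) (c : X) (y : Fin n) {x : X} → x ≢ c → update φ c y x ≡ φ x
  update-off φ c y {x} x≢c with x ≟ₓ c
  ... | yes e = contradiction e x≢c
  ... | no _ = refl

  module _ {n : ℕ} (all : List X) (coords⊆all : ∀ {i x} → i ∈ₗ L → x ∈ₗ coords i → x ∈ₗ all) where

    placed-mono : (φ ψ : X → Fin n) (A B : Subset n) → ∣ A ∣ ≡ ∣ B ∣ →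
      (∀ {x} → x ∈ₗ all → lookup A (φ x) ≡ true → lookup B (ψ x) ≡ true) → Placed φ A → Placed ψ B
    placed-mono φ ψ A B ∣A∣≡∣B∣ h (e , a) with find a
    ... | i , i∈L , sat = trans (sym ∣A∣≡∣B∣) e , lose i∈L (mono i (λ j → h (coords⊆all i∈L j)) sat)

    update-injective : (φ : X → Fin n) (c : X) (y : Fin n) → (∀ {x} → x ∈ₗ all → φ x ≢ y) →
      BlockInjective φ → BlockInjective (update φ c y)
    update-injective φ c y unused inj {i} i∈L {x} {z} jx jz e with x ≟ₓ c | z ≟ₓ c
    ... | yes refl | yes refl = refl
    ... | yes refl | no _ = contradiction (sym e) (unused (coords⊆all i∈L jz))
    ... | no _ | yes refl = contradiction e (unused (coords⊆all i∈L jx))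
    ... | no _ | no _ = inj i∈L jx jz e

    -- Among sets that contain exactly one of φ c and y, exchanging the two pairs them
    -- up, and a block that needs c needs no other coordinate placed at φ c.
    update-≤ : (φ : X → Fin n) (c : X) (y : Fin n) → c ∈ₗ all → (∀ {x} → x ∈ₗ all → φ x ≢ y) →
      BlockInjective φ → # (Placed? φ) ≤ # (Placed? (update φ c y))
    update-≤ φ c y c∈all unused inj = S-exchange (unused c∈all) pair same
      where
      φ′ = update φ c y
      same : ∀ A → lookup A (φ c) ≡ lookup A y → 𝟙 (Placed? φ A) ≤ 𝟙 (Placed? φ′ A)
      same A e = 𝟙-mono (Placed? φ A) (Placed? φ′ A) (placed-mono φ φ′ A A refl keep)
        where
        keep : ∀ {x} → x ∈ₗ all → lookup A (φ x) ≡ true → lookup A (φ′ x) ≡ true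
        keep {x} _ h with x ≟ₓ c
        ... | yes refl = trans (sym e) h
        ... | no _ = h
      pair : ∀ A → lookup A (φ c) ≡ true → lookup A y ≡ false → _
      pair A Au Ay = 𝟙-pair (Placed? φ A) (Placed? φ A′) (Placed? φ′ A) (Placed? φ′ A′) high low
        where
        A′ = A [ φ c ]≔ false [ y ]≔ true
        ∣A′∣ : ∣ A′ ∣ ≡ ∣ A ∣
        ∣A′∣ = ∣move∣ A (unused c∈all) Au Ay
        -- A block without `c` is still satisfied by `A`; one with `c` is satisfied by `A′`, which
        -- holds `y` in place of `φ c`.
        high : Placed φ A → Placed φ′ A ⊎ Placed φ′ A′
        high (e , a) with find a
        ... | i , i∈L , sat with c ∈ₓ? coords i
        ...   | no c∉ = inj₁ (e , lose i∈L (mono i keep sat))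
          where
          keep : ∀ {x} → x ∈ₗ coords i → lookup A (φ x) ≡ true → lookup A (φ′ x) ≡ true
          keep j h = trans (cong (lookup A) (update-off φ c y λ { refl → c∉ j })) h
        ...   | yes c∈ = inj₂ (trans ∣A′∣ e , lose i∈L (mono i keep sat))
          where
          keep : ∀ {x} → x ∈ₗ coords i → lookup A (φ x) ≡ true → lookup A′ (φ′ x) ≡ true
          keep {x} j h with x ≟ₓ c
          ... | yes refl = lookup∘updateAt y (A [ φ c ]≔ false)
          ... | no x≢c = trans (lookup-moved A (λ e → x≢c (inj i∈L j c∈ e)) (unused (coords⊆all i∈L j))) h
        -- `A′` lacks `φ c`, so only coordinates placed elsewhere contribute, and neither the update
        -- nor undoing the exchange affects them.
        low : Placed φ A′ → Placed φ′ A × Placed φ′ A′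
        low p = placed-mono φ φ′ A′ A ∣A′∣ (λ j h → proj₁ (keep j h)) p ,
                placed-mono φ φ′ A′ A′ refl (λ j h → proj₂ (keep j h)) p
          where
          keep : ∀ {x} → x ∈ₗ all → lookup A′ (φ x) ≡ true →
            lookup A (φ′ x) ≡ true × lookup A′ (φ′ x) ≡ true
          keep {x} j h with φ x Fin.≟ φ c
          ... | yes e = contradiction
            (trans (sym h) (trans (cong (lookup A′) e) (lookup-moved-from A (unused c∈all)))) λ ()
          ... | no φx≢ = trans (cong (lookup A) off) (trans (sym (lookup-moved A φx≢ (unused j))) h) ,
                         trans (cong (lookup A′) off) h
            where
            off : φ′ x ≡ φ x
            off = update-off φ c y λ { refl → φx≢ refl }

    -- First every coordinate is moved away from the range of g, then each to its target.
    spread : (φ g : X → Fin n) → length all + length all < n → BlockInjective φ →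
      (∀ {x y} → x ∈ₗ all → y ∈ₗ all → g x ≡ g y → x ≡ y) → # (Placed? φ) ≤ # (Placed? g)
    spread φ g room injφ injg with settle all id
      where
      scatter : ∀ xs → (∀ {x} → x ∈ₗ xs → x ∈ₗ all) →
        ∃ λ ψ → BlockInjective ψ × # (Placed? φ) ≤ # (Placed? ψ) × (∀ {x} → x ∈ₗ xs → ¬ ψ x ∈ₗ map g all)
      scatter [] _ = φ , injφ , ≤-refl , λ ()
      scatter (c ∷ xs) sub with scatter xs (sub ∘ there)
      -- The new point avoids all current positions and all targets, which calls for twice the
      -- number of coordinates.
      ... | ψ , injψ , le , away with fresh (map ψ all ++ map g all)
        (subst (_< n) (sym (trans (length-++ (map ψ all)) (cong₂ _+_ (length-map ψ all) (length-map g all)))) room)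
      ...   | y , y∉ = update ψ c y , update-injective ψ c y unused injψ ,
        ≤-trans le (update-≤ ψ c y (sub (here refl)) unused injψ) , away′
        where
        unused : ∀ {x} → x ∈ₗ all → ψ x ≢ y
        unused j refl = y∉ (∈-++⁺ˡ (∈-map⁺ ψ j))
        away′ : ∀ {x} → x ∈ₗ c ∷ xs → ¬ update ψ c y x ∈ₗ map g all
        away′ {x} j i with x ≟ₓ c
        ... | yes _ = y∉ (∈-++⁺ʳ (map ψ all) i)
        away′ (here e) i | no x≢c = x≢c e
        away′ (there j) i | no _ = away j i
      Settled : (X → Fin n) → X → Set
      Settled ψ x = ψ x ≡ g x ⊎ ¬ ψ x ∈ₗ map g all
      settle : ∀ xs → (∀ {x} → x ∈ₗ xs → x ∈ₗ all) →
        ∃ λ ψ → BlockInjective ψ × # (Placed? φ) ≤ # (Placed? ψ) ×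
          (∀ {x} → x ∈ₗ all → Settled ψ x) × (∀ {x} → x ∈ₗ xs → ψ x ≡ g x)
      settle [] _ = let ψ , injψ , le , away = scatter all id in ψ , injψ , le , inj₂ ∘ away , λ ()
      settle (c ∷ xs) sub with settle xs (sub ∘ there)
      ... | ψ , injψ , le , settled , done with ψ c Fin.≟ g c
      ...   | yes e = ψ , injψ , le , settled , λ { (here refl) → e ; (there j) → done j }
      ...   | no ψc≢ = update ψ c (g c) , update-injective ψ c (g c) unused injψ ,
        ≤-trans le (update-≤ ψ c (g c) (sub (here refl)) unused injψ) , settled′ , done′
        where
        unused : ∀ {x} → x ∈ₗ all → ψ x ≢ g c
        unused {x} j e with settled j
        ... | inj₂ away = away (subst (_∈ₗ map g all) (sym e) (∈-map⁺ g (sub (here refl))))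
        ... | inj₁ e′ with injg j (sub (here refl)) (trans (sym e′) e)
        ...   | refl = ψc≢ e
        settled′ : ∀ {x} → x ∈ₗ all → Settled (update ψ c (g c)) x
        settled′ {x} j with x ≟ₓ c
        ... | yes refl = inj₁ refl
        ... | no _ = settled j
        done′ : ∀ {x} → x ∈ₗ c ∷ xs → update ψ c (g c) x ≡ g x
        done′ {x} j with x ≟ₓ c
        ... | yes refl = refl
        done′ (here e) | no x≢c = contradiction e x≢c
        done′ (there j) | no _ = done j
    ... | ψ , _ , le , _ , done = ≤-trans le (#-mono (Placed? ψ) (Placed? g)
      (λ A → placed-mono ψ g A A refl (λ j h → subst (λ z → lookup A z ≡ true) (done j) h)))

-- Stars and exceptional blocks in coordinates

nth : {X : Set} → X → List X → ℕ → X
nth z [] _ = z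
nth z (x ∷ _) zero = x
nth z (_ ∷ xs) (suc i) = nth z xs i

nth-∈ : {X : Set} (z : X) (L : List X) {i : ℕ} → i < length L → nth z L i ∈ₗ L
nth-∈ z (x ∷ L) {zero} _ = here refl
nth-∈ z (x ∷ L) {suc i} (s≤s lt) = there (nth-∈ z L lt)

nth-index : {X : Set} (z : X) {L : List X} {x : X} → x ∈ₗ L → ∃ λ i → i < length L × nth z L i ≡ x
nth-index z (here refl) = 0 , s≤s z≤n , refl
nth-index z (there j) = let i , lt , e = nth-index z j in suc i , s≤s lt , e

nth-injective : {X : Set} (z : X) {L : List X} → Unique L → {i j : ℕ} →
  i < length L → j < length L → nth z L i ≡ nth z L j → i ≡ j
nth-injective z (u ∷ us) {zero} {zero} _ _ _ = refl
nth-injective z {x ∷ L} (u ∷ us) {zero} {suc j} _ (s≤s lt) e = contradiction e (All.lookup u (nth-∈ z L lt))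
nth-injective z {x ∷ L} (u ∷ us) {suc i} {zero} (s≤s lt) _ e = contradiction (sym e) (All.lookup u (nth-∈ z L lt))
nth-injective z (u ∷ us) {suc i} {suc j} (s≤s lt) (s≤s lt′) e = cong suc (nth-injective z us lt lt′ e)

nth-++ˡ : {X : Set} (z : X) (L L′ : List X) {i : ℕ} → i < length L → nth z (L ++ L′) i ≡ nth z L i
nth-++ˡ z (x ∷ L) L′ {zero} _ = refl
nth-++ˡ z (x ∷ L) L′ {suc i} (s≤s lt) = nth-++ˡ z L L′ lt

nth-++ʳ : {X : Set} (z : X) (L L′ : List X) (i : ℕ) → nth z (L ++ L′) (length L + i) ≡ nth z L′ i
nth-++ʳ z [] L′ i = refl
nth-++ʳ z (x ∷ L) L′ i = nth-++ʳ z L L′ i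

Coord : Set
Coord = ℕ × ℕ

_≟ᶜ_ : (x y : Coord) → Dec (x ≡ y)
_≟ᶜ_ = Product.≡-dec _≟_ _≟_

row : ℕ → ℕ → List Coord
row r l = map (r ,_) (upTo l)

∈-row⁻ : ∀ {r l x} → x ∈ₗ row r l → proj₁ x ≡ r × proj₂ x < l
∈-row⁻ i with ∈-map⁻ _ i
... | _ , j , refl = refl , ∈-upTo⁻ j

∈-row⁺ : ∀ {r l i} → i < l → (r , i) ∈ₗ row r l
∈-row⁺ lt = ∈-map⁺ _ (∈-upTo⁺ lt)

data Kind : Set where
  star triangle hiltonMilner : ℕ → Kind

-- Rows 0, …, m−1 of t coordinates are the kernels of the stars. Row m carries the
-- exceptional block: the t+2 points of the triangle, or the t points of the kernel
-- followed by the k+1−t points that have to be met.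
module Kinds (k t m : ℕ) (t<k : t < k) where

  width : Kind → ℕ
  width (star _) = t
  width (triangle _) = suc (suc t)
  width (hiltonMilner _) = suc k

  rowOf : Kind → ℕ
  rowOf (star r) = r
  rowOf (triangle r) = r
  rowOf (hiltonMilner r) = r

  coords : Kind → List Coord
  coords κ = row (rowOf κ) (width κ)

  -- The Hilton-Milner block lets only a kernel point be omitted: a `k`-set that omits a later point
  -- of the row contains the kernel and meets the other points, so the first alternative has it.
  Sat : Kind → (Coord → Bool) → Set
  Sat (star r) a = ∀ {j} → j < t → a (r , j) ≡ true
  Sat (triangle r) a = ∃ λ i → i < suc (suc t) × (∀ {j} → j < suc (suc t) → j ≡ i ⊎ a (r , j) ≡ true)
  Sat (hiltonMilner r) a =
    ((∀ {j} → j < t → a (r , j) ≡ true) × ∃ λ j → j < suc k × t ≤ j × a (r , j) ≡ true)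
    ⊎ (∃ λ i → i < t × (∀ {j} → j < suc k → j ≡ i ⊎ a (r , j) ≡ true))

  sat? : ∀ κ a → Dec (Sat κ a)
  sat? (star r) a = allUpTo? (λ j → a (r , j) Bool.≟ true) t
  sat? (triangle r) a =
    anyUpTo? (λ i → allUpTo? (λ j → (j ≟ i) ⊎-dec (a (r , j) Bool.≟ true)) (suc (suc t))) (suc (suc t))
  sat? (hiltonMilner r) a =
    (allUpTo? (λ j → a (r , j) Bool.≟ true) t
      ×-dec anyUpTo? (λ j → (t ≤? j) ×-dec (a (r , j) Bool.≟ true)) (suc k))
    ⊎-dec anyUpTo? (λ i → allUpTo? (λ j → (j ≟ i) ⊎-dec (a (r , j) Bool.≟ true)) (suc k)) t

  mono : ∀ κ {a b} → (∀ {x} → x ∈ₗ coords κ → a x ≡ true → b x ≡ true) → Sat κ a → Sat κ b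
  mono (star r) h sat lt = h (∈-row⁺ lt) (sat lt)
  mono (triangle r) h (i , lt , sat) = i , lt , λ lt′ → Sum.map₂ (h (∈-row⁺ lt′)) (sat lt′)
  mono (hiltonMilner r) h (inj₁ (sat , j , lt , le , s)) =
    inj₁ ((λ lt′ → h (∈-row⁺ (<-trans lt′ (m≤n⇒m≤1+n t<k))) (sat lt′)) , j , lt , le , h (∈-row⁺ lt) s)
  mono (hiltonMilner r) h (inj₂ (i , lt , sat)) =
    inj₂ (i , lt , λ lt′ → Sum.map₂ (h (∈-row⁺ lt′)) (sat lt′))

  stars : List Kind
  stars = map star (upTo m)

  -- Row `m` always gets `suc k` coordinates, enough for either exceptional block, so that one
  -- layout serves both.
  allCoords : List Coord
  allCoords = concatMap (λ r → row r t) (upTo m) ++ row m (suc k)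

  ∈-all⁻ : ∀ {r i} → (r , i) ∈ₗ allCoords → (r < m × i < t) ⊎ (r ≡ m × i < suc k)
  ∈-all⁻ j with ∈-++⁻ (concatMap (λ r → row r t) (upTo m)) j
  ... | inj₂ j′ = inj₂ (∈-row⁻ j′)
  ... | inj₁ j′ with find (∈-concatMap⁻ (λ r → row r t) {xs = upTo m} j′)
  ...   | r′ , r′∈ , x∈ with ∈-row⁻ x∈
  ...     | refl , lt = inj₁ (∈-upTo⁻ r′∈ , lt)

  ∈-all-star : ∀ {r i} → r < m → i < t → (r , i) ∈ₗ allCoords
  ∈-all-star r<m i<t = ∈-++⁺ˡ (∈-concatMap⁺ (λ r → row r t) (lose (∈-upTo⁺ r<m) (∈-row⁺ i<t)))

  ∈-all-last : ∀ {i} → i < suc k → (m , i) ∈ₗ allCoords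
  ∈-all-last lt = ∈-++⁺ʳ _ (∈-row⁺ lt)

  N : ℕ
  N = m * t + suc k

  position-< : ∀ {r i} → (r , i) ∈ₗ allCoords → r * t + i < N
  position-< {r} {i} j with ∈-all⁻ j
  ... | inj₂ (refl , lt) = +-monoʳ-< (m * t) lt
  ... | inj₁ (r<m , i<t) = <-≤-trans (+-monoʳ-< (r * t) i<t)
    (≤-trans (≤-reflexive (+-comm (r * t) t)) (≤-trans (*-monoˡ-≤ t r<m) (m≤m+n (m * t) (suc k))))

  -- Rows start `t` apart, and only the last one, row `m`, is longer than `t`.
  position-<-position : ∀ {r i r′ i′} → (r , i) ∈ₗ allCoords → (r′ , i′) ∈ₗ allCoords → r < r′ →
    r * t + i < r′ * t + i′
  position-<-position {r} {i} {r′} {i′} jx jy r<r′ with ∈-all⁻ jx | ∈-all⁻ jy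
  ... | inj₂ (refl , _) | inj₂ (refl , _) = contradiction r<r′ (<-irrefl refl)
  ... | inj₂ (refl , _) | inj₁ (r′<m , _) = contradiction r<r′ (<-asym r′<m)
  ... | inj₁ (_ , i<t) | _ = <-≤-trans (+-monoʳ-< (r * t) i<t)
    (≤-trans (≤-reflexive (+-comm (r * t) t)) (≤-trans (*-monoˡ-≤ t r<r′) (m≤m+n (r′ * t) i′)))

  position-injective : ∀ {x y} → x ∈ₗ allCoords → y ∈ₗ allCoords →
    proj₁ x * t + proj₂ x ≡ proj₁ y * t + proj₂ y → x ≡ y
  position-injective {r , i} {r′ , i′} jx jy e with <-cmp r r′
  ... | tri≈ _ refl _ = cong (r ,_) (+-cancelˡ-≡ (r * t) i i′ e)
  ... | tri< r<r′ _ _ = contradiction e (<⇒≢ (position-<-position jx jy r<r′))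
  ... | tri> _ _ r′<r = contradiction (sym e) (<⇒≢ (position-<-position jy jx r′<r))

module Standard (k t m : ℕ) (t<k : t < k) (n : ℕ) .{{_ : NonZero n}} (N≤n : Kinds.N k t m t<k ≤ n) where

  open Kinds k t m t<k

  module On (L : List Kind) = Blocks _≟ᶜ_ coords Sat sat? mono L k

  opaque
    -- Reduction modulo `n` makes the layout total; on `allCoords` positions are below `N` and stay
    -- unchanged.
    g : Coord → Fin n
    g (r , i) = (r * t + i) mod n

    toℕ-g : ∀ {x} → x ∈ₗ allCoords → Fin.toℕ (g x) ≡ proj₁ x * t + proj₂ x
    toℕ-g j = trans (Fin.toℕ-fromℕ< _) (m<n⇒m%n≡m (<-≤-trans (position-< j) N≤n))

  g-injective : ∀ {x y} → x ∈ₗ allCoords → y ∈ₗ allCoords → g x ≡ g y → x ≡ y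
  g-injective jx jy e = position-injective jx jy
    (trans (sym (toℕ-g jx)) (trans (cong Fin.toℕ e) (toℕ-g jy)))

  Valid : Kind → Set
  Valid κ = (∃ λ r → κ ≡ star r × r < m) ⊎ (rowOf κ ≡ m × width κ ≤ suc k)

  stars-valid : ∀ {κ} → κ ∈ₗ stars → ∃ λ r → κ ≡ star r × r < m
  stars-valid j with ∈-map⁻ star j
  ... | r , r∈ , e = r , e , ∈-upTo⁻ r∈

  valid-coords : ∀ {κ} → Valid κ → ∀ {x} → x ∈ₗ coords κ → x ∈ₗ allCoords
  valid-coords (inj₁ (r , refl , r<m)) j with ∈-row⁻ j
  ... | refl , lt = ∈-all-star r<m lt
  valid-coords (inj₂ (e , w)) j with ∈-row⁻ j
  ... | refl , lt = subst (λ r → (r , _) ∈ₗ allCoords) (sym e) (∈-all-last (≤-trans lt w))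

  module Placement (𝒯 : List (Subset n)) (∣𝒯∣ : length 𝒯 ≡ m) (sizes : ∀ {T} → T ∈ₗ 𝒯 → ∣ T ∣ ≡ t)
    (R : List (Fin n)) (unique : Unique R) (room : length allCoords + length allCoords < n) where

    z : Fin n
    z = 0 mod n

    rows : List (List (Fin n))
    rows = map elems 𝒯 ++ R ∷ []

    -- The placement found in the given family. Kernels may share points with each other and with
    -- `R`, which injectivity on single blocks tolerates. The default `z` fills indices outside the
    -- rows.
    φ : Coord → Fin n
    φ (r , i) = nth z (nth [] rows r) i

    ∣elems𝒯∣ : length (map elems 𝒯) ≡ m
    ∣elems𝒯∣ = trans (length-map elems 𝒯) ∣𝒯∣

    last-row : nth [] rows m ≡ R
    last-row = trans (cong (nth [] rows) (trans (sym ∣elems𝒯∣) (sym (+-identityʳ _))))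
                     (nth-++ʳ [] (map elems 𝒯) (R ∷ []) 0)

    star-row : ∀ {r} → r < m → ∃ λ T → T ∈ₗ 𝒯 × nth [] rows r ≡ elems T
    star-row {r} lt with ∈-map⁻ elems (nth-∈ [] (map elems 𝒯) (subst (r <_) (sym ∣elems𝒯∣) lt))
    ... | T , T∈ , e = T , T∈ , trans (nth-++ˡ [] (map elems 𝒯) (R ∷ []) (subst (r <_) (sym ∣elems𝒯∣) lt)) e

    row-star : ∀ {T} → T ∈ₗ 𝒯 → ∃ λ r → r < m × nth [] rows r ≡ elems T
    row-star T∈ with nth-index [] (∈-map⁺ elems T∈)
    ... | r , lt , e = r , subst (r <_) ∣elems𝒯∣ lt , trans (nth-++ˡ [] (map elems 𝒯) (R ∷ []) lt) e

    place-≤ : (L : List Kind) →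
      (∀ {κ} → κ ∈ₗ L → (∃ λ r → κ ≡ star r × r < m) ⊎ (rowOf κ ≡ m × width κ ≤ suc k × width κ ≤ length R)) →
      {H : Subset n → Set} (H? : Decidable H) → (∀ F → H F → On.Placed L φ F) →
      # H? ≤ # (On.Placed? L g)
    place-≤ L valid H? h = ≤-trans (#-mono H? (On.Placed? L φ) h)
      (On.spread L allCoords (λ j → valid-coords (Sum.map₂ (λ v → proj₁ v , proj₁ (proj₂ v)) (valid j)))
        φ g room injective g-injective)
      where
      injective : On.BlockInjective L φ
      injective κ∈ jx jy e with valid κ∈
      ... | inj₁ (r , refl , r<m) with ∈-row⁻ jx | ∈-row⁻ jy | star-row r<m
      ...   | refl , ltx | refl , lty | T , T∈ , er = cong (r ,_) (nth-injective z (elems-unique T)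
        (subst (_ <_) ∣T∣ ltx) (subst (_ <_) ∣T∣ lty)
        (trans (sym (cong (λ l → nth z l _) er)) (trans e (cong (λ l → nth z l _) er))))
        where
        ∣T∣ : t ≡ length (elems T)
        ∣T∣ = sym (trans (length-elems T) (sizes T∈))
      injective κ∈ jx jy e | inj₂ (er , _ , w) with ∈-row⁻ jx | ∈-row⁻ jy
      ...   | refl , ltx | refl , lty = cong (_ ,_) (nth-injective z unique (≤-trans ltx w) (≤-trans lty w)
        (trans (sym (cong (λ l → nth z l _) row-R)) (trans e (cong (λ l → nth z l _) row-R))))
        where row-R = trans (cong (nth [] rows) er) last-row

    sat-star : ∀ {F T} → T ∈ₗ 𝒯 → T ⊆ F → Any (λ κ → Sat κ (lookup F ∘ φ)) stars
    sat-star {F} {T} T∈ T⊆F with row-star T∈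
    ... | r , lt , e = lose (∈-map⁺ star (∈-upTo⁺ lt)) λ {j} lt′ →
      ∈⇒lookup (T⊆F (subst (λ l → nth z l j ∈ T) (sym e)
        (∈-elems⁻ T (nth-∈ z (elems T) (subst (j <_) (sym (trans (length-elems T) (sizes T∈))) lt′)))))

    φ-last : ∀ {i} → φ (m , i) ≡ nth z R i
    φ-last {i} = cong (λ l → nth z l i) last-row

  module _ (𝒯 : List (Subset n)) (∣𝒯∣ : length 𝒯 ≡ m) (sizes : ∀ {T} → T ∈ₗ 𝒯 → ∣ T ∣ ≡ t)
    (room : length allCoords + length allCoords < n) where

    stars-≤ : {H : Subset n → Set} (H? : Decidable H) →
      (∀ F → H F → ∣ F ∣ ≡ k × Any (_⊆ F) 𝒯) → # H? ≤ # (On.Placed? stars g)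
    stars-≤ H? h = place-≤ stars (inj₁ ∘ stars-valid) H?
      (λ F p → proj₁ (h F p) , let T , T∈ , s = find (proj₂ (h F p)) in sat-star T∈ s)
      where open Placement 𝒯 ∣𝒯∣ sizes [] [] room

    triangle-≤ : (Y : Subset n) → ∣ Y ∣ ≡ suc (suc t) → {H : Subset n → Set} (H? : Decidable H) →
      (∀ F → H F → ∣ F ∣ ≡ k × (Any (_⊆ F) 𝒯 ⊎ ∃ λ i → i ∈ Y × AllBut (_∈ F) i Y)) →
      # H? ≤ # (On.Placed? (triangle m ∷ stars) g)
    triangle-≤ Y ∣Y∣ H? h = place-≤ (triangle m ∷ stars)
      (λ { (here refl) → inj₂ (refl , s≤s t<k , ≤-reflexive (sym ∣R∣)) ; (there j) → inj₁ (stars-valid j) }) H?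
      (λ F p → proj₁ (h F p) , sat F (proj₂ (h F p)))
      where
      open Placement 𝒯 ∣𝒯∣ sizes (elems Y) (elems-unique Y) room
      ∣R∣ : length (elems Y) ≡ suc (suc t)
      ∣R∣ = trans (length-elems Y) ∣Y∣
      sat : ∀ F → (Any (_⊆ F) 𝒯 ⊎ ∃ λ i → i ∈ Y × AllBut (_∈ F) i Y) →
        Any (λ κ → Sat κ (lookup F ∘ φ)) (triangle m ∷ stars)
      sat F (inj₁ a) = let T , T∈ , s = find a in there (sat-star T∈ s)
      sat F (inj₂ (i , i∈Y , but)) with nth-index z (∈-elems⁺ i∈Y)
      ... | i′ , lt , e = here (i′ , subst (i′ <_) ∣R∣ lt , others)
        where
        others : ∀ {j} → j < suc (suc t) → j ≡ i′ ⊎ lookup F (φ (m , j)) ≡ true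
        others {j} lt′ with but (∈-elems⁻ Y (nth-∈ z (elems Y) (subst (j <_) (sym ∣R∣) lt′)))
        ... | inj₁ e′ = inj₁ (nth-injective z (elems-unique Y) (subst (j <_) (sym ∣R∣) lt′) lt (trans e′ (sym e)))
        ... | inj₂ j∈F = inj₂ (∈⇒lookup (subst (_∈ F) (sym φ-last) j∈F))

    hiltonMilner-≤ : (T X : Subset n) → ∣ T ∣ ≡ t → ∣ X ∣ + t ≡ suc k → (∀ {x} → x ∈ X → x ∉ T) →
      {H : Subset n → Set} (H? : Decidable H) →
      (∀ F → H F → ∣ F ∣ ≡ k × (Any (_⊆ F) 𝒯 ⊎ (T ⊆ F × ∃ λ x → x ∈ X × x ∈ F)
                                            ⊎ (∃ λ i → i ∈ T × AllBut (_∈ F) i T × X ⊆ F))) →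
      # H? ≤ # (On.Placed? (hiltonMilner m ∷ stars) g)
    hiltonMilner-≤ T X ∣T∣ ∣X∣ disjoint H? h = place-≤ (hiltonMilner m ∷ stars)
      (λ { (here refl) → inj₂ (refl , ≤-refl , ≤-reflexive (sym ∣R∣)) ; (there j) → inj₁ (stars-valid j) }) H?
      (λ F p → proj₁ (h F p) , sat F (proj₂ (h F p)))
      where
      R : List (Fin n)
      R = elems T ++ elems X
      uniqueR : Unique R
      uniqueR = Unique.++⁺ (elems-unique T) (elems-unique X)
        (λ (i , j) → disjoint (∈-elems⁻ X j) (∈-elems⁻ T i))
      open Placement 𝒯 ∣𝒯∣ sizes R uniqueR room
      ∣elemsT∣ : length (elems T) ≡ t
      ∣elemsT∣ = trans (length-elems T) ∣T∣
      ∣R∣ : length R ≡ suc k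
      ∣R∣ = trans (length-++ (elems T)) (trans (cong₂ _+_ ∣elemsT∣ (length-elems X)) (trans (+-comm t _) ∣X∣))
      in-T : ∀ {j} → j < t → nth z R j ∈ T
      in-T {j} lt = subst (_∈ T) (sym (nth-++ˡ z (elems T) (elems X) lt′)) (∈-elems⁻ T (nth-∈ z (elems T) lt′))
        where lt′ = subst (j <_) (sym ∣elemsT∣) lt
      sat : ∀ F → _ → Any (λ κ → Sat κ (lookup F ∘ φ)) (hiltonMilner m ∷ stars)
      sat F (inj₁ a) = let T , T∈ , s = find a in there (sat-star T∈ s)
      sat F (inj₂ (inj₁ (T⊆F , x , x∈X , x∈F))) with nth-index z (∈-elems⁺ x∈X)
      ... | i , lt , e = here (inj₁ ((λ lt′ → ∈⇒lookup (subst (_∈ F) (sym φ-last) (T⊆F (in-T lt′)))) ,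
        length (elems T) + i ,
        subst (length (elems T) + i <_) (trans (sym (length-++ (elems T))) ∣R∣) (+-monoʳ-< (length (elems T)) lt) ,
        ≤-trans (≤-reflexive (sym ∣elemsT∣)) (m≤m+n _ i) ,
        ∈⇒lookup (subst (_∈ F) (sym (trans φ-last (trans (nth-++ʳ z (elems T) (elems X) i) e))) x∈F)))
      sat F (inj₂ (inj₂ (i , i∈T , but , X⊆F))) with nth-index z (∈-elems⁺ i∈T)
      ... | i′ , lt , e = here (inj₂ (i′ , subst (i′ <_) ∣elemsT∣ lt , others))
        where
        others : ∀ {j} → j < suc k → j ≡ i′ ⊎ lookup F (φ (m , j)) ≡ true
        others {j} lt′ with ∈-++⁻ (elems T) (nth-∈ z R (subst (j <_) (sym ∣R∣) lt′))
        ... | inj₂ j∈X = inj₂ (∈⇒lookup (subst (_∈ F) (sym φ-last) (X⊆F (∈-elems⁻ X j∈X))))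
        ... | inj₁ j∈T with but (∈-elems⁻ T j∈T)
        ...   | inj₂ j∈F = inj₂ (∈⇒lookup (subst (_∈ F) (sym φ-last) j∈F))
        ...   | inj₁ e′ = inj₁ (nth-injective z uniqueR (subst (j <_) (sym ∣R∣) lt′)
          (<-≤-trans lt (≤-trans (m≤m+n _ _) (≤-reflexive (sym (length-++ (elems T))))))
          (trans e′ (sym (trans (nth-++ˡ z (elems T) (elems X) lt) e))))

-- Lower bounds for the extremal families

Generated? : ∀ k (L : List (Subset n)) → Decidable (λ F → ∣ F ∣ ≡ k × Any (_⊆ F) L)
Generated? k L F = (∣ F ∣ ≟ k) ×-dec Any.any? (_⊆? F) L

-- A set through `B` that is already generated contains some `A` from `L`, hence `B` with a point of
-- `A` off `B`: at most `d n k (suc ∣ B ∣)` sets for each `A`. This overlap stands on the right to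
-- avoid subtraction.
add-kernel : ∀ k (L : List (Subset n)) (B : Subset n) → (∀ {A} → A ∈ₗ L → ¬ A ⊆ B) →
  # (Generated? k L) + d n k ∣ B ∣ ≤ # (Generated? k (B ∷ L)) + length L * d n k (suc ∣ B ∣)
add-kernel {n} k L B A⊈B = begin
  # (Generated? k L) + d n k ∣ B ∣
    ≡⟨ cong (# (Generated? k L) +_) (sym (star-size k B)) ⟩
  # (Generated? k L) + # (Star? k B)
    ≤⟨ +-monoʳ-≤ _ (#-⊎ (Star? k B) New? Old? split) ⟩
  # (Generated? k L) + (# New? + # Old?)
    ≡⟨ sym (+-assoc (# (Generated? k L)) (# New?) (# Old?)) ⟩
  # (Generated? k L) + # New? + # Old?
    ≤⟨ +-mono-≤ (#-disj (Generated? k L) New? (Generated? k (B ∷ L))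
         (λ _ (e , a) → e , there a) (λ _ ((e , s) , _) → e , here s) (λ _ (_ , a) (_ , ¬a) → ¬a a))
         (#-any L Old? Both? (d n k (suc ∣ B ∣)) (λ { F (st , a) → let A , i , s = find a in A , i , st , s }) both) ⟩
  # (Generated? k (B ∷ L)) + length L * d n k (suc ∣ B ∣) ∎
  where
  open ≤-Reasoning
  New? : Decidable (λ F → (∣ F ∣ ≡ k × B ⊆ F) × ¬ Any (_⊆ F) L)
  New? F = Star? k B F ×-dec ¬? (Any.any? (_⊆? F) L)
  Old? : Decidable (λ F → (∣ F ∣ ≡ k × B ⊆ F) × Any (_⊆ F) L)
  Old? F = Star? k B F ×-dec Any.any? (_⊆? F) L
  Both? : (A : Subset n) → Decidable (λ F → (∣ F ∣ ≡ k × B ⊆ F) × A ⊆ F)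
  Both? A F = Star? k B F ×-dec (A ⊆? F)
  split : ∀ F → ∣ F ∣ ≡ k × B ⊆ F → _
  split F st with Any.any? (_⊆? F) L
  ... | yes a = inj₂ (st , a)
  ... | no ¬a = inj₁ (st , ¬a)
  both : ∀ A → A ∈ₗ L → # (Both? A) ≤ d n k (suc ∣ B ∣)
  both A i with ∉-witness A B (A⊈B i)
  ... | x , x∈A , x∉B = ≤-trans
    (#-mono (Both? A) (Star? k (insert x B))
      (λ { F ((e , s) , A⊆F) → e , insert-⊆ {A = B} {B = F} (A⊆F x∈A) s }))
    (≤-reflexive (trans (star-size k (insert x B)) (cong (d n k) (∣insert∣ B x∉B))))

add-kernels : ∀ k b (L Bs : List (Subset n)) → (∀ {B} → B ∈ₗ Bs → ∣ B ∣ ≡ b) →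
  (∀ {A B} → A ∈ₗ L → B ∈ₗ Bs → ¬ A ⊆ B) → AllPairs (λ B B′ → ¬ B′ ⊆ B) Bs →
  # (Generated? k L) + length Bs * d n k b
    ≤ # (Generated? k (Bs ++ L)) + length Bs * (length Bs + length L) * d n k (suc b)
add-kernels k b L [] _ _ _ = ≤-refl
add-kernels {n} k b L (B ∷ Bs) size L⊈ (p ∷ ps) = begin
  # (Generated? k L) + suc l * d n k b
    ≡⟨ regroup₁ (# (Generated? k L)) (d n k b) (l * d n k b) ⟩
  # (Generated? k L) + l * d n k b + d n k b
    ≤⟨ +-monoˡ-≤ (d n k b) (add-kernels k b L Bs (size ∘ there) (λ i j → L⊈ i (there j)) ps) ⟩
  # (Generated? k (Bs ++ L)) + l * (l + length L) * D + d n k b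
    ≡⟨ regroup₂ (# (Generated? k (Bs ++ L))) (l * (l + length L) * D) (d n k b) ⟩
  # (Generated? k (Bs ++ L)) + d n k b + l * (l + length L) * D
    ≤⟨ +-monoˡ-≤ (l * (l + length L) * D)
         (subst (λ c → # (Generated? k (Bs ++ L)) + d n k c ≤
                       # (Generated? k (B ∷ Bs ++ L)) + length (Bs ++ L) * d n k (suc c))
                (size (here refl)) (add-kernel k (Bs ++ L) B apart)) ⟩
  # (Generated? k (B ∷ Bs ++ L)) + length (Bs ++ L) * D + l * (l + length L) * D
    ≡⟨ cong (λ e → # (Generated? k (B ∷ Bs ++ L)) + e * D + l * (l + length L) * D) (length-++ Bs) ⟩
  # (Generated? k (B ∷ Bs ++ L)) + (l + length L) * D + l * (l + length L) * D
    ≡⟨ regroup₃ (# (Generated? k (B ∷ Bs ++ L))) (l + length L) l D ⟩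
  # (Generated? k (B ∷ Bs ++ L)) + suc l * (l + length L) * D
    ≤⟨ +-monoʳ-≤ _ (*-monoˡ-≤ D (*-monoʳ-≤ (suc l) (n≤1+n (l + length L)))) ⟩
  # (Generated? k (B ∷ Bs ++ L)) + suc l * (suc l + length L) * D ∎
  where
  open ≤-Reasoning
  l = length Bs
  D = d n k (suc b)
  regroup₁ : ∀ a x y → a + (x + y) ≡ a + y + x
  regroup₁ = solve-∀
  regroup₂ : ∀ a x y → a + x + y ≡ a + y + x
  regroup₂ = solve-∀
  regroup₃ : ∀ a x l D → a + x * D + l * x * D ≡ a + suc l * x * D
  regroup₃ = solve-∀
  apart : ∀ {A} → A ∈ₗ Bs ++ L → ¬ A ⊆ B
  apart i with ∈-++⁻ Bs i
  ... | inj₁ j = All.lookup p j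
  ... | inj₂ j = L⊈ j (here refl)

unique⇒allPairs : {X : Set} {R : X → X → Set} {xs : List X} → Unique xs →
  (∀ {x y} → x ∈ₗ xs → y ∈ₗ xs → x ≢ y → R x y) → AllPairs R xs
unique⇒allPairs [] h = []
unique⇒allPairs (u ∷ us) h =
  All.tabulate (λ j → h (here refl) (there j) (All.lookup u j)) ∷
  unique⇒allPairs us (λ i j → h (there i) (there j))

module LowerBounds (k t m : ℕ) (1≤t : 1 ≤ t) (t<k : t < k) (n : ℕ) .{{_ : NonZero n}}
  (N≤n : Kinds.N k t m t<k ≤ n) where

  open Kinds k t m t<k
  open Standard k t m t<k n N≤n

  row-image-unique : ∀ {r l} → (∀ {i} → i < l → (r , i) ∈ₗ allCoords) → Unique (map g (row r l))
  row-image-unique {r} {l} h = AllPairs.map⁺ (AllPairs.map⁺ (unique⇒allPairs (Unique.upTo⁺ l)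
    (λ i j i≢j e → i≢j (cong proj₂ (g-injective (h (∈-upTo⁻ i)) (h (∈-upTo⁻ j)) e)))))

  opaque
    segment : ℕ → ℕ → Subset n
    segment r l = fromList (map g (row r l))

    ∣segment∣ : ∀ {r l} → (∀ {i} → i < l → (r , i) ∈ₗ allCoords) → ∣ segment r l ∣ ≡ l
    ∣segment∣ {r} {l} h = trans (∣fromList∣ (row-image-unique h))
      (trans (length-map g (row r l)) (trans (length-map (r ,_) (upTo l)) (length-upTo l)))

    ∈-segment⁺ : ∀ {r l i} → i < l → g (r , i) ∈ segment r l
    ∈-segment⁺ lt = ∈-fromList⁺ (∈-map⁺ g (∈-row⁺ lt))

    ∈-segment⁻ : ∀ {r l x} → x ∈ segment r l → ∃ λ i → i < l × x ≡ g (r , i)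
    ∈-segment⁻ {r} {l} x∈ with ∈-map⁻ g (∈-fromList⁻ (map g (row r l)) x∈)
    ... | (r′ , i) , j , e with ∈-row⁻ j
    ...   | refl , lt = i , lt , e

  kernels : List (Subset n)
  kernels = map (λ r → segment r t) (upTo m)

  ∈-kernels⁻ : ∀ {A} → A ∈ₗ kernels → ∃ λ r → r < m × A ≡ segment r t
  ∈-kernels⁻ i with ∈-map⁻ _ i
  ... | r , j , e = r , ∈-upTo⁻ j , e

  ∣kernels∣ : length kernels ≡ m
  ∣kernels∣ = trans (length-map _ (upTo m)) (length-upTo m)

  kernel⊈ : ∀ {r B} → g (r , 0) ∉ B → ¬ segment r t ⊆ B
  kernel⊈ ∉ s = ∉ (s (∈-segment⁺ 1≤t))

  stars-≤-generated : # (On.Placed? stars g) ≤ # (Generated? k kernels)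
  stars-≤-generated = #-mono (On.Placed? stars g) (Generated? k kernels) generated
    where
    generated : ∀ F → On.Placed stars g F → ∣ F ∣ ≡ k × Any (_⊆ F) kernels
    generated F (e , a) with find a
    ... | κ , κ∈ , sat with stars-valid κ∈
    ...   | r , refl , r<m = e , lose (∈-map⁺ (λ r → segment r t) (∈-upTo⁺ r<m)) included
      where
      included : segment r t ⊆ F
      included x∈ with ∈-segment⁻ x∈
      ... | i , lt , refl = lookup⇒∈ (sat lt)

  kernel⇒star : ∀ {F A} → A ∈ₗ kernels → A ⊆ F → Any (λ κ → Sat κ (lookup F ∘ g)) stars
  kernel⇒star i A⊆F with ∈-kernels⁻ i
  ... | r , r<m , refl = lose (∈-map⁺ star (∈-upTo⁺ r<m)) λ lt → ∈⇒lookup (A⊆F (∈-segment⁺ lt))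

  stars-lower : m * d n k t ≤ # (On.Placed? stars g) + m * (m + 0) * d n k (suc t)
  stars-lower = begin
    m * d n k t
      ≡⟨ cong (_* d n k t) (sym ∣kernels∣) ⟩
    length kernels * d n k t
      ≤⟨ m≤n+m _ (# (Generated? {n} k [])) ⟩
    # (Generated? {n} k []) + length kernels * d n k t
      ≤⟨ add-kernels k t [] kernels sizes (λ ()) pairs ⟩
    # (Generated? k (kernels ++ [])) + length kernels * (length kernels + 0) * d n k (suc t)
      ≡⟨ cong (λ l → # (Generated? k (kernels ++ [])) + l * (l + 0) * d n k (suc t)) ∣kernels∣ ⟩
    # (Generated? k (kernels ++ [])) + m * (m + 0) * d n k (suc t)
      ≤⟨ +-monoˡ-≤ _ (#-mono (Generated? k (kernels ++ [])) (On.Placed? stars g) placed) ⟩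
    # (On.Placed? stars g) + m * (m + 0) * d n k (suc t) ∎
    where
    open ≤-Reasoning
    sizes : ∀ {B} → B ∈ₗ kernels → ∣ B ∣ ≡ t
    sizes i with ∈-kernels⁻ i
    ... | r , r<m , refl = ∣segment∣ (∈-all-star r<m)
    pairs : AllPairs (λ B B′ → ¬ B′ ⊆ B) kernels
    pairs = AllPairs.map⁺ (unique⇒allPairs (Unique.upTo⁺ m) (λ {r} {r′} i j r≢r′ →
      kernel⊈ {r′} {segment r t} (λ x∈ → let i′ , lt , e = ∈-segment⁻ x∈ in
        r≢r′ (sym (cong proj₁ (g-injective (∈-all-star (∈-upTo⁻ j) 1≤t) (∈-all-star (∈-upTo⁻ i) lt) e))))))
    placed : ∀ F → ∣ F ∣ ≡ k × Any (_⊆ F) (kernels ++ []) → On.Placed stars g F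
    placed F (e , a) with find a
    ... | A , i , s with ∈-++⁻ kernels i
    ...   | inj₁ j = e , kernel⇒star {F} j s

  -- The second-order term: each `(t+1)`-set in row `m` contributes `d n k (suc t)` sets beyond the
  -- stars, up to overlaps. It contains no kernel, because row `m` shares no point with earlier
  -- rows.
  exceptional-lower : ∀ κ b (Bs : List (Subset n)) → (∀ {B} → B ∈ₗ Bs → ∣ B ∣ ≡ suc t) →
    (∀ {B} → B ∈ₗ Bs → B ⊆ segment m (suc k)) → AllPairs (λ B B′ → ¬ B′ ⊆ B) Bs → length Bs ≡ b →
    (∀ {F B} → B ∈ₗ Bs → B ⊆ F → Sat κ (lookup F ∘ g)) →
    # (On.Placed? stars g) + b * d n k (suc t)
      ≤ # (On.Placed? (κ ∷ stars) g) + b * (b + m) * d n k (suc (suc t))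
  exceptional-lower κ b Bs sizes within pairs refl sat = begin
    # (On.Placed? stars g) + length Bs * d n k (suc t)
      ≤⟨ +-monoˡ-≤ _ stars-≤-generated ⟩
    # (Generated? k kernels) + length Bs * d n k (suc t)
      ≤⟨ add-kernels k (suc t) kernels Bs sizes apart pairs ⟩
    # (Generated? k (Bs ++ kernels)) + length Bs * (length Bs + length kernels) * d n k (suc (suc t))
      ≡⟨ cong (λ l → # (Generated? k (Bs ++ kernels)) + length Bs * (length Bs + l) * d n k (suc (suc t))) ∣kernels∣ ⟩
    # (Generated? k (Bs ++ kernels)) + length Bs * (length Bs + m) * d n k (suc (suc t))
      ≤⟨ +-monoˡ-≤ _ (#-mono (Generated? k (Bs ++ kernels)) (On.Placed? (κ ∷ stars) g) placed) ⟩
    # (On.Placed? (κ ∷ stars) g) + length Bs * (length Bs + m) * d n k (suc (suc t)) ∎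
    where
    open ≤-Reasoning
    apart : ∀ {A B} → A ∈ₗ kernels → B ∈ₗ Bs → ¬ A ⊆ B
    apart {A} {B} i j with ∈-kernels⁻ i
    ... | r , r<m , refl = kernel⊈ {r} {B} λ x∈ → let i′ , lt , e = ∈-segment⁻ (within j x∈) in
      <⇒≢ r<m (cong proj₁ (g-injective (∈-all-star r<m 1≤t) (∈-all-last lt) e))
    placed : ∀ F → ∣ F ∣ ≡ k × Any (_⊆ F) (Bs ++ kernels) → On.Placed (κ ∷ stars) g F
    placed F (e , a) with find a
    ... | A , i , s with ∈-++⁻ Bs i
    ...   | inj₁ j = e , here (sat {F} j s)
    ...   | inj₂ j = e , there (kernel⇒star {F} j s)

  triangle-lower : # (On.Placed? stars g) + suc (suc t) * d n k (suc t)
    ≤ # (On.Placed? (triangle m ∷ stars) g) + suc (suc t) * (suc (suc t) + m) * d n k (suc (suc t))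
  triangle-lower = exceptional-lower (triangle m) (suc (suc t)) (map side (upTo (suc (suc t))))
    sizes within (AllPairs.map⁺ (unique⇒allPairs (Unique.upTo⁺ (suc (suc t))) pairs))
    (trans (length-map side (upTo (suc (suc t)))) (length-upTo (suc (suc t)))) sat
    where
    Y : Subset n
    Y = segment m (suc (suc t))
    side : ℕ → Subset n
    side i = Y - g (m , i)
    wide : ∀ {i} → i < suc (suc t) → (m , i) ∈ₗ allCoords
    wide lt = ∈-all-last (≤-trans lt (s≤s t<k))
    sizes : ∀ {B} → B ∈ₗ map side (upTo (suc (suc t))) → ∣ B ∣ ≡ suc t
    sizes i with ∈-map⁻ side i
    ... | r , j , refl = suc-injective (trans (∣-∣ Y (∈-segment⁺ (∈-upTo⁻ j))) (∣segment∣ wide))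
    within : ∀ {B} → B ∈ₗ map side (upTo (suc (suc t))) → B ⊆ segment m (suc k)
    within i x∈ with ∈-map⁻ side i
    ... | r , j , refl with ∈-segment⁻ (proj₁ (∈-⁻ Y x∈))
    ...   | i′ , lt , refl = ∈-segment⁺ (≤-trans lt (s≤s t<k))
    pairs : ∀ {i j} → i ∈ₗ upTo (suc (suc t)) → j ∈ₗ upTo (suc (suc t)) → i ≢ j → ¬ side j ⊆ side i
    pairs {i} {j} i∈ j∈ i≢j s = proj₂ (∈-⁻ {x = g (m , i)} Y (s (x∈p∧x≢y⇒x∈p-y (∈-segment⁺ (∈-upTo⁻ i∈))
      λ e → i≢j (cong proj₂ (g-injective (wide (∈-upTo⁻ i∈)) (wide (∈-upTo⁻ j∈)) e))))) refl
    sat : ∀ {F B} → B ∈ₗ map side (upTo (suc (suc t))) → B ⊆ F → Sat (triangle m) (lookup F ∘ g)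
    sat {F} i B⊆F with ∈-map⁻ side i
    ... | r , j , refl = r , ∈-upTo⁻ j , others
      where
      others : ∀ {i} → i < suc (suc t) → i ≡ r ⊎ lookup F (g (m , i)) ≡ true
      others {i} lt with i ≟ r
      ... | yes e = inj₁ e
      ... | no i≢r = inj₂ (∈⇒lookup (B⊆F (x∈p∧x≢y⇒x∈p-y (∈-segment⁺ lt)
        λ e → i≢r (cong proj₂ (g-injective (wide lt) (wide (∈-upTo⁻ j)) e)))))

  -- One petal for each of the `k + 1 - t` points that have to be met. The sets omitting a kernel
  -- point, only `t` in number, are left out of this lower bound.
  hiltonMilner-lower : # (On.Placed? stars g) + (suc k ∸ t) * d n k (suc t)
    ≤ # (On.Placed? (hiltonMilner m ∷ stars) g)
      + (suc k ∸ t) * ((suc k ∸ t) + m) * d n k (suc (suc t))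
  hiltonMilner-lower = exceptional-lower (hiltonMilner m) (suc k ∸ t) (map petal (upTo (suc k ∸ t)))
    sizes within (AllPairs.map⁺ (unique⇒allPairs (Unique.upTo⁺ (suc k ∸ t)) pairs))
    (trans (length-map petal (upTo (suc k ∸ t))) (length-upTo (suc k ∸ t))) sat
    where
    T : Subset n
    T = segment m t
    petal : ℕ → Subset n
    petal i = insert (g (m , t + i)) T
    reach : ∀ {i} → i ∈ₗ upTo (suc k ∸ t) → t + i < suc k
    reach {i} j = <-≤-trans (+-monoʳ-< t (∈-upTo⁻ j)) (≤-reflexive (m+[n∸m]≡n (m≤n⇒m≤1+n (<⇒≤ t<k))))
    low : ∀ {i} → i < t → (m , i) ∈ₗ allCoords
    low lt = ∈-all-last (<-trans lt (m≤n⇒m≤1+n t<k))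
    petal∉T : ∀ {i} → i ∈ₗ upTo (suc k ∸ t) → g (m , t + i) ∉ T
    petal∉T {i} j x∈ with ∈-segment⁻ x∈
    ... | i′ , lt , e = <⇒≱ lt (≤-trans (m≤m+n t i)
      (≤-reflexive (cong proj₂ (g-injective (∈-all-last (reach j)) (low lt) e))))
    sizes : ∀ {B} → B ∈ₗ map petal (upTo (suc k ∸ t)) → ∣ B ∣ ≡ suc t
    sizes i with ∈-map⁻ petal i
    ... | r , j , refl = trans (∣insert∣ T (petal∉T j)) (cong suc (∣segment∣ low))
    within : ∀ {B} → B ∈ₗ map petal (upTo (suc k ∸ t)) → B ⊆ segment m (suc k)
    within i x∈ with ∈-map⁻ petal i
    ... | r , j , refl with ∈-insert⁻ T x∈
    ...   | inj₁ refl = ∈-segment⁺ (reach j)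
    ...   | inj₂ x∈T with ∈-segment⁻ x∈T
    ...     | i′ , lt , refl = ∈-segment⁺ (<-trans lt (m≤n⇒m≤1+n t<k))
    pairs : ∀ {i j} → i ∈ₗ upTo (suc k ∸ t) → j ∈ₗ upTo (suc k ∸ t) → i ≢ j → ¬ petal j ⊆ petal i
    pairs {i} {j} i∈ j∈ i≢j s with ∈-insert⁻ T (s (x∈insert (g (m , t + j)) T))
    ... | inj₁ e = i≢j (sym (+-cancelˡ-≡ t j i (cong proj₂ (g-injective (∈-all-last (reach j∈)) (∈-all-last (reach i∈)) e))))
    ... | inj₂ x∈T = petal∉T j∈ x∈T
    sat : ∀ {F B} → B ∈ₗ map petal (upTo (suc k ∸ t)) → B ⊆ F → Sat (hiltonMilner m) (lookup F ∘ g)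
    sat i B⊆F with ∈-map⁻ petal i
    ... | r , j , refl = inj₁ ((λ lt → ∈⇒lookup (B⊆F (insert-⊇ (g (m , t + r)) T (∈-segment⁺ lt)))) ,
      t + r , reach j , m≤m+n t r , ∈⇒lookup (B⊆F (x∈insert (g (m , t + r)) T)))

-- The two exceptional blocks for k = 2t+1

#-transfer : {P Q : Subset n → Set} (P? : Decidable P) (Q? : Decidable Q) {X : Set} (L : List X)
  {E E′ : X → Subset n → Set} (E? : ∀ x → Decidable (E x)) (E′? : ∀ x → Decidable (E′ x)) →
  (∀ A → P A → ∃ λ x → x ∈ₗ L × E x A) → (∀ x → x ∈ₗ L → # (E? x) ≤ # (E′? x)) →
  (∀ x A → x ∈ₗ L → E′ x A → Q A) → AllPairs (λ x y → ∀ A → E′ x A → ¬ E′ y A) L →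
  # P? ≤ # Q?
#-transfer P? Q? [] E? E′? covered _ _ _ =
  ≤-trans (≤-reflexive (#-none P? (λ A p → ∉[] (proj₁ (proj₂ (covered A p)))))) z≤n
  where
  ∉[] : ∀ {X : Set} {x : X} → ¬ x ∈ₗ []
  ∉[] ()
#-transfer {P = P} {Q} P? Q? (x ∷ L) {E} {E′} E? E′? covered le within (p ∷ ps) = ≤-trans
  (#-⊎ P? (E? x) P₁? split)
  (≤-trans (+-mono-≤ (le x (here refl))
      (#-transfer P₁? Q₁? L E? E′? later (λ y i → le y (there i))
        (λ y A i e → within y A (there i) e , λ e′ → All.lookup p i A e′ e) ps))
    (#-disj (E′? x) Q₁? Q? (λ A → within x A (here refl)) (λ A → proj₁) (λ A e q → proj₂ q e)))
  where
  -- What `E x` has taken is removed from `P`, so the `E x` may overlap; only the images `E′ x` have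
  -- to be disjoint.
  P₁? : Decidable (λ A → P A × ¬ E x A)
  P₁? A = P? A ×-dec ¬? (E? x A)
  Q₁? : Decidable (λ A → Q A × ¬ E′ x A)
  Q₁? A = Q? A ×-dec ¬? (E′? x A)
  split : ∀ A → P A → E x A ⊎ (P A × ¬ E x A)
  split A p with E? x A
  ... | yes e = inj₁ e
  ... | no ¬e = inj₂ (p , ¬e)
  later : ∀ A → P A × ¬ E x A → ∃ λ y → y ∈ₗ L × E y A
  later A (p , ¬e) with covered A p
  ... | _ , here refl , e = contradiction e ¬e
  ... | y , there i , e = y , i , e

-- A set through the kernel that misses the first two petals and contains the petal i + 2 is
-- sent to the set in which kernel point i and that petal are replaced by the first two petals.
module Tie (t m : ℕ) (t<k : t < suc (t + t)) (n : ℕ) .{{_ : NonZero n}}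
  (N≤n : Kinds.N (suc (t + t)) t m t<k ≤ n) where

  k : ℕ
  k = suc (t + t)

  open Kinds k t m t<k
  open Standard k t m t<k n N≤n

  p : ℕ → Fin n
  p i = g (m , i)

  p-injective : ∀ {i j} → i < suc k → j < suc k → i ≢ j → p i ≢ p j
  p-injective lt lt′ i≢j e = i≢j (cong proj₂ (g-injective (∈-all-last lt) (∈-all-last lt′) e))

  Starry : Subset n → Set
  Starry F = Any (λ κ → Sat κ (lookup F ∘ g)) stars

  Starry? : Decidable Starry
  Starry? F = Any.any? (λ κ → sat? κ (lookup F ∘ g)) stars

  -- Stars read only rows before `m`, and the exchanged points belong to row `m`.
  starry-moved : ∀ {i j} F → i < suc k → j < suc k →
    Starry (F [ p i ]≔ false [ p j ]≔ true) → Starry F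
  starry-moved {i} {j} F i< j< a with find a
  ... | κ , κ∈ , sat with stars-valid κ∈
  ...   | r , refl , r<m = lose κ∈ λ lt → trans (sym (lookup-moved F (off i< lt) (off j< lt))) (sat lt)
    where
    off : ∀ {i j} → i < suc k → j < t → g (r , j) ≢ p i
    off i< lt e = <⇒≢ r<m (cong proj₁ (g-injective (∈-all-star r<m lt) (∈-all-last i<) e))

  KernelBut : (ℕ → Set) → Subset n → Set
  KernelBut Skip F = ∀ {j} → j < t → Skip j ⊎ lookup F (p j) ≡ true

  record Shape (Skip : ℕ → Set) (x₁ x₂ : Bool) (i : ℕ) (y : Bool) (F : Subset n) : Set where
    constructor shape
    field
      size : ∣ F ∣ ≡ k
      plain : ¬ Starry F
      kernel : KernelBut Skip F
      first : lookup F (p t) ≡ x₁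
      second : lookup F (p (suc t)) ≡ x₂
      petal : lookup F (p (suc (suc t) + i)) ≡ y
  open Shape

  shape? : ∀ {Skip : ℕ → Set} → Decidable Skip → ∀ x₁ x₂ i y → Decidable (Shape Skip x₁ x₂ i y)
  shape? {Skip} skip? x₁ x₂ i y F = map′ to from
    ((∣ F ∣ ≟ k) ×-dec ¬? (Starry? F) ×-dec allUpTo? (λ j → skip? j ⊎-dec (lookup F (p j) Bool.≟ true)) t
      ×-dec (lookup F (p t) Bool.≟ x₁) ×-dec (lookup F (p (suc t)) Bool.≟ x₂)
      ×-dec (lookup F (p (suc (suc t) + i)) Bool.≟ y))
    where
    Fields : Set
    Fields = ∣ F ∣ ≡ k × ¬ Starry F × KernelBut Skip F × lookup F (p t) ≡ x₁ ×
      lookup F (p (suc t)) ≡ x₂ × lookup F (p (suc (suc t) + i)) ≡ y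
    to : Fields → Shape Skip x₁ x₂ i y F
    to (a , b , c , d , e , f) = shape a b c d e f
    from : Shape Skip x₁ x₂ i y F → Fields
    from (shape a b c d e f) = a , b , c , d , e , f

  Never : ℕ → Set
  Never _ = Empty.⊥

  -- The exchange in two single moves: from `E₀` to `E₁` kernel point `i` gives way to the first
  -- petal, from `E₁` to `E₂` petal `suc (suc t) + i` to the second. For `k = 2t + 1` exactly `t`
  -- petals remain besides the first two, one for each kernel point.
  E₀ E₁ E₂ : ℕ → Subset n → Set
  E₀ i = Shape Never false false i true
  E₁ i F = Shape (_≡ i) true false i true F × lookup F (p i) ≡ false
  E₂ i F = Shape (_≡ i) true true i false F × lookup F (p i) ≡ false

  E₀? : ∀ i → Decidable (E₀ i)
  E₀? i = shape? (λ _ → no λ ()) false false i true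
  E₁? : ∀ i → Decidable (E₁ i)
  E₁? i F = shape? (_≟ i) true false i true F ×-dec (lookup F (p i) Bool.≟ false)
  E₂? : ∀ i → Decidable (E₂ i)
  E₂? i F = shape? (_≟ i) true true i false F ×-dec (lookup F (p i) Bool.≟ false)

  kernel-< : ∀ {j} → j < t → j < suc k
  kernel-< lt = <-trans lt (m≤n⇒m≤1+n t<k)

  petal-< : ∀ {i} → i < t → suc (suc t) + i < suc k
  petal-< {i} lt = s≤s (s≤s (+-monoʳ-< t lt))

  t< : t < suc k
  t< = m≤n⇒m≤1+n t<k

  1+t< : suc t < suc k
  1+t< = s≤s t<k

  E₀≤E₁ : ∀ i → i < t → # (E₀? i) ≤ # (E₁? i)
  E₀≤E₁ i lt = #-move (E₀? i) (E₁? i) i≢t moved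
    where
    i≢t = p-injective (kernel-< lt) t< (<⇒≢ lt)
    moved : ∀ F → E₀ i F → _
    moved F s = in-kernel lt , first s ,
      shape (trans (∣move∣ F i≢t (in-kernel lt) (first s)) (size s))
        (plain s ∘ starry-moved F (kernel-< lt) t<)
        kernel′ (lookup∘updateAt (p t) (F [ p i ]≔ false))
        (trans (stay 1+t< (<⇒≢ (<-trans lt (n<1+n t))) (<⇒≢ (n<1+n t))) (second s))
        (trans (stay (petal-< lt) (<⇒≢ (<-≤-trans lt (≤-trans (n≤1+n t) (≤-trans (n≤1+n (suc t)) (m≤m+n _ i)))))
                     (<⇒≢ (≤-trans (n≤1+n (suc t)) (m≤m+n (suc (suc t)) i)))) (petal s)) ,
      lookup-moved-from F i≢t
      where
      stay : ∀ {j} → j < suc k → i ≢ j → t ≢ j → lookup (F [ p i ]≔ false [ p t ]≔ true) (p j) ≡ lookup F (p j)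
      stay j< i≢j t≢j = lookup-moved F (p-injective j< (kernel-< lt) (i≢j ∘ sym)) (p-injective j< t< (t≢j ∘ sym))
      in-kernel : ∀ {j} → j < t → lookup F (p j) ≡ true
      in-kernel lt′ with kernel s lt′
      ... | inj₂ e = e
      kernel′ : KernelBut (_≡ i) (F [ p i ]≔ false [ p t ]≔ true)
      kernel′ {j} lt′ with j ≟ i
      ... | yes e = inj₁ e
      ... | no j≢i = inj₂ (trans (stay (kernel-< lt′) (j≢i ∘ sym) (<⇒≢ lt′ ∘ sym)) (in-kernel lt′))

  E₁≤E₂ : ∀ i → i < t → # (E₁? i) ≤ # (E₂? i)
  E₁≤E₂ i lt = #-move (E₁? i) (E₂? i) q≢ moved
    where
    q : ℕ
    q = suc (suc t) + i
    t+2≤q : suc (suc t) ≤ q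
    t+2≤q = m≤m+n (suc (suc t)) i
    q≢ = p-injective (petal-< lt) 1+t< (<⇒≢ t+2≤q ∘ sym)
    moved : ∀ F → E₁ i F → _
    moved F (s , absent) = petal s , second s ,
      shape (trans (∣move∣ F q≢ (petal s) (second s)) (size s))
        (plain s ∘ starry-moved F (petal-< lt) 1+t<)
        (λ lt′ → Sum.map₂ (trans (stay-kernel lt′)) (kernel s lt′))
        (trans (stay t< (<⇒≢ (<-trans (n<1+n t) t+2≤q)) (<⇒≢ (n<1+n t))) (first s))
        (lookup∘updateAt (p (suc t)) (F [ p q ]≔ false))
        (lookup-moved-from F q≢) ,
      trans (stay-kernel lt) absent
      where
      stay : ∀ {j} → j < suc k → j ≢ q → j ≢ suc t → lookup (F [ p q ]≔ false [ p (suc t) ]≔ true) (p j) ≡ lookup F (p j)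
      stay j< j≢q j≢1+t = lookup-moved F (p-injective j< (petal-< lt) j≢q) (p-injective j< 1+t< j≢1+t)
      stay-kernel : ∀ {j} → j < t → lookup (F [ p q ]≔ false [ p (suc t) ]≔ true) (p j) ≡ lookup F (p j)
      stay-kernel lt′ = stay (kernel-< lt′) (<⇒≢ (<-≤-trans lt′ (≤-trans (n≤1+n t) (≤-trans (n≤1+n (suc t)) t+2≤q))))
        (<⇒≢ (m≤n⇒m≤1+n lt′))

  HM? = On.Placed? (hiltonMilner m ∷ stars) g
  Tri? = On.Placed? (triangle m ∷ stars) g

  -- Sets in both families cancel. One that is only in `HM` contains the whole kernel and misses the
  -- first two petals, so it contains a later one and lies in some `E₀ i`.
  tie : # HM? ≤ # Tri?
  tie = ≤-trans (#-⊎ HM? Both? OnlyHM? split) (≤-trans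
    (+-monoʳ-≤ (# Both?) (#-transfer OnlyHM? OnlyTri? (upTo t) E₀? E₂? covered
      (λ i j → ≤-trans (E₀≤E₁ i (∈-upTo⁻ j)) (E₁≤E₂ i (∈-upTo⁻ j)))
      (λ i F j → only-tri i F (∈-upTo⁻ j))
      (unique⇒allPairs (Unique.upTo⁺ t) disjoint)))
    (#-disj Both? OnlyTri? Tri? (λ _ → proj₂) (λ _ → proj₁) (λ _ (h , _) (_ , ¬h) → ¬h h)))
    where
    Both? = λ F → HM? F ×-dec Tri? F
    OnlyHM? = λ F → HM? F ×-dec ¬? (Tri? F)
    OnlyTri? = λ F → Tri? F ×-dec ¬? (HM? F)
    HM = On.Placed (hiltonMilner m ∷ stars) g
    Tri = On.Placed (triangle m ∷ stars) g
    split : ∀ F → HM F → (HM F × Tri F) ⊎ (HM F × ¬ Tri F)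
    split F h with Tri? F
    ... | yes p = inj₁ (h , p)
    ... | no ¬p = inj₂ (h , ¬p)
    covered : ∀ F → HM F × ¬ Tri F → ∃ λ i → i ∈ₗ upTo t × E₀ i F
    covered F ((e , there a) , ¬tri) = contradiction (e , there a) ¬tri
    -- Omitting a single kernel point leaves `t + 1` of the first `t + 2` points of the row.
    covered F ((e , here (inj₂ (i , lt , but))) , ¬tri) =
      ⊥-elim (¬tri (e , here (i , ≤-trans lt (≤-trans (n≤1+n t) (n≤1+n (suc t))) ,
        λ lt′ → but (≤-trans lt′ (s≤s t<k)))))
    covered F ((e , here (inj₁ (ker , j , j< , t≤j , j∈))) , ¬tri) = found
      where
      x₁∉ : lookup F (p t) ≡ false
      x₁∉ with lookup F (p t) in eq
      ... | false = refl
      ... | true = ⊥-elim (¬tri (e , here (suc t , ≤-refl , others)))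
        where
        others : ∀ {j} → j < suc (suc t) → j ≡ suc t ⊎ lookup F (p j) ≡ true
        others {j} lt with <-cmp j t
        ... | tri< lt′ _ _ = inj₂ (ker lt′)
        ... | tri≈ _ refl _ = inj₂ eq
        ... | tri> _ _ gt = inj₁ (≤-antisym (s≤s⁻¹ lt) gt)
      x₂∉ : lookup F (p (suc t)) ≡ false
      x₂∉ with lookup F (p (suc t)) in eq
      ... | false = refl
      ... | true = ⊥-elim (¬tri (e , here (t , n≤1+n (suc t) , others)))
        where
        others : ∀ {j} → j < suc (suc t) → j ≡ t ⊎ lookup F (p j) ≡ true
        others {j} lt with <-cmp j t
        ... | tri< lt′ _ _ = inj₂ (ker lt′)
        ... | tri≈ _ e _ = inj₁ e
        ... | tri> _ _ gt = inj₂ (subst (λ j → lookup F (p j) ≡ true) (≤-antisym gt (s≤s⁻¹ lt)) eq)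
      t≢j : t ≢ j
      t≢j refl = contradiction (trans (sym j∈) x₁∉) λ ()
      1+t≢j : suc t ≢ j
      1+t≢j refl = contradiction (trans (sym j∈) x₂∉) λ ()
      j≡ : suc (suc t) + (j ∸ suc (suc t)) ≡ j
      j≡ = m+[n∸m]≡n (≤∧≢⇒< (≤∧≢⇒< t≤j t≢j) 1+t≢j)
      found : ∃ λ i → i ∈ₗ upTo t × E₀ i F
      found = j ∸ suc (suc t) ,
        ∈-upTo⁺ (+-cancelˡ-< (suc (suc t)) _ _ (subst (_< suc (suc t) + t) (sym j≡) j<)) ,
        shape e (λ a → ¬tri (e , there a)) (λ lt → inj₂ (ker lt)) x₁∉ x₂∉
          (subst (λ j → lookup F (p j) ≡ true) (sym j≡) j∈)
    only-tri : ∀ i F → i < t → E₂ i F → Tri F × ¬ HM F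
    only-tri i F lt (s , absent) = (size s , here (i , ≤-trans lt (≤-trans (n≤1+n t) (n≤1+n (suc t))) , others)) , not-hm
      where
      others : ∀ {j} → j < suc (suc t) → j ≡ i ⊎ lookup F (p j) ≡ true
      others {j} lt′ with <-cmp j t
      ... | tri< lt″ _ _ = kernel s lt″
      ... | tri≈ _ refl _ = inj₂ (first s)
      ... | tri> _ _ gt = inj₂ (subst (λ j → lookup F (p j) ≡ true) (≤-antisym gt (s≤s⁻¹ lt′)) (second s))
      not-hm : ¬ HM F
      not-hm (_ , there a) = plain s a
      not-hm (_ , here (inj₁ (ker , _))) = contradiction (trans (sym (ker lt)) absent) λ ()
      -- This alternative allows one missing point, in the kernel, while a set in `E₂ i` lacks
      -- kernel point `i` and also a petal.
      not-hm (_ , here (inj₂ (i₀ , lt₀ , but))) with but (kernel-< lt) | but (petal-< lt)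
      ... | inj₂ e | _ = contradiction (trans (sym e) absent) λ ()
      ... | inj₁ _ | inj₂ e = contradiction (trans (sym e) (petal s)) λ ()
      ... | inj₁ _ | inj₁ e = <⇒≱ lt₀ (≤-trans (≤-trans (n≤1+n t) (≤-trans (n≤1+n (suc t)) (m≤m+n _ i))) (≤-reflexive e))
    -- The index can be read off: `i` is the only kernel point that a set in `E₂ i` omits.
    disjoint : ∀ {i j} → i ∈ₗ upTo t → j ∈ₗ upTo t → i ≢ j → ∀ F → E₂ i F → ¬ E₂ j F
    disjoint i∈ j∈ i≢j F (s , absent) (s′ , _) with kernel s′ (∈-upTo⁻ i∈)
    ... | inj₁ e = i≢j e
    ... | inj₂ e = contradiction (trans (sym e) absent) λ ()

-- The size of 𝓗

sum-allSubsets : (f : Subset n → ℕ) → sum (map f (allSubsets n)) ≡ S f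
sum-allSubsets {zero} f = +-identityʳ (f [])
sum-allSubsets {suc n} f = begin
  sum (map f (map (true ∷_) (allSubsets n) ++ map (false ∷_) (allSubsets n)))
    ≡⟨ cong sum (map-++ f (map (true ∷_) (allSubsets n)) (map (false ∷_) (allSubsets n))) ⟩
  sum (map f (map (true ∷_) (allSubsets n)) ++ map f (map (false ∷_) (allSubsets n)))
    ≡⟨ sum-++ (map f (map (true ∷_) (allSubsets n))) _ ⟩
  sum (map f (map (true ∷_) (allSubsets n))) + sum (map f (map (false ∷_) (allSubsets n)))
    ≡⟨ cong₂ _+_ (half true) (half false) ⟩
  S (f ∘ (true ∷_)) + S (f ∘ (false ∷_)) ∎
  where
  open ≡-Reasoning
  half : ∀ b → sum (map f (map (b ∷_) (allSubsets n))) ≡ S (f ∘ (b ∷_))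
  half b = trans (cong sum (sym (map-∘ (allSubsets n)))) (sum-allSubsets (f ∘ (b ∷_)))

#≤sizeH : ∀ k t s {P : Subset n → Set} (P? : Decidable P) →
  (∀ A → P A → ∣ A ∣ ≡ k × Hmem k t s A ≡ true) → # P? ≤ sizeH n k t s
#≤sizeH {n} k t s {P} P? h = ≤-trans (S-mono pointwise) (≤-reflexive (sym (sum-allSubsets indicator)))
  where
  indicator : Subset n → ℕ
  indicator A = if (∣ A ∣ ≡ᵇ k) Bool.∧ Hmem k t s A then 1 else 0
  pointwise : ∀ A → 𝟙 (P? A) ≤ indicator A
  pointwise A with P? A
  ... | no _ = z≤n
  ... | yes p = ≤-reflexive (sym (cong (if_then 1 else 0)
    (cong₂ Bool._∧_ (Equivalence.to T-≡ (≡⇒≡ᵇ ∣ A ∣ k (proj₁ (h A p)))) (proj₂ (h A p)))))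

∨-introˡ : ∀ {x y} → x ≡ true → x Bool.∨ y ≡ true
∨-introˡ refl = refl

∨-introʳ : ∀ x {y} → y ≡ true → x Bool.∨ y ≡ true
∨-introʳ x refl = ∨-zeroʳ x

all-true : {X : Set} (p : X → Bool) (L : List X) → (∀ {x} → x ∈ₗ L → p x ≡ true) → all p L ≡ true
all-true p [] h = refl
all-true p (x ∷ L) h = cong₂ Bool._∧_ (h (here refl)) (all-true p L (h ∘ there))

any-true : {X : Set} (p : X → Bool) {L : List X} {x : X} → x ∈ₗ L → p x ≡ true → any p L ≡ true
any-true p (here refl) e = ∨-introˡ e
any-true p {y ∷ L} (there i) e = ∨-introʳ (p y) (any-true p i e)

total : {X : Set} → (X → Bool) → List X → ℕ
total p L = sum (map (λ x → if p x then 1 else 0) L)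

total-all : {X : Set} (p : X → Bool) (L : List X) → (∀ {x} → x ∈ₗ L → p x ≡ true) → total p L ≡ length L
total-all p [] h = refl
total-all p (x ∷ L) h = cong₂ _+_ (cong (if_then 1 else 0) (h (here refl))) (total-all p L (h ∘ there))

total-all-but : {X : Set} (p : X → Bool) {L : List X} (y : X) → Unique L →
  (∀ {x} → x ∈ₗ L → x ≡ y ⊎ p x ≡ true) → length L ≤ suc (total p L)
total-all-but p y [] h = z≤n
total-all-but p {x ∷ L} y (u ∷ us) h with h (here refl)
... | inj₂ e = s≤s (≤-trans (total-all-but p y us (h ∘ there))
  (≤-reflexive (cong (λ b → (if b then 1 else 0) + total p L) (sym e))))
... | inj₁ refl = s≤s (≤-trans (≤-reflexive (sym (total-all p L rest))) (m≤n+m (total p L) _))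
  where
  rest : ∀ {z} → z ∈ₗ L → p z ≡ true
  rest i with h (there i)
  ... | inj₂ e = e
  ... | inj₁ refl = contradiction refl (All.lookup u i)

total-positive : {X : Set} (p : X → Bool) {L : List X} {x : X} → x ∈ₗ L → p x ≡ true → 1 ≤ total p L
total-positive p {L = _ ∷ L} (here refl) e = ≤-trans (≤-reflexive (sym (cong (if_then 1 else 0) e))) (m≤m+n _ (total p L))
total-positive p {L = y ∷ L} (there i) e = ≤-trans (total-positive p i e) (m≤n+m (total p L) _)

∈-range⁺ : ∀ {a b x} → a ≤ x → x ≤ b → x ∈ₗ range a b
∈-range⁺ {a} {b} {x} a≤x x≤b = subst (_∈ₗ range a b) (m+[n∸m]≡n a≤x)
  (∈-map⁺ (a +_) (∈-upTo⁺ (∸-monoˡ-< (s≤s x≤b) a≤x)))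

∈-range⁻ : ∀ {a b x} → x ∈ₗ range a b → a ≤ x × x ≤ b
∈-range⁻ {a} {b} i with ∈-map⁻ (a +_) i
... | j , j∈ , refl = m≤m+n a j , s≤s⁻¹ (subst (_≤ suc b) (+-suc a j)
  (≤-trans (+-monoʳ-≤ a (∈-upTo⁻ j∈)) (≤-reflexive (m+[n∸m]≡n a≤1+b))))
  where
  a≤1+b : a ≤ suc b
  a≤1+b = <⇒≤ (m<n⇒0<n∸m⁻¹ (≤-<-trans z≤n (∈-upTo⁻ j∈)))
    where
    m<n⇒0<n∸m⁻¹ : 0 < suc b ∸ a → a < suc b
    m<n⇒0<n∸m⁻¹ lt = ≰⇒> λ le → <⇒≱ lt (≤-reflexive (m≤n⇒m∸n≡0 le))

range-unique : ∀ a b → Unique (range a b)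
range-unique a b = Unique.map⁺ (+-cancelˡ-≡ a _ _) (Unique.upTo⁺ (suc b ∸ a))

length-range : ∀ a b → length (range a b) ≡ suc b ∸ a
length-range a b = trans (length-map (a +_) (upTo (suc b ∸ a))) (length-upTo (suc b ∸ a))

mem0-lookup : (A : Subset n) (x : Fin n) → mem0 A (Fin.toℕ x) ≡ lookup A x
mem0-lookup (_ ∷ A) zero = refl
mem0-lookup (_ ∷ A) (suc x) = mem0-lookup A x

mem0-true : (A : Subset n) (j : ℕ) → mem0 A j ≡ true → ∃ λ x → Fin.toℕ x ≡ j × x ∈ A
mem0-true (true ∷ A) zero refl = zero , refl , here
mem0-true (_ ∷ A) (suc j) e = let x , e′ , x∈ = mem0-true A j e in suc x , cong suc e′ , there x∈

∧-true : ∀ {x y} → x Bool.∧ y ≡ true → x ≡ true × y ≡ true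
∧-true {true} {true} _ = refl , refl

≤ᵇ-true : ∀ {m n} → m ≤ n → (m ≤ᵇ n) ≡ true
≤ᵇ-true le = Equivalence.to T-≡ (≤⇒≤ᵇ le)

≤ᵇ-true⁻ : ∀ {m n} → (m ≤ᵇ n) ≡ true → m ≤ n
≤ᵇ-true⁻ {m} {n} e = ≤ᵇ⇒≤ m n (Equivalence.from T-≡ e)

not-≡ᵇ : ∀ {i j} → j ≢ i → Bool.not (j ≡ᵇ i) ≡ true
not-≡ᵇ {i} {j} j≢i with j ≡ᵇ i in eq
... | false = refl
... | true = contradiction (≡ᵇ⇒≡ j i (Equivalence.from T-≡ eq)) j≢i

not-≡ᵇ⁻ : ∀ {i j} → Bool.not (j ≡ᵇ i) ≡ true → j ≢ i
not-≡ᵇ⁻ {i} e refl = contradiction (trans (sym e) (cong Bool.not (Equivalence.to T-≡ (≡⇒≡ᵇ i i refl)))) λ ()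

module Extremal (k t m : ℕ) (1≤t : 1 ≤ t) (t<k : t < k) (n : ℕ) .{{_ : NonZero n}}
  (N≤n : Kinds.N k t m t<k ≤ n) where

  open Kinds k t m t<k
  open Standard k t m t<k n N≤n
  open LowerBounds k t m 1≤t t<k n N≤n using (segment; ∣segment∣; ∈-segment⁺; ∈-segment⁻)

  a : ℕ
  a = m * t + 1

  -- Positions count from 0 and elements from 1, hence the shift. The equation for `x` is an
  -- argument so that each use can supply its own form of the index.
  memℕ-g : ∀ A {r i} → (r , i) ∈ₗ allCoords → ∀ {x} → x ≡ r * t + 1 + i → memℕ A x ≡ lookup A (g (r , i))
  memℕ-g A {r} {i} j refl = trans (cong (memℕ A) (shift (r * t) i))
    (trans (cong (mem0 A) (sym (toℕ-g j))) (mem0-lookup A (g (r , i))))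
    where
    shift : ∀ x i → x + 1 + i ≡ suc (x + i)
    shift = solve-∀

  interval : ∀ A r b → (∀ {x} → r * t + 1 ≤ x → x ≤ b → (r , x ∸ (r * t + 1)) ∈ₗ allCoords
                          × lookup A (g (r , x ∸ (r * t + 1))) ≡ true) →
    intervalIn (r * t + 1) b A ≡ true
  interval A r b h = all-true (memℕ A) (range (r * t + 1) b) λ x∈ →
    let lo , hi = ∈-range⁻ x∈ ; j , e = h lo hi
    in trans (memℕ-g A j (sym (m+[n∸m]≡n lo))) e

  offset-< : ∀ {r x l} → x ≤ l + r * t → r * t + 1 ≤ x → x ∸ (r * t + 1) < l
  offset-< {r} {x} {l} hi lo = +-cancelˡ-< (r * t + 1) _ l (subst (_< r * t + 1 + l) (sym (m+[n∸m]≡n lo))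
    (≤-<-trans hi (≤-reflexive (regroup l (r * t)))))
    where
    regroup : ∀ l y → suc (l + y) ≡ y + 1 + l
    regroup = solve-∀

  -- Star `r` is the block that the definition of `𝓗` numbers `r + 1`, and `m` is `s - 1`.
  part1 : ∀ A → Any (λ κ → Sat κ (lookup A ∘ g)) stars → Hpart1 t (suc m) A ≡ true
  part1 A an with find an
  ... | κ , κ∈ , sat with stars-valid κ∈
  ...   | r , refl , r<m = any-true (λ r → intervalIn ((r ∸ 1) * t + 1) (r * t) A)
    (∈-range⁺ {1} {m} (s≤s z≤n) r<m)
    (interval A r (suc r * t) λ lo hi → ∈-all-star r<m (offset-< {r} hi lo) , sat (offset-< {r} hi lo))

  Sat⇒HmemI : ∀ A → Any (λ κ → Sat κ (lookup A ∘ g)) (triangle m ∷ stars) → HmemI k t (suc m) A ≡ true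
  Sat⇒HmemI A (there an) = ∨-introˡ (part1 A an)
  Sat⇒HmemI A (here (i , lt , but)) = ∨-introʳ (Hpart1 t (suc m) A) (≤ᵇ-true many)
    where
    b : ℕ
    b = suc m * t + 2
    len : length (range a b) ≡ suc (suc t)
    len = trans (length-range a b) (trans (cong (_∸ a) (regroup (m * t) t)) (m+n∸m≡n a (suc (suc t))))
      where
      regroup : ∀ y t → suc (t + y + 2) ≡ y + 1 + suc (suc t)
      regroup = solve-∀
    others : ∀ {x} → x ∈ₗ range a b → x ≡ a + i ⊎ memℕ A x ≡ true
    others {x} x∈ = Sum.map (λ e → trans (sym (m+[n∸m]≡n lo)) (cong (a +_) e))
      (trans (memℕ-g A (∈-all-last (≤-trans j< (s≤s t<k))) (sym (m+[n∸m]≡n lo)))) (but j<)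
      where
      lo = proj₁ (∈-range⁻ x∈)
      regroup : ∀ y t → t + y + 2 ≡ suc (suc t) + y
      regroup = solve-∀
      j< : x ∸ a < suc (suc t)
      j< = offset-< {m} (≤-trans (proj₂ (∈-range⁻ x∈)) (≤-reflexive (regroup (m * t) t))) lo
    many : t + 1 ≤ countIn a b A
    many = ≤-trans (≤-reflexive (+-comm t 1)) (s≤s⁻¹ (≤-trans (≤-reflexive (sym len))
      (total-all-but (memℕ A) (a + i) (range-unique a b) others)))

  Sat⇒HmemII : ∀ A → ∣ A ∣ ≡ k → Any (λ κ → Sat κ (lookup A ∘ g)) (hiltonMilner m ∷ stars) →
    HmemII k t (suc m) A ≡ true
  Sat⇒HmemII A _ (there an) = ∨-introˡ (part1 A an)
  Sat⇒HmemII A _ (here (inj₁ (kernel , j , j< , t≤j , e))) =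
    ∨-introʳ (Hpart1 t (suc m) A) (∨-introˡ (cong₂ Bool._∧_
      (interval A m (suc m * t) λ lo hi →
        ∈-all-last (<-trans (offset-< {m} hi lo) (m≤n⇒m≤1+n t<k)) , kernel (offset-< {m} hi lo))
      (≤ᵇ-true (total-positive (memℕ A) (∈-range⁺ lo hi) (trans (memℕ-g A (∈-all-last j<) refl) e)))))
    where
    lo : suc m * t + 1 ≤ a + j
    lo = ≤-trans (≤-reflexive (regroup t (m * t))) (+-monoʳ-≤ a t≤j)
      where
      regroup : ∀ t y → t + y + 1 ≡ y + 1 + t
      regroup = solve-∀
    hi : a + j ≤ m * t + k + 1
    hi = ≤-trans (+-monoʳ-≤ a (s≤s⁻¹ j<)) (≤-reflexive (regroup k (m * t)))
      where
      regroup : ∀ k y → y + 1 + k ≡ y + k + 1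
      regroup = solve-∀
  Sat⇒HmemII A ∣A∣ (here (inj₂ (i , i<t , but))) =
    ∨-introʳ (Hpart1 t (suc m) A) (∨-introʳ _ minus-point)
    where
    b : ℕ
    b = m * t + k + 1
    V : Subset n
    V = segment m (suc k) - g (m , i)
    i< : i < suc k
    i< = <-trans i<t (m≤n⇒m≤1+n t<k)
    V⊆A : V ⊆ A
    V⊆A x∈ with ∈-⁻ (segment m (suc k)) x∈
    ... | x∈Z , x≢ with ∈-segment⁻ x∈Z
    ...   | j , lt , refl with but lt
    ...     | inj₁ refl = contradiction refl x≢
    ...     | inj₂ e = lookup⇒∈ e
    -- Both sets have `k` points, so the inclusion is an equality and the elementwise test holds in
    -- both directions.
    A⊆V : A ⊆ V
    A⊆V = ⊆-full V⊆A (≤-reflexive (trans ∣A∣ (suc-injective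
      (trans (sym (∣segment∣ ∈-all-last)) (sym (∣-∣ (segment m (suc k)) (∈-segment⁺ i<)))))))
    Inside : ℕ → Bool
    Inside j = (a ≤ᵇ j) Bool.∧ (j ≤ᵇ b) Bool.∧ Bool.not (j ≡ᵇ a + i)
    inside⁺ : ∀ {j} → j < suc k → j ≢ i → Inside (a + j) ≡ true
    inside⁺ {j} lt j≢i = cong₂ Bool._∧_ (≤ᵇ-true (m≤m+n a j)) (cong₂ Bool._∧_
      (≤ᵇ-true (≤-trans (+-monoʳ-≤ a (s≤s⁻¹ lt)) (≤-reflexive (regroup k (m * t)))))
      (not-≡ᵇ (j≢i ∘ +-cancelˡ-≡ a j i)))
      where
      regroup : ∀ k y → y + 1 + k ≡ y + k + 1
      regroup = solve-∀
    mem⇒inside : ∀ x → memℕ A x ≡ true → Inside x ≡ true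
    mem⇒inside (suc y) e with mem0-true A y e
    ... | q , refl , q∈A with ∈-⁻ (segment m (suc k)) (A⊆V q∈A)
    ...   | q∈Z , q≢ with ∈-segment⁻ q∈Z
    ...     | j , lt , refl = subst (λ x → Inside x ≡ true)
      (trans (regroup (m * t) j) (cong suc (sym (toℕ-g (∈-all-last lt)))))
      (inside⁺ lt λ { refl → q≢ refl })
      where
      regroup : ∀ y j → y + 1 + j ≡ suc (y + j)
      regroup = solve-∀
    inside⇒mem : ∀ x → Inside x ≡ true → memℕ A x ≡ true
    inside⇒mem x e with ∧-true {a ≤ᵇ x} e
    ... | e₁ , e₂₃ with ∧-true {x ≤ᵇ b} e₂₃
    ...   | e₂ , e₃ = found (but j<)
      where
      lo = ≤ᵇ-true⁻ {a} {x} e₁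
      regroup : ∀ k y → y + k + 1 ≡ suc k + y
      regroup = solve-∀
      j< : x ∸ a < suc k
      j< = offset-< {m} (≤-trans (≤ᵇ-true⁻ {x} {b} e₂) (≤-reflexive (regroup k (m * t)))) lo
      found : x ∸ a ≡ i ⊎ lookup A (g (m , x ∸ a)) ≡ true → memℕ A x ≡ true
      found (inj₁ e′) = contradiction (trans (sym (m+[n∸m]≡n lo)) (cong (a +_) e′)) (not-≡ᵇ⁻ {a + i} {x} e₃)
      found (inj₂ e′) = trans (memℕ-g A (∈-all-last j<) (sym (m+[n∸m]≡n lo))) e′
    -- The unification names the pointwise test, whose helper is local to its definition.
    test : ∃ λ (p : ℕ → ℕ → Bool) →
      intervalMinusPoint a b A ≡ any (λ i → all (p i) (range 1 (n ⊔ b))) (range a b)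
    test = _ , refl
    agree : ∀ x → proj₁ test (a + i) x ≡ true
    agree x with memℕ A x in e₁ | Inside x in e₂
    ... | true | true = refl
    ... | false | false = refl
    ... | true | false = contradiction (trans (sym (mem⇒inside x e₁)) e₂) λ ()
    ... | false | true = contradiction (trans (sym e₁) (inside⇒mem x e₂)) λ ()
    minus-point : intervalMinusPoint a b A ≡ true
    minus-point = any-true _ (∈-range⁺ {a} {b} {a + i} (m≤m+n a i) hi)
      (all-true (proj₁ test (a + i)) (range 1 (n ⊔ b)) (λ {x} _ → agree x))
      where
      hi : a + i ≤ b
      hi = ≤-trans (+-monoʳ-≤ a (s≤s⁻¹ i<)) (≤-reflexive (regroup k (m * t)))
        where
        regroup : ∀ k y → y + 1 + k ≡ y + k + 1
        regroup = solve-∀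

  triangle-≤-sizeH : k ≤ 2 * t + 1 → # (On.Placed? (triangle m ∷ stars) g) ≤ sizeH n k t (suc m)
  triangle-≤-sizeH le = #≤sizeH k t (suc m) (On.Placed? (triangle m ∷ stars) g)
    λ A (e , an) → e , trans (cong (λ c → if c then HmemI k t (suc m) A else HmemII k t (suc m) A) (≤ᵇ-true le))
                             (Sat⇒HmemI A an)

  hiltonMilner-≤-sizeH : ¬ k ≤ 2 * t + 1 → # (On.Placed? (hiltonMilner m ∷ stars) g) ≤ sizeH n k t (suc m)
  hiltonMilner-≤-sizeH ≰ = #≤sizeH k t (suc m) (On.Placed? (hiltonMilner m ∷ stars) g)
    λ A (e , an) → e , trans (cong (λ c → if c then HmemI k t (suc m) A else HmemII k t (suc m) A) ≤ᵇ-false)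
                             (Sat⇒HmemII A e an)
    where
    ≤ᵇ-false : (k ≤ᵇ 2 * t + 1) ≡ false
    ≤ᵇ-false with k ≤ᵇ 2 * t + 1 in eq
    ... | false = refl
    ... | true = contradiction (≤ᵇ-true⁻ eq) ≰

  stars-≤-sizeH : # (On.Placed? stars g) ≤ sizeH n k t (suc m)
  stars-≤-sizeH with k ≤? 2 * t + 1
  ... | yes le = ≤-trans (#-mono (On.Placed? stars g) (On.Placed? (triangle m ∷ stars) g)
    (λ _ (e , an) → e , there an)) (triangle-≤-sizeH le)
  ... | no ≰ = ≤-trans (#-mono (On.Placed? stars g) (On.Placed? (hiltonMilner m ∷ stars) g)
    (λ _ (e , an) → e , there an)) (hiltonMilner-≤-sizeH ≰)

-- Comparison of leading terms and conclusion

module Comparison (k t m M : ℕ) (1≤t : 1 ≤ t) (t<k : t < k)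
  (t+2≤M : suc (suc t) ≤ M) (k<M+t : k < M + t) where

  open Kinds k t m t<k

  -- The factors of `rest-bound` at `s = suc m`, and `sparse-constant`.
  restConstant gapConstant : ℕ
  restConstant = suc m * (2 ^ k * (suc (suc m) * k))
  gapConstant = 2 ^ k * (2 ^ (k + k) * k)

  -- From `n₁` and `n₂` on, `d n k t` and `d n k (suc t)` absorb the errors of both the upper bound
  -- for the family and the lower bound for `𝓗`; `n₃` leaves room to scatter the coordinates.
  n₁ n₂ n₃ : ℕ
  n₁ = (restConstant + m * (m + 0)) * k + suc t
  n₂ = (gapConstant + M * (M + m)) * k + suc (suc t)
  n₃ = suc (length allCoords + length allCoords)

  -- Falling short by one in the coefficient of `p` frees a whole `p`, which pays for both error
  -- terms, `c * q` and `c′ * q`.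
  lower-terms : ∀ x len w p q T c c′ → x + w * p ≤ T + c′ * q → len < w → (c + c′) * q ≤ p →
    x + (len * p + c * q) ≤ T
  lower-terms x len w p q T c c′ le len<w small = +-cancelʳ-≤ (c′ * q) _ T (begin
    x + (len * p + c * q) + c′ * q ≡⟨ regroup x (len * p) c c′ q ⟩
    x + (len * p + (c + c′) * q)   ≤⟨ +-monoʳ-≤ x (+-monoʳ-≤ (len * p) small) ⟩
    x + (len * p + p)              ≡⟨ cong (x +_) (+-comm (len * p) p) ⟩
    x + suc len * p                ≤⟨ +-monoʳ-≤ x (*-monoˡ-≤ p len<w) ⟩
    x + w * p                      ≤⟨ le ⟩
    T + c′ * q                     ∎)
    where
    open ≤-Reasoning
    regroup : ∀ x y c c′ q → x + (y + c * q) + c′ * q ≡ x + (y + (c + c′) * q)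
    regroup = solve-∀

  module _ (n : ℕ) .{{_ : NonZero n}} (n₁≤n : n₁ ≤ n) (n₂≤n : n₂ ≤ n) (n₃≤n : n₃ ≤ n) (N≤n : N ≤ n)
    (𝓕 : List (Subset n)) (distinct : Unique 𝓕) (uniform : All (λ F → ∣ F ∣ ≡ k) 𝓕)
    (ν : NuEq t 𝓕 (suc m)) (τ : TauGt t 𝓕 (suc m)) where

    open Standard k t m t<k n N≤n
    open LowerBounds k t m 1≤t t<k n N≤n using (stars-lower)
    open Matchings k t (suc m) t<k 𝓕 uniform ν τ
    open DecMembership (_≟ₛ_ {n}) using () renaming (_∈?_ to _∈ₗ?_)

    Covered? : Decidable (λ F → F ∈ₗ 𝓕 × Any (_⊆ F) 𝒯)
    Covered? F = (F ∈ₗ? 𝓕) ×-dec Any.any? (_⊆? F) 𝒯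

    covered-or-rest : ∀ F → F ∈ₗ 𝓕 → (F ∈ₗ 𝓕 × Any (_⊆ F) 𝒯) ⊎ Rest F
    covered-or-rest F F∈ with Any.any? (_⊆? F) 𝒯
    ... | yes a = inj₁ (F∈ , a)
    ... | no ¬a = inj₂ (F∈ , All.¬Any⇒All¬ 𝒯 ¬a)

    length-≤ : length 𝓕 ≤ # (_∈ₗ? 𝓕)
    length-≤ = #-length (_∈ₗ? 𝓕) distinct (All.tabulate id)

    split-≤ : length 𝓕 ≤ # Covered? + # Rest?
    split-≤ = ≤-trans length-≤ (#-⊎ (_∈ₗ? 𝓕) Covered? Rest? covered-or-rest)

    𝒯-sizes : ∀ {T} → T ∈ₗ 𝒯 → ∣ T ∣ ≡ t
    𝒯-sizes i = proj₁ (All.lookup 𝒯-large i)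

    -- The stars of `𝓗` alone suffice here: they have at least one more term of order `d n k t`.
    few-kernels : length 𝒯 < m → length 𝓕 ≤ # (On.Placed? stars g)
    few-kernels lt = ≤-trans split-≤ (≤-trans (+-mono-≤ covered-≤ rest-≤)
      (lower-terms 0 (length 𝒯) m (d n k t) (d n k (suc t)) (# (On.Placed? stars g)) restConstant (m * (m + 0))
        stars-lower lt (d-dominates (restConstant + m * (m + 0)) n k t n₁≤n)))
      where
      covered-≤ : # Covered? ≤ length 𝒯 * d n k t
      covered-≤ = #-any 𝒯 Covered? (Star? k) (d n k t)
        (λ F (F∈ , a) → let T , i , s = find a in T , i , size F F∈ , s)
        (λ T i → ≤-reflexive (trans (star-size k T) (cong (d n k) (𝒯-sizes i))))
      rest-≤ : # Rest? ≤ restConstant * d n k (suc t)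
      rest-≤ = ≤-trans rest-bound (≤-reflexive (regroup (suc m) (2 ^ k) (suc (suc m) * k) (d n k (suc t))))
        where
        regroup : ∀ a b c e → a * (b * (c * e)) ≡ a * (b * c) * e
        regroup = solve-∀

    -- The terms of order `d n k t` now agree, so the covered part is bounded exactly, by spreading
    -- the kernels, and only the exceptional part is estimated, at order `d n k (suc t)`.
    all-kernels : length 𝒯 ≡ m → ∀ X → # (On.Placed? stars g) + M * d n k (suc t) ≤ X + M * (M + m) * d n k (suc (suc t)) →
      (M ≤ suc (suc t) → # (On.Placed? (triangle m ∷ stars) g) ≤ X) →
      (M + t ≤ suc k → # (On.Placed? (hiltonMilner m ∷ stars) g) ≤ X) → length 𝓕 ≤ X
    all-kernels ∣𝒯∣ X gap tri hm = conclude structure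
      where
      F₁ : ∃ Rest
      F₁ = let T , _ , ∣T∣ = choose-subset t ⊤ (≤-trans t≤n (≤-reflexive (sym (∣⊤∣≡n n))))
               F , rest , _ = rest-uncovered (cong suc ∣𝒯∣) T ∣T∣
           in F , rest
        where
        t≤n : t ≤ n
        t≤n = ≤-trans (≤-trans (n≤1+n t) (m≤n+m (suc t) _)) n₁≤n
      open Intersecting k t M 1≤t t<k t+2≤M k<M+t Rest? (λ F r → size F (proj₁ r))
        (rest-intersecting (cong suc ∣𝒯∣)) (rest-uncovered (cong suc ∣𝒯∣)) (proj₁ F₁) (proj₂ F₁)
      conclude : length 𝓑 < M ⊎ TriangleType ⊎ HiltonMilnerType → length 𝓕 ≤ X
      conclude (inj₁ lt) = ≤-trans split-≤ (≤-trans (+-mono-≤ covered-≤ bound)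
        (lower-terms (# (On.Placed? stars g)) (length 𝓑) M (d n k (suc t)) (d n k (suc (suc t))) X
          gapConstant (M * (M + m)) gap lt (d-dominates (gapConstant + M * (M + m)) n k (suc t) n₂≤n)))
        where
        covered-≤ : # Covered? ≤ # (On.Placed? stars g)
        covered-≤ = stars-≤ 𝒯 ∣𝒯∣ 𝒯-sizes n₃≤n Covered? (λ F (F∈ , a) → size F F∈ , a)
      conclude (inj₂ (inj₁ (M≤ , Y , ∣Y∣ , shape))) = ≤-trans length-≤ (≤-trans
        (triangle-≤ 𝒯 ∣𝒯∣ 𝒯-sizes n₃≤n Y ∣Y∣ (_∈ₗ? 𝓕)
          (λ F F∈ → size F F∈ , Sum.map proj₂ (shape F) (covered-or-rest F F∈)))
        (tri M≤))
      conclude (inj₂ (inj₂ (M≤ , T , X′ , ∣T∣ , ∣X′∣ , disjoint , shape))) = ≤-trans length-≤ (≤-trans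
        (hiltonMilner-≤ 𝒯 ∣𝒯∣ 𝒯-sizes n₃≤n T X′ ∣T∣ ∣X′∣ disjoint (_∈ₗ? 𝓕)
          (λ F F∈ → size F F∈ , Sum.map proj₂ (shape F) (covered-or-rest F F∈)))
        (hm M≤))

    -- `X` is abstract so that both ranges of `k` share the argument; `M` is the coefficient of
    -- order `d n k (suc t)` that `X` is known to reach beyond the stars.
    comparison : ∀ X → # (On.Placed? stars g) ≤ X →
      # (On.Placed? stars g) + M * d n k (suc t) ≤ X + M * (M + m) * d n k (suc (suc t)) →
      (M ≤ suc (suc t) → # (On.Placed? (triangle m ∷ stars) g) ≤ X) →
      (M + t ≤ suc k → # (On.Placed? (hiltonMilner m ∷ stars) g) ≤ X) → length 𝓕 ≤ X
    comparison X stars≤X gap tri hm with length 𝒯 <? m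
    ... | yes lt = ≤-trans (few-kernels lt) stars≤X
    ... | no ≮ = all-kernels (≤-antisym (s≤s⁻¹ few-large) (≮⇒≥ ≮)) X gap tri hm

  n₀ : ℕ
  n₀ = suc (n₁ + (n₂ + (n₃ + N)))

  module Sizes {n : ℕ} (le : n₀ ≤ n) where
    below : ∀ {x} → x ≤ n₁ + (n₂ + (n₃ + N)) → x ≤ n
    below h = ≤-trans h (≤-trans (n≤1+n _) le)
    n₁≤ : n₁ ≤ n
    n₁≤ = below (m≤m+n n₁ _)
    n₂≤ : n₂ ≤ n
    n₂≤ = below (≤-trans (m≤m+n n₂ _) (m≤n+m _ n₁))
    n₃≤ : n₃ ≤ n
    n₃≤ = below (≤-trans (m≤m+n n₃ N) (≤-trans (m≤n+m _ n₂) (m≤n+m _ n₁)))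
    N≤ : N ≤ n
    N≤ = below (≤-trans (m≤n+m N n₃) (≤-trans (m≤n+m _ n₂) (m≤n+m _ n₁)))
    n≢0 : NonZero n
    n≢0 = >-nonZero (≤-trans (s≤s z≤n) le)

theorem1p4 : (k t s : ℕ) → 1 ≤ t → t < k → 1 ≤ s → 3 ≤ k →
    Σ ℕ λ n₀ → (n : ℕ) → n₀ ≤ n →
    (𝓕 : List (Subset n)) → Unique 𝓕 → All (λ F → ∣ F ∣ ≡ k) 𝓕 →
    NuEq t 𝓕 s → TauGt t 𝓕 s →
    length 𝓕 ≤ sizeH n k t s
theorem1p4 k t (suc m) 1≤t t<k _ _ with k ≤? 2 * t + 1
... | yes k≤2t+1 = n₀ , conclude
  where
  k<M+t : k < suc (suc t) + t
  k<M+t = s≤s (≤-trans k≤2t+1 (≤-reflexive (double t)))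
    where
    double : ∀ t → 2 * t + 1 ≡ suc (t + t)
    double = solve-∀
  -- For `k ≤ 2t + 1` the larger of `t + 2` and `k + 1 - t` is `t + 2`.
  open Comparison k t m (suc (suc t)) 1≤t t<k ≤-refl k<M+t
  conclude : (n : ℕ) → n₀ ≤ n → (𝓕 : List (Subset n)) → Unique 𝓕 → All (λ F → ∣ F ∣ ≡ k) 𝓕 →
    NuEq t 𝓕 (suc m) → TauGt t 𝓕 (suc m) → length 𝓕 ≤ sizeH n k t (suc m)
  conclude n le 𝓕 distinct uniform ν τ =
    comparison n n₁≤ n₂≤ n₃≤ N≤ 𝓕 distinct uniform ν τ (sizeH n k t (suc m)) stars-≤-sizeH
      (≤-trans triangle-lower (+-monoˡ-≤ _ (triangle-≤-sizeH k≤2t+1)))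
      (λ _ → triangle-≤-sizeH k≤2t+1)
      -- A Hilton-Milner family with `M = t + 2` forces `k ≥ 2t + 1`, so `k = 2t + 1` and the exact
      -- comparison of the two blocks applies.
      (λ tight → ≤-trans (tied (s≤s⁻¹ tight)) (triangle-≤-sizeH k≤2t+1))
    where
    open Sizes le
    instance _ = n≢0
    open Standard k t m t<k n N≤
    open LowerBounds k t m 1≤t t<k n N≤ using (triangle-lower)
    open Extremal k t m 1≤t t<k n N≤
    open Kinds k t m t<k using (stars)
    tied : suc (t + t) ≤ k → # (On.Placed? (hiltonMilner m ∷ stars) g) ≤ # (On.Placed? (triangle m ∷ stars) g)
    tied ≤k = by-equality (≤-antisym (≤-trans k≤2t+1 (≤-reflexive (double t))) ≤k) t<k N≤
      where
      double : ∀ t → 2 * t + 1 ≡ suc (t + t)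
      double = solve-∀
      -- `k` is generalised together with `t<k` and `N≤`, whose types depend on it, so that the
      -- equation can be matched by `refl`.
      by-equality : ∀ {k} → k ≡ suc (t + t) → (t<k : t < k) (N≤ : Kinds.N k t m t<k ≤ n) →
        # (Standard.On.Placed? k t m t<k n N≤ (hiltonMilner m ∷ Kinds.stars k t m t<k) (Standard.g k t m t<k n N≤))
        ≤ # (Standard.On.Placed? k t m t<k n N≤ (triangle m ∷ Kinds.stars k t m t<k) (Standard.g k t m t<k n N≤))
      by-equality refl t<k N≤ = Tie.tie t m t<k n N≤
... | no k≰2t+1 = n₀ , conclude
  where
  M : ℕ
  M = suc k ∸ t
  t≤1+k : t ≤ suc k
  t≤1+k = ≤-trans (<⇒≤ t<k) (n≤1+n k)
  2t+2≤k : suc (suc t) + t ≤ k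
  2t+2≤k = ≤-trans (≤-reflexive (double t)) (≰⇒> k≰2t+1)
    where
    double : ∀ t → suc (suc t) + t ≡ suc (2 * t + 1)
    double = solve-∀
  -- Now `k ≥ 2t + 2`, and `k + 1 - t` is the larger number.
  open Comparison k t m M 1≤t t<k (m+n≤o⇒m≤o∸n (suc (suc t)) (≤-trans 2t+2≤k (n≤1+n k)))
    (≤-reflexive (sym (m∸n+n≡m t≤1+k)))
  conclude : (n : ℕ) → n₀ ≤ n → (𝓕 : List (Subset n)) → Unique 𝓕 → All (λ F → ∣ F ∣ ≡ k) 𝓕 →
    NuEq t 𝓕 (suc m) → TauGt t 𝓕 (suc m) → length 𝓕 ≤ sizeH n k t (suc m)
  conclude n le 𝓕 distinct uniform ν τ =
    comparison n n₁≤ n₂≤ n₃≤ N≤ 𝓕 distinct uniform ν τ (sizeH n k t (suc m)) stars-≤-sizeH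
      (≤-trans hiltonMilner-lower (+-monoˡ-≤ _ (hiltonMilner-≤-sizeH k≰2t+1)))
      -- A triangle would need `k + 1 - t ≤ t + 2`.
      (λ M≤ → contradiction (≤-trans (≤-reflexive (sym (m∸n+n≡m t≤1+k))) (+-monoˡ-≤ t M≤)) (<⇒≱ (s≤s 2t+2≤k)))
      (λ _ → hiltonMilner-≤-sizeH k≰2t+1)
    where
    open Sizes le
    instance _ = n≢0
    open LowerBounds k t m 1≤t t<k n N≤ using (hiltonMilner-lower)
    open Extremal k t m 1≤t t<k n N≤
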